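{- There is an absolute constant $K>0$ such that the following holds. Let $p>2$ be a prime, $n\ge1$, and let $f:\mathbb{Z}_p^n\to\{+1,-1\}$ be such that $\|\hat f\|_1=A$ and $|\{\alpha\mid\hat f(\alpha)\ne0\}|=s$. Then $f$ can be computed by a $\oplus_p$-DT of depth at most $KA^2\log s$.
   Context: Let $\omega=e^{2\pi i/p}$ and, for $\alpha\in\mathbb{Z}_p^n$, $\chi_\alpha(x)=\omega^{\langle\alpha,x\rangle}$. For $f:\mathbb{Z}_p^n\to\mathbb{C}$, $\hat f(\alpha)=\mathbb{E}_x[f(x)\overline{\chi_\alpha(x)}]$ ($x$ uniform in $\mathbb{Z}_p^n$), and $\|\hat f\|_1=\sum_{\alpha\in\mathbb{Z}_p^n}|\hat f(\alpha)|$. A $p$-ary linear decision tree ($\oplus_p$-DT) is a tree in which every internal node is labeled by a linear function $\gamma\in\mathbb{Z}_p^n$ and has $p$ children, the edges to which are labeled $0,1,\dots,p-1$, and every leaf is labeled by a value in $\{+1,-1\}$. On input $x$, at an internal node labeled $\gamma$ one follows the edge labeled $\langle\gamma,x\rangle \bmod p$; at a leaf one outputs its label. The tree computes $f$ if it outputs $f(x)$ on every input $x$. Its depth is the maximal number of edges on a root-to-leaf path. -}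

module Defs where

open import Algebra.Bundles.Raw using (RawMonoid; RawRing)
import Algebra.Definitions.RawMonoid as MonoidDefs
import Algebra.Definitions.RawSemiring as SemiringDefs
open import Data.Empty using (⊥; ⊥-elim)
open import Data.Fin.Base using (Fin; toℕ)
open import Data.Integer.Base as ℤ using (+_)
import Data.Integer.Properties as ℤₚ
open import Data.List.Base using (List; length)
open import Data.List.Membership.Propositional using (_∈_)
open import Data.List.Relation.Unary.Unique.Propositional using (Unique)
open import Data.Nat.Base as ℕ using (ℕ; zero; suc; _!; s≤s)
open import Data.Nat.DivMod using (_mod_)
import Data.Nat.Properties as ℕₚ
open import Data.Product.Base using (Σ; ∃-syntax; _×_; _,_; proj₁; proj₂)
open import Data.Rational.Base as ℚ
  using (ℚ; 0ℚ; 1ℚ; ½; _/_; 1/_; _+_; _*_; _-_; -_; ∣_∣; _≤_; _<_; *<*; *≤*)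
open import Data.Rational.Properties
import Data.Rational.Solver as ℚSolver
open import Data.Rational.Unnormalised.Base as ℚᵘ using (mkℚᵘ)
import Data.Rational.Unnormalised.Properties as ℚᵘₚ
open import Data.Sign.Base as Sign using (Sign)
open import Data.Sum.Base using (_⊎_; inj₁; inj₂)
open import Data.Vec.Base as Vec using (Vec; []; _∷_)
import Data.Vec.Functional as Vector
open import Function.Bundles using (_⇔_)
open import Level using (0ℓ)
open import Relation.Binary.PropositionalEquality
  using (_≡_; refl; sym; trans; cong; cong₂; subst; subst₂)
open import Relation.Nullary using (¬_; yes; no)

private
  0<½* : ∀ {ε} → 0ℚ < ε → 0ℚ < ½ * ε
  0<½* {ε} ε>0 = positive⁻¹ _ {{pos*pos⇒pos ½ ε {{ℚ.positive ε>0}}}}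

  0<* : ∀ {p q} → 0ℚ < p → 0ℚ < q → 0ℚ < p * q
  0<* {p} {q} p>0 q>0 =
    positive⁻¹ _ {{pos*pos⇒pos p {{ℚ.positive p>0}} q {{ℚ.positive q>0}}}}

  halves : ∀ ε → ½ * ε + ½ * ε ≡ ε
  halves ε = trans (sym (*-distribʳ-+ ε ½ ½)) (*-identityˡ ε)

  *-mono-≤ : ∀ {a b c d} → 0ℚ ≤ b → 0ℚ ≤ c → a ≤ b → c ≤ d → a * c ≤ b * d
  *-mono-≤ {a} {b} {c} {d} 0≤b 0≤c a≤b c≤d = ≤-trans
    (*-monoʳ-≤-nonNeg c {{ℚ.nonNegative 0≤c}} a≤b)
    (*-monoˡ-≤-nonNeg b {{ℚ.nonNegative 0≤b}} c≤d)

  p≤∣p∣ : ∀ p → p ≤ ∣ p ∣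
  p≤∣p∣ p with ≤-total 0ℚ p
  ... | inj₁ 0≤p = ≤-reflexive (sym (0≤p⇒∣p∣≡p 0≤p))
  ... | inj₂ p≤0 = ≤-trans p≤0 (0≤∣p∣ p)

  ∣-∣-bound : ∀ p q r → p ≤ q + r → q ≤ p + r → ∣ p - q ∣ ≤ r
  ∣-∣-bound p q r h₁ h₂ with ∣p∣≡p∨∣p∣≡-p (p - q)
  ... | inj₁ e = subst₂ _≤_ (sym e)
      (solve 2 (λ q r → q :+ r :- q := r) refl q r) (+-monoˡ-≤ (- q) h₁)
    where open ℚSolver.+-*-Solver
  ... | inj₂ e = subst₂ _≤_
      (trans (solve 2 (λ p q → q :- p := :- (p :- q)) refl p q) (sym e))
      (solve 2 (λ p r → p :+ r :- p := r) refl p r) (+-monoˡ-≤ (- p) h₂)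
    where open ℚSolver.+-*-Solver

IsCauchy : (ℕ → ℚ) → Set
IsCauchy u = ∀ ε → 0ℚ < ε →
  ∃[ N ] ∀ m n → N ℕ.≤ m → N ℕ.≤ n → ∣ u m - u n ∣ ≤ ε

-- Reals are Cauchy sequences of rationals.  The modulus is part of the data,
-- and the equality of reals is _≃ℝ_, not _≡_.
record ℝ : Set where
  constructor mkℝ
  field
    seq    : ℕ → ℚ
    cauchy : IsCauchy seq

open ℝ public

infix 4 _≃ℝ_ _≤ℝ_ _<ℝ_

_≃ℝ_ : ℝ → ℝ → Set
x ≃ℝ y = ∀ ε → 0ℚ < ε → ∃[ N ] ∀ n → N ℕ.≤ n → ∣ seq x n - seq y n ∣ ≤ ε

_≤ℝ_ : ℝ → ℝ → Set
x ≤ℝ y = ∀ ε → 0ℚ < ε → ∃[ N ] ∀ n → N ℕ.≤ n → seq x n ≤ seq y n + ε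

_<ℝ_ : ℝ → ℝ → Set
x <ℝ y = ∃[ ε ] 0ℚ < ε × ∃[ N ] ∀ n → N ℕ.≤ n → seq x n + ε ≤ seq y n

fromℚ : ℚ → ℝ
fromℚ q = mkℝ (λ _ → q) λ ε ε>0 → 0 , λ _ _ _ _ →
  subst (λ d → ∣ d ∣ ≤ ε) (sym (+-inverseʳ q)) (<⇒≤ ε>0)

fromℕ : ℕ → ℝ
fromℕ n = fromℚ (+ n / 1)

0ℝ 1ℝ : ℝ
0ℝ = fromℚ 0ℚ
1ℝ = fromℚ 1ℚ

private
  +-cauchy : ∀ {u v} → IsCauchy u → IsCauchy v → IsCauchy (λ n → u n + v n)
  +-cauchy {u} {v} cu cv ε ε>0 =
    N₁ ℕ.⊔ N₂ , λ m n N≤m N≤n → subst₂ _≤_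
      (cong ∣_∣ (solve 4 (λ a b c d → (a :- b) :+ (c :- d) := (a :+ c) :- (b :+ d))
                  refl (u m) (u n) (v m) (v n)))
      (halves ε)
      (≤-trans (∣p+q∣≤∣p∣+∣q∣ (u m - u n) (v m - v n))
        (+-mono-≤
          (h₁ m n (ℕₚ.m⊔n≤o⇒m≤o N₁ N₂ N≤m) (ℕₚ.m⊔n≤o⇒m≤o N₁ N₂ N≤n))
          (h₂ m n (ℕₚ.m⊔n≤o⇒n≤o N₁ N₂ N≤m) (ℕₚ.m⊔n≤o⇒n≤o N₁ N₂ N≤n))))
    where
    open ℚSolver.+-*-Solver
    N₁ = proj₁ (cu (½ * ε) (0<½* ε>0))
    N₂ = proj₁ (cv (½ * ε) (0<½* ε>0))
    h₁ = proj₂ (cu (½ * ε) (0<½* ε>0))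
    h₂ = proj₂ (cv (½ * ε) (0<½* ε>0))

  neg-cauchy : ∀ {u} → IsCauchy u → IsCauchy (λ n → - u n)
  neg-cauchy {u} cu ε ε>0 = proj₁ (cu ε ε>0) , λ m n N≤m N≤n → subst (_≤ ε)
    (trans (sym (∣-p∣≡∣p∣ (u m - u n)))
      (cong ∣_∣ (solve 2 (λ a b → :- (a :- b) := :- a :- :- b) refl (u m) (u n))))
    (proj₂ (cu ε ε>0) m n N≤m N≤n)
    where open ℚSolver.+-*-Solver

  eventually-bounded : ∀ {u} → IsCauchy u →
    ∃[ B ] 0ℚ < B × ∃[ N ] ∀ n → N ℕ.≤ n → ∣ u n ∣ ≤ B
  eventually-bounded {u} cu =
    1ℚ + ∣ u N ∣ ,
    <-≤-trans 0<1 (subst (_≤ 1ℚ + ∣ u N ∣) (+-identityʳ 1ℚ)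
      (+-monoʳ-≤ 1ℚ (0≤∣p∣ (u N)))) ,
    N , λ n N≤n → ≤-trans
      (subst (λ d → ∣ d ∣ ≤ ∣ u n - u N ∣ + ∣ u N ∣)
        (solve 2 (λ a b → a :- b :+ b := a) refl (u n) (u N))
        (∣p+q∣≤∣p∣+∣q∣ (u n - u N) (u N)))
      (+-monoˡ-≤ ∣ u N ∣ (proj₂ (cu 1ℚ 0<1) n N N≤n ℕₚ.≤-refl))
    where
    open ℚSolver.+-*-Solver
    0<1 : 0ℚ < 1ℚ
    0<1 = positive⁻¹ 1ℚ
    N = proj₁ (cu 1ℚ 0<1)

  share : ∀ ε C → 0ℚ < ε → 0ℚ < C → ∃[ δ ] 0ℚ < δ × δ * C ≡ ½ * ε
  share ε C ε>0 C>0 =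
    ½ * ε * 1/ C ,
    0<* (0<½* ε>0) (positive⁻¹ (1/ C) {{1/pos⇒pos C}}) ,
    trans (*-assoc (½ * ε) (1/ C) C)
      (trans (cong (½ * ε *_) (*-inverseˡ C)) (*-identityʳ (½ * ε)))
    where
    instance
      C-pos : ℚ.Positive C
      C-pos = ℚ.positive C>0
      C-nz : ℚ.NonZero C
      C-nz = pos⇒nonZero C

  ∣ac-bd∣-bound : ∀ {B C δ₁ δ₂} a b c d → 0ℚ ≤ C → 0ℚ ≤ B → 0ℚ ≤ δ₂ →
    ∣ a ∣ ≤ B → ∣ d ∣ ≤ C → ∣ a - b ∣ ≤ δ₁ → ∣ c - d ∣ ≤ δ₂ →
    ∣ a * c - b * d ∣ ≤ δ₁ * C + δ₂ * B
  ∣ac-bd∣-bound {B} {C} {δ₁} {δ₂} a b c d 0≤C 0≤B 0≤δ₂ ha hd hab hcd = begin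
    ∣ a * c - b * d ∣
      ≡⟨ cong ∣_∣ (solve 4 (λ a b c d →
           a :* c :- b :* d := d :* (a :- b) :+ (c :- d) :* a) refl a b c d) ⟩
    ∣ d * (a - b) + (c - d) * a ∣
      ≤⟨ ∣p+q∣≤∣p∣+∣q∣ (d * (a - b)) ((c - d) * a) ⟩
    ∣ d * (a - b) ∣ + ∣ (c - d) * a ∣
      ≡⟨ cong₂ _+_ (∣p*q∣≡∣p∣*∣q∣ d (a - b)) (∣p*q∣≡∣p∣*∣q∣ (c - d) a) ⟩
    ∣ d ∣ * ∣ a - b ∣ + ∣ c - d ∣ * ∣ a ∣
      ≤⟨ +-mono-≤ (*-mono-≤ 0≤C (0≤∣p∣ (a - b)) hd hab)
                  (*-mono-≤ 0≤δ₂ (0≤∣p∣ a) hcd ha) ⟩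
    C * δ₁ + δ₂ * B
      ≡⟨ cong (λ e → e + δ₂ * B) (*-comm C δ₁) ⟩
    δ₁ * C + δ₂ * B ∎
    where
    open ≤-Reasoning
    open ℚSolver.+-*-Solver using (solve; _:+_; _:*_; _:-_; _:=_)

  *-cauchy : ∀ {u v} → IsCauchy u → IsCauchy v → IsCauchy (λ n → u n * v n)
  *-cauchy {u} {v} cu cv ε ε>0 =
    let B , B>0 , M₁ , b = eventually-bounded {u} cu
        C , C>0 , M₂ , c = eventually-bounded {v} cv
        δ₁ , δ₁>0 , δ₁C≡ = share ε C ε>0 C>0
        δ₂ , δ₂>0 , δ₂B≡ = share ε B ε>0 B>0
        N₁ , h₁ = cu δ₁ δ₁>0
        N₂ , h₂ = cv δ₂ δ₂>0
        M = M₁ ℕ.⊔ M₂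
        N = N₁ ℕ.⊔ N₂
    in M ℕ.⊔ N , λ m n ≤m ≤n →
      let M≤m = ℕₚ.m⊔n≤o⇒m≤o M N ≤m
          M≤n = ℕₚ.m⊔n≤o⇒m≤o M N ≤n
          N≤m = ℕₚ.m⊔n≤o⇒n≤o M N ≤m
          N≤n = ℕₚ.m⊔n≤o⇒n≤o M N ≤n
      in subst (∣ u m * v m - u n * v n ∣ ≤_)
           (trans (cong₂ _+_ δ₁C≡ δ₂B≡) (halves ε))
           (∣ac-bd∣-bound (u m) (u n) (v m) (v n) (<⇒≤ C>0) (<⇒≤ B>0) (<⇒≤ δ₂>0)
             (b m (ℕₚ.m⊔n≤o⇒m≤o M₁ M₂ M≤m))
             (c n (ℕₚ.m⊔n≤o⇒n≤o M₁ M₂ M≤n))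
             (h₁ m n (ℕₚ.m⊔n≤o⇒m≤o N₁ N₂ N≤m) (ℕₚ.m⊔n≤o⇒m≤o N₁ N₂ N≤n))
             (h₂ m n (ℕₚ.m⊔n≤o⇒n≤o N₁ N₂ N≤m) (ℕₚ.m⊔n≤o⇒n≤o N₁ N₂ N≤n)))

infixl 6 _+ℝ_
infixl 7 _*ℝ_
infix  8 -ℝ_

_+ℝ_ : ℝ → ℝ → ℝ
x +ℝ y = mkℝ (λ n → seq x n + seq y n) (+-cauchy {seq x} {seq y} (cauchy x) (cauchy y))

-ℝ_ : ℝ → ℝ
-ℝ x = mkℝ (λ n → - seq x n) (neg-cauchy {seq x} (cauchy x))

_*ℝ_ : ℝ → ℝ → ℝ
x *ℝ y = mkℝ (λ n → seq x n * seq y n) (*-cauchy {seq x} {seq y} (cauchy x) (cauchy y))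

ℝ-rawRing : RawRing 0ℓ 0ℓ
ℝ-rawRing = record
  { Carrier = ℝ ; _≈_ = _≃ℝ_ ; _+_ = _+ℝ_ ; _*_ = _*ℝ_ ; -_ = -ℝ_ ; 0# = 0ℝ ; 1# = 1ℝ }

-- The largest j/(k+1) with j ≤ b and (j/(k+1))² ≤ q (or 0 if there is none).
searchRoot : ℚ → ℕ → ℕ → ℚ
searchRoot q k zero    = 0ℚ
searchRoot q k (suc b) with (+ suc b / suc k) * (+ suc b / suc k) ≤? q
... | yes _ = + suc b / suc k
... | no  _ = searchRoot q k b

-- As (∣↥ q∣ + 1)² > q, the search range contains every candidate, so
-- rootℚ q k is within 1/(k+1) of the square root of max q 0.
rootℚ : ℚ → ℕ → ℚ
rootℚ q k = searchRoot q k (suc ℤ.∣ ℚ.↥ q ∣ ℕ.* suc k)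

private
  open ℚSolver.+-*-Solver using (solve; _:+_; _:*_; _:-_; :-_; _:=_)

  toℚᵘ-/ : ∀ i k → ℚ.toℚᵘ (i / suc k) ℚᵘ.≃ mkℚᵘ i k
  toℚᵘ-/ i k = toℚᵘ-fromℚᵘ (mkℚᵘ i k)

  suc-/ : ∀ j k → + j / suc k + + 1 / suc k ≡ + suc j / suc k
  suc-/ j k = toℚᵘ-injective (begin
    ℚ.toℚᵘ (+ j / suc k + + 1 / suc k)
      ≈⟨ toℚᵘ-homo-+ (+ j / suc k) (+ 1 / suc k) ⟩
    ℚ.toℚᵘ (+ j / suc k) ℚᵘ.+ ℚ.toℚᵘ (+ 1 / suc k)
      ≈⟨ ℚᵘₚ.+-cong (toℚᵘ-/ (+ j) k) (toℚᵘ-/ (+ 1) k) ⟩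
    mkℚᵘ (+ j) k ℚᵘ.+ mkℚᵘ (+ 1) k
      ≈⟨ ℚᵘ.*≡* eq ⟩
    mkℚᵘ (+ suc j) k
      ≈⟨ ℚᵘₚ.≃-sym (toℚᵘ-/ (+ suc j) k) ⟩
    ℚ.toℚᵘ (+ suc j / suc k) ∎)
    where
    open ℚᵘₚ.≃-Reasoning
    K = + suc k
    eq : (+ j ℤ.* K ℤ.+ + 1 ℤ.* K) ℤ.* K ≡ + suc j ℤ.* (K ℤ.* K)
    eq = trans (cong (ℤ._* K) (sym (ℤₚ.*-distribʳ-+ K (+ j) (+ 1))))
      (trans (ℤₚ.*-assoc (+ j ℤ.+ + 1) K K)
        (cong (ℤ._* (K ℤ.* K)) (ℤₚ.+-comm (+ j) (+ 1))))

  0≤/ : ∀ j k → 0ℚ ≤ + j / suc k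
  0≤/ j k = nonNegative⁻¹ _ {{normalize-nonNeg j (suc k)}}

  archimedean : ∀ ε → 0ℚ < ε → ∀ n → ℚ.denominator-1 ε ℕ.≤ n → + 1 / suc n ≤ ε
  archimedean ε@(ℚ.mkℚ (+ zero) d _) (*<* (ℤ.+<+ ())) n d≤n
  archimedean ε@(ℚ.mkℚ (ℤ.-[1+ a ]) d _) (*<* ()) n d≤n
  archimedean ε@(ℚ.mkℚ (+ suc a) d _) ε>0 n d≤n = toℚᵘ-cancel-≤
    (ℚᵘₚ.≤-respˡ-≃ (ℚᵘₚ.≃-sym (toℚᵘ-/ (+ 1) n))
      (ℚᵘ.*≤* (subst₂ ℤ._≤_ (ℤₚ.pos-* 1 (suc d)) (ℤₚ.pos-* (suc a) (suc n))
        (ℤ.+≤+ (ℕₚ.*-mono-≤ (s≤s (ℕ.z≤n {a})) (s≤s d≤n))))))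

  search-nonneg : ∀ q k b → 0ℚ ≤ searchRoot q k b
  search-nonneg q k zero = ≤-refl
  search-nonneg q k (suc b) with (+ suc b / suc k) * (+ suc b / suc k) ≤? q
  ... | yes _ = 0≤/ (suc b) k
  ... | no  _ = search-nonneg q k b

  search-below : ∀ q k b → searchRoot q k b ≡ 0ℚ ⊎ searchRoot q k b * searchRoot q k b ≤ q
  search-below q k zero = inj₁ refl
  search-below q k (suc b) with (+ suc b / suc k) * (+ suc b / suc k) ≤? q
  ... | yes h = inj₂ h
  ... | no  _ = search-below q k b

  search-above : ∀ q k b → q < (+ suc b / suc k) * (+ suc b / suc k) →
    let r = searchRoot q k b + + 1 / suc k in q < r * r
  search-above q k zero h = subst (λ r → q < r * r) (sym (+-identityˡ (+ 1 / suc k))) h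
  search-above q k (suc b) h with (+ suc b / suc k) * (+ suc b / suc k) ≤? q
  ... | yes _ = subst (λ r → q < r * r) (sym (suc-/ (suc b) k)) h
  ... | no ¬h = search-above q k b (≰⇒> ¬h)

root-nonneg : ∀ q k → 0ℚ ≤ rootℚ q k
root-nonneg q k = search-nonneg q k (suc ℤ.∣ ℚ.↥ q ∣ ℕ.* suc k)

root-below : ∀ q k → rootℚ q k ≡ 0ℚ ⊎ rootℚ q k * rootℚ q k ≤ q
root-below q k = search-below q k (suc ℤ.∣ ℚ.↥ q ∣ ℕ.* suc k)

root-above : ∀ q k → let r = rootℚ q k + + 1 / suc k in q < r * r
root-above q k = search-above q k J (<-≤-trans q<c c≤)
  where
  J = suc ℤ.∣ ℚ.↥ q ∣ ℕ.* suc k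
  c = + suc ℤ.∣ ℚ.↥ q ∣ / 1
  r = + suc J / suc k
  q<c : q < c
  q<c = toℚᵘ-cancel-< (ℚᵘₚ.<-respʳ-≃ (ℚᵘₚ.≃-sym (toℚᵘ-/ (+ suc ℤ.∣ ℚ.↥ q ∣) 0)) (lem q))
    where
    lem : ∀ q → ℚ.toℚᵘ q ℚᵘ.< mkℚᵘ (+ suc ℤ.∣ ℚ.↥ q ∣) 0
    lem (ℚ.mkℚ (+ a) d _) = ℚᵘ.*<* (subst₂ ℤ._<_ (ℤₚ.pos-* a 1) (ℤₚ.pos-* (suc a) (suc d))
      (ℤ.+<+ (ℕₚ.<-≤-trans (subst (ℕ._< suc a) (sym (ℕₚ.*-identityʳ a)) (ℕₚ.n<1+n a))
        (ℕₚ.m≤m*n (suc a) (suc d)))))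
    lem (ℚ.mkℚ ℤ.-[1+ a ] d _) = ℚᵘ.*<* ℤ.-<+
  1≤c : 1ℚ ≤ c
  1≤c = toℚᵘ-cancel-≤ (ℚᵘₚ.≤-respʳ-≃ (ℚᵘₚ.≃-sym (toℚᵘ-/ (+ suc ℤ.∣ ℚ.↥ q ∣) 0))
    (ℚᵘ.*≤* (ℤ.+≤+ (s≤s ℕ.z≤n))))
  c≤r : c ≤ r
  c≤r = toℚᵘ-cancel-≤ (ℚᵘₚ.≤-respˡ-≃ (ℚᵘₚ.≃-sym (toℚᵘ-/ (+ suc ℤ.∣ ℚ.↥ q ∣) 0))
    (ℚᵘₚ.≤-respʳ-≃ (ℚᵘₚ.≃-sym (toℚᵘ-/ (+ suc J) k))
      (ℚᵘ.*≤* (subst₂ ℤ._≤_ (ℤₚ.pos-* (suc ℤ.∣ ℚ.↥ q ∣) (suc k)) (ℤₚ.pos-* (suc J) 1)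
        (ℤ.+≤+ (subst (J ℕ.≤_) (sym (ℕₚ.*-identityʳ (suc J))) (ℕₚ.n≤1+n J)))))))
  0≤r : 0ℚ ≤ r
  0≤r = 0≤/ (suc J) k
  c≤ : c ≤ r * r
  c≤ = subst (_≤ r * r) (*-identityʳ c)
    (*-mono-≤ 0≤r (<⇒≤ (positive⁻¹ 1ℚ)) c≤r (≤-trans 1≤c c≤r))

private
  close : ∀ p q s t η ε → 0ℚ < ε → 0ℚ ≤ t → 0ℚ ≤ η → η ≤ ½ * ε →
    s ≡ 0ℚ ⊎ s * s ≤ p → q < (t + η) * (t + η) →
    ∣ p - q ∣ ≤ (½ * ε) * (½ * ε) → s ≤ t + ε
  close p q s t η ε ε>0 0≤t 0≤η hη below above hpq with s ≤? t + ε
  ... | yes h = h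
  ... | no ¬h = ⊥-elim (contra below)
    where
    t′ = t + η
    δ = ½ * ε
    0≤t′ : 0ℚ ≤ t′
    0≤t′ = +-mono-≤ 0≤t 0≤η
    0≤δ : 0ℚ ≤ δ
    0≤δ = <⇒≤ (0<½* ε>0)
    lt : t + ε < s
    lt = ≰⇒> ¬h
    0<s : 0ℚ < s
    0<s = ≤-<-trans (+-mono-≤ 0≤t (<⇒≤ ε>0)) lt
    le : t′ + δ ≤ s
    le = ≤-trans (subst (t′ + δ ≤_)
           (trans (+-assoc t δ δ) (cong (λ e → t + e) (halves ε)))
           (+-monoˡ-≤ δ (+-monoʳ-≤ t hη))) (<⇒≤ lt)
    0≤t′+δ : 0ℚ ≤ t′ + δ
    0≤t′+δ = +-mono-≤ 0≤t′ 0≤δ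
    0≤t′δ : 0ℚ ≤ t′ * δ
    0≤t′δ = subst (_≤ t′ * δ) (*-zeroˡ 0ℚ) (*-mono-≤ 0≤t′ ≤-refl 0≤t′ 0≤δ)
    sq : t′ * t′ + δ * δ ≤ s * s
    sq = ≤-trans
      (subst₂ _≤_ (+-identityʳ (t′ * t′ + δ * δ))
        (solve 2 (λ a d → a :* a :+ d :* d :+ (a :* d :+ a :* d) := (a :+ d) :* (a :+ d)) refl t′ δ)
        (+-monoʳ-≤ (t′ * t′ + δ * δ) (+-mono-≤ 0≤t′δ 0≤t′δ)))
      (*-mono-≤ (<⇒≤ 0<s) 0≤t′+δ le le)
    p< : p < s * s
    p< = <-≤-trans (≤-<-trans
      (subst (_≤ q + δ * δ) (solve 2 (λ p q → q :+ (p :- q) := p) refl p q)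
        (+-monoʳ-≤ q (≤-trans (p≤∣p∣ (p - q)) hpq)))
      (+-monoˡ-< (δ * δ) above)) sq
    contra : s ≡ 0ℚ ⊎ s * s ≤ p → ⊥
    contra (inj₁ e) = <-irrefl (sym e) 0<s
    contra (inj₂ h) = <-irrefl refl (<-≤-trans p< h)

  root-close : ∀ p q k l ε → 0ℚ < ε → + 1 / suc l ≤ ½ * ε →
    ∣ p - q ∣ ≤ (½ * ε) * (½ * ε) → rootℚ p k ≤ rootℚ q l + ε
  root-close p q k l ε ε>0 hl hpq =
    close p q (rootℚ p k) (rootℚ q l) (+ 1 / suc l) ε ε>0
      (root-nonneg q l) (0≤/ 1 l) hl (root-below p k) (root-above q l) hpq

  √-cauchy : ∀ {u} → IsCauchy u → IsCauchy (λ n → rootℚ (u n) n)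
  √-cauchy {u} cu ε ε>0 = N₁ ℕ.⊔ N₂ , λ m n N≤m N≤n → ∣-∣-bound (rootℚ (u m) m) (rootℚ (u n) n) ε
      (root-close (u m) (u n) m n ε ε>0 (small n N≤n) (near m n N≤m N≤n))
      (root-close (u n) (u m) n m ε ε>0 (small m N≤m) (near n m N≤n N≤m))
    where
    δ = ½ * ε
    δ>0 : 0ℚ < δ
    δ>0 = 0<½* ε>0
    N₁ = ℚ.denominator-1 δ
    N₂ = proj₁ (cu (δ * δ) (0<* δ>0 δ>0))
    small : ∀ n → N₁ ℕ.⊔ N₂ ℕ.≤ n → + 1 / suc n ≤ δ
    small n h = archimedean δ δ>0 n (ℕₚ.m⊔n≤o⇒m≤o N₁ N₂ h)
    near : ∀ m n → N₁ ℕ.⊔ N₂ ℕ.≤ m → N₁ ℕ.⊔ N₂ ℕ.≤ n → ∣ u m - u n ∣ ≤ δ * δ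
    near m n h k = proj₂ (cu (δ * δ) (0<* δ>0 δ>0)) m n
      (ℕₚ.m⊔n≤o⇒n≤o N₁ N₂ h) (ℕₚ.m⊔n≤o⇒n≤o N₁ N₂ k)

-- The square root of max x 0.
√ℝ : ℝ → ℝ
√ℝ x = mkℝ (λ n → rootℚ (seq x n) n) (√-cauchy {seq x} (cauchy x))

infix 4 _≃ℂ_
infixl 6 _+ℂ_
infixl 7 _*ℂ_
infix  8 -ℂ_

record ℂ : Set where
  constructor _+i_
  field
    re im : ℝ

open ℂ public

_≃ℂ_ : ℂ → ℂ → Set
z ≃ℂ w = re z ≃ℝ re w × im z ≃ℝ im w

fromℝ : ℝ → ℂ
fromℝ x = x +i 0ℝ

0ℂ 1ℂ : ℂ
0ℂ = fromℝ 0ℝ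
1ℂ = fromℝ 1ℝ

_+ℂ_ : ℂ → ℂ → ℂ
(a +i b) +ℂ (c +i d) = (a +ℝ c) +i (b +ℝ d)

-ℂ_ : ℂ → ℂ
-ℂ (a +i b) = (-ℝ a) +i (-ℝ b)

_*ℂ_ : ℂ → ℂ → ℂ
(a +i b) *ℂ (c +i d) = (a *ℝ c +ℝ -ℝ (b *ℝ d)) +i (a *ℝ d +ℝ b *ℝ c)

conj : ℂ → ℂ
conj (a +i b) = a +i (-ℝ b)

∣_∣ℂ : ℂ → ℝ
∣ a +i b ∣ℂ = √ℝ (a *ℝ a +ℝ b *ℝ b)

ℂ-rawRing : RawRing 0ℓ 0ℓ
ℂ-rawRing = record
  { Carrier = ℂ ; _≈_ = _≃ℂ_ ; _+_ = _+ℂ_ ; _*_ = _*ℂ_ ; -_ = -ℂ_ ; 0# = 0ℂ ; 1# = 1ℂ }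

open SemiringDefs (RawRing.rawSemiring ℂ-rawRing) public
  using () renaming (_^_ to _^ℂ_; sum to sumℂ)

_⟶_ : (ℕ → ℂ) → ℂ → Set
u ⟶ z = ∀ ε → 0ℚ < ε → ∃[ N ] ∀ n → N ℕ.≤ n → ∣ u n +ℂ -ℂ z ∣ℂ ≤ℝ fromℚ ε

-- Σ_{k<n} z^k / k!, a partial sum of the power series of e^z.
expPartial : ℂ → ℕ → ℂ
expPartial z n = sumℂ {n} λ i → let k = toℕ i in
  fromℝ (fromℚ ((+ 1 / (k !)) {{k ℕₚ.!≢0}})) *ℂ z ^ℂ k

infix 4 _IsExpOf_ _IsLogOf_

_IsExpOf_ : ℂ → ℂ → Set
w IsExpOf z = expPartial z ⟶ w

-- sin t = 0, with sin t read as the imaginary part of e^{it}.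
IsSineZero : ℝ → Set
IsSineZero t = ∃[ w ] (w IsExpOf (0ℝ +i t)) × im w ≃ℝ 0ℝ

IsPi : ℝ → Set
IsPi π = 0ℝ <ℝ π × IsSineZero π × (∀ t → 0ℝ <ℝ t → IsSineZero t → π ≤ℝ t)

-- Natural logarithm:  e^ℓ = s.
_IsLogOf_ : ℝ → ℕ → Set
ℓ IsLogOf s = fromℝ (fromℕ s) IsExpOf fromℝ ℓ

2πi/ : (p : ℕ) .{{_ : ℕ.NonZero p}} → ℝ → ℂ
2πi/ p π = 0ℝ +i (fromℚ (+ 2 / p) *ℝ π)

ℤ^ : ℕ → ℕ → Set
ℤ^ p n = Vec (Fin p) n

module _ (M : RawMonoid 0ℓ 0ℓ) where
  open RawMonoid M using (Carrier)

  sumOver : ∀ p n → (ℤ^ p n → Carrier) → Carrier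
  sumOver p zero    g = g []
  sumOver p (suc n) g = MonoidDefs.sum M {p} λ a → sumOver p n λ x → g (a ∷ x)

∑ℝ : ∀ {p n} → (ℤ^ p n → ℝ) → ℝ
∑ℝ = sumOver (RawRing.+-rawMonoid ℝ-rawRing) _ _

∑ℂ : ∀ {p n} → (ℤ^ p n → ℂ) → ℂ
∑ℂ = sumOver (RawRing.+-rawMonoid ℂ-rawRing) _ _

module _ {p : ℕ} .{{_ : ℕ.NonZero p}} where

  ⟨_,_⟩ : ∀ {n} → ℤ^ p n → ℤ^ p n → Fin p
  ⟨ α , x ⟩ = Vec.sum (Vec.zipWith (λ a b → toℕ a ℕ.* toℕ b) α x) mod p

  𝔼 : ∀ {n} → (ℤ^ p n → ℂ) → ℂ
  𝔼 {n} g = fromℝ (fromℚ ((+ 1 / (p ℕ.^ n)) {{ℕₚ.m^n≢0 p n}})) *ℂ ∑ℂ g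

  -- ω is a parameter; the exponent is a representative of ⟨α,x⟩ in {0,…,p-1}.
  χ : ∀ {n} → ℂ → ℤ^ p n → ℤ^ p n → ℂ
  χ ω α x = ω ^ℂ toℕ ⟨ α , x ⟩

  fourier : ∀ {n} → ℂ → (ℤ^ p n → ℂ) → ℤ^ p n → ℂ
  fourier ω f α = 𝔼 λ x → f x *ℂ conj (χ ω α x)

‖_‖₁ : ∀ {p n} → (ℤ^ p n → ℂ) → ℝ
‖ g ‖₁ = ∑ℝ λ α → ∣ g α ∣ℂ

-- The values +1 and -1 of a Boolean function, as complex numbers.
⟦_⟧ : Sign → ℂ
⟦ Sign.+ ⟧ = 1ℂ
⟦ Sign.- ⟧ = -ℂ 1ℂ

HasCardinality : {A : Set} → (A → Set) → ℕ → Set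
HasCardinality {A} P s =
  Σ (List A) λ as → Unique as × (∀ a → a ∈ as ⇔ P a) × length as ≡ s

-- children a is the subtree below the edge labelled a.
data DecisionTree (p n : ℕ) : Set where
  leaf : Sign → DecisionTree p n
  node : (γ : ℤ^ p n) (children : Fin p → DecisionTree p n) → DecisionTree p n

module _ {p n : ℕ} where

  depth : DecisionTree p n → ℕ
  depth (leaf _)   = 0
  depth (node _ T) = suc (Vector.foldr ℕ._⊔_ 0 λ a → depth (T a))

  eval : .{{_ : ℕ.NonZero p}} → DecisionTree p n → ℤ^ p n → Sign
  eval (leaf b)   x = b
  eval (node γ T) x = eval (T ⟨ γ , x ⟩) x

  _Computes_ : .{{_ : ℕ.NonZero p}} → DecisionTree p n → (ℤ^ p n → Sign) → Set
  T Computes f = ∀ x → eval T x ≡ f x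

module Submission where

-- Let b be the indicator of the minority value of f, N = ‖b̂‖₁ and μ = 𝔼 b ≤ ½.  Compose b with a
-- projection onto a hyperplane ⟨γ,x⟩ = c with 𝔼 b not increased; the Fourier coefficients are summed,
-- up to phases, over the cosets of ⟨γ⟩.  Let a_β be the sums of |b̂| over the cosets, g_β the absolute
-- values of the new coefficients and Q = Σ a_β².  As b² = b, each a_β is at most Q, so by Parseval the
-- norm drops by at least L with Q − μ ≤ Σ (a_β² − g_β²) ≤ 2 Q L, while Q ≥ a_0 ≥ μ + |b̂(γ)|.
-- If 8 N L < 1 for every γ ≠ 0, then all |b̂(γ)| are at most μ / 3N, which contradicts Σ |b̂|² = μ ≤ ½.
-- Hence suitable answers to O(A²) queries make f constant.  So every nontrivial coset of the span of the
-- queries which meets the support of f̂ meets it at least twice, since a single coefficient could not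
-- cancel.  Therefore these queries halve the sparsity, whatever the answers are.
--
-- The reals are only classically ordered.  But the existence of a tree of a given depth is decidable and
-- inequalities of reals are stable under double negation, so for a tree of least depth the bound on the
-- depth may be proved classically.

open import Data.Empty using (⊥; ⊥-elim)
import Data.Integer.Properties as ℤₚ
open import Data.List.Base using (List; []; _∷_; length)
open import Data.Nat.Base as ℕ using (NonZero; suc; s≤s; zero; z≤n; ℕ)
open import Data.Nat.Primality using (Prime)
import Data.Nat.Properties as ℕₚ
open import Data.Product.Base using (_,_; _×_; proj₁; proj₂; Σ; ∃-syntax)
open import Data.Rational.Base as ℚ using (0ℚ; 1ℚ; ½; ℚ)
import Data.Rational.Properties as ℚₚ
import Data.Rational.Solver as ℚSolver
open import Data.Sign.Base as Sign using (Sign)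
import Data.Sign.Properties as Signₚ
open import Data.Sum.Base using ([_,_]′; _⊎_; inj₁; inj₂)
open import Data.Vec.Base using (Vec; []; _∷_)
open import Function.Base using (_∘_)
open import Level using (0ℓ)
import Relation.Binary.PropositionalEquality as ≡
open import Relation.Nullary using (Dec; no; yes; ¬_)
open import Relation.Nullary.Negation using (contradiction)

module Reals where

  open import Defs
  open import Algebra.Bundles using (CommutativeRing)
  import Data.Integer.Base as ℤ
  open import Data.Rational.Base using (_/_; 1/_; _+_; _*_; _-_; -_; ∣_∣; _≤_; _<_; *<*; *≤*)
  open import Data.Rational.Properties
  open import Data.Rational.Unnormalised.Base as ℚᵘ using (mkℚᵘ)
  import Data.Rational.Unnormalised.Properties as ℚᵘₚ
  open import Function.Base using (id)
  open import Relation.Binary.PropositionalEquality using (_≡_; refl; sym; trans; cong; subst; subst₂)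

  open ℚSolver.+-*-Solver

  ≤-by-difference : ∀ {p q} d → 0ℚ ≤ d → q ≡ p + d → p ≤ q
  ≤-by-difference {p} d 0≤d refl = subst (_≤ p + d) (+-identityʳ p) (+-monoʳ-≤ p 0≤d)

  0≤-difference : ∀ {p q} → p ≤ q → 0ℚ ≤ q - p
  0≤-difference {p} {q} p≤q = subst (_≤ q - p) (+-inverseʳ p) (+-monoˡ-≤ (- p) p≤q)

  0≤-sum : ∀ {p q} → 0ℚ ≤ p → 0ℚ ≤ q → 0ℚ ≤ p + q
  0≤-sum = +-mono-≤

  0≤-product : ∀ {p q} → 0ℚ ≤ p → 0ℚ ≤ q → 0ℚ ≤ p * q
  0≤-product {p} {q} 0≤p 0≤q =
    nonNegative⁻¹ _ {{nonNeg*nonNeg⇒nonNeg p {{ℚ.nonNegative 0≤p}} q {{ℚ.nonNegative 0≤q}}}}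

  0<-product : ∀ {p q} → 0ℚ < p → 0ℚ < q → 0ℚ < p * q
  0<-product {p} {q} 0<p 0<q =
    positive⁻¹ _ {{pos*pos⇒pos p {{ℚ.positive 0<p}} q {{ℚ.positive 0<q}}}}

  *-mono-≤-nonneg : ∀ {a b c d} → 0ℚ ≤ b → 0ℚ ≤ c → a ≤ b → c ≤ d → a * c ≤ b * d
  *-mono-≤-nonneg {a} {b} {c} {d} 0≤b 0≤c a≤b c≤d = ≤-trans
    (*-monoʳ-≤-nonNeg c {{ℚ.nonNegative 0≤c}} a≤b)
    (*-monoˡ-≤-nonNeg b {{ℚ.nonNegative 0≤b}} c≤d)

  half : ∀ {ε} → 0ℚ < ε → 0ℚ < ½ * ε
  half = 0<-product (positive⁻¹ ½)

  halves : ∀ ε → ½ * ε + ½ * ε ≡ ε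
  halves ε = trans (sym (*-distribʳ-+ ε ½ ½)) (*-identityˡ ε)

  p≤∣p∣ : ∀ p → p ≤ ∣ p ∣
  p≤∣p∣ p with ≤-total 0ℚ p
  ... | inj₁ 0≤p = ≤-reflexive (sym (0≤p⇒∣p∣≡p 0≤p))
  ... | inj₂ p≤0 = ≤-trans p≤0 (0≤∣p∣ p)

  ∣p∣≤ : ∀ {p r} → p ≤ r → - p ≤ r → ∣ p ∣ ≤ r
  ∣p∣≤ {p} p≤r -p≤r with ∣p∣≡p∨∣p∣≡-p p
  ... | inj₁ e = subst (_≤ _) (sym e) p≤r
  ... | inj₂ e = subst (_≤ _) (sym e) -p≤r

  ∣p∣≤⇒p≤ : ∀ {p r} → ∣ p ∣ ≤ r → p ≤ r
  ∣p∣≤⇒p≤ {p} = ≤-trans (p≤∣p∣ p)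

  ∣p∣≤⇒-p≤ : ∀ {p r} → ∣ p ∣ ≤ r → - p ≤ r
  ∣p∣≤⇒-p≤ {p} h = ≤-trans (p≤∣p∣ (- p)) (subst (_≤ _) (sym (∣-p∣≡∣p∣ p)) h)

  share : ∀ {ε} C → 0ℚ < ε → 0ℚ < C → ∃[ δ ] 0ℚ < δ × δ * C ≡ ε
  share {ε} C ε>0 C>0 =
    ε * 1/ C ,
    0<-product ε>0 (positive⁻¹ (1/ C) {{1/pos⇒pos C}}) ,
    trans (*-assoc ε (1/ C) C) (trans (cong (ε *_) (*-inverseˡ C)) (*-identityʳ ε))
    where
    instance
      C-pos : ℚ.Positive C
      C-pos = ℚ.positive C>0
      C-nz : ℚ.NonZero C
      C-nz = pos⇒nonZero C

  toℚᵘ-/ : ∀ i k → ℚ.toℚᵘ (i / suc k) ℚᵘ.≃ mkℚᵘ i k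
  toℚᵘ-/ i k = toℚᵘ-fromℚᵘ (mkℚᵘ i k)

  archimedean : ∀ ε → 0ℚ < ε → ∃[ N ] ∀ n → N ℕ.≤ n → ℤ.+ 1 / suc n ≤ ε
  archimedean ε@(ℚ.mkℚ (ℤ.+ zero) d _) (*<* (ℤ.+<+ ()))
  archimedean ε@(ℚ.mkℚ (ℤ.-[1+ a ]) d _) (*<* ())
  archimedean ε@(ℚ.mkℚ (ℤ.+ suc a) d _) ε>0 = d , λ n d≤n → toℚᵘ-cancel-≤
    (ℚᵘₚ.≤-respˡ-≃ (ℚᵘₚ.≃-sym (toℚᵘ-/ (ℤ.+ 1) n))
      (ℚᵘ.*≤* (subst₂ ℤ._≤_ (ℤₚ.pos-* 1 (suc d)) (ℤₚ.pos-* (suc a) (suc n))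
        (ℤ.+≤+ (ℕₚ.*-mono-≤ (ℕ.s≤s (ℕ.z≤n {a})) (ℕ.s≤s d≤n))))))

  0≤1/suc : ∀ k → 0ℚ ≤ ℤ.+ 1 / suc k
  0≤1/suc k = nonNegative⁻¹ _ {{normalize-nonNeg 1 (suc k)}}

  Eventually : (ℕ → Set) → Set
  Eventually P = ∃[ N ] ∀ n → N ℕ.≤ n → P n

  always : ∀ {P : ℕ → Set} → (∀ n → P n) → Eventually P
  always p = 0 , λ n _ → p n

  eventually-map : ∀ {P Q : ℕ → Set} → (∀ n → P n → Q n) → Eventually P → Eventually Q
  eventually-map f (N , p) = N , λ n N≤n → f n (p n N≤n)

  eventually-map₂ : ∀ {P Q R : ℕ → Set} → (∀ n → P n → Q n → R n) →
    Eventually P → Eventually Q → Eventually R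
  eventually-map₂ f (M , p) (N , q) = M ℕ.⊔ N , λ n M⊔N≤n →
    f n (p n (ℕₚ.m⊔n≤o⇒m≤o M N M⊔N≤n)) (q n (ℕₚ.m⊔n≤o⇒n≤o M N M⊔N≤n))

  eventually-witness : ∀ {P : ℕ → Set} → Eventually P → ∃[ n ] P n
  eventually-witness (N , p) = N , p N ℕₚ.≤-refl

  infixl 6 _-ℝ_
  _-ℝ_ : ℝ → ℝ → ℝ
  x -ℝ y = x +ℝ -ℝ y

  ≤ℝ⇒0≤ℝ : ∀ {x y} → x ≤ℝ y → 0ℝ ≤ℝ y -ℝ x
  ≤ℝ⇒0≤ℝ {x} {y} h ε ε>0 = eventually-map (λ n x≤ → ≤-by-difference _ (0≤-difference x≤)
    (solve 3 (λ x y e → y :+ :- x :+ e := con 0ℚ :+ (y :+ e :+ :- x)) refl (seq x n) (seq y n) ε)) (h ε ε>0)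

  0≤ℝ⇒≤ℝ : ∀ {x y} → 0ℝ ≤ℝ y -ℝ x → x ≤ℝ y
  0≤ℝ⇒≤ℝ {x} {y} h ε ε>0 = eventually-map (λ n 0≤ → ≤-by-difference _ 0≤
    (solve 3 (λ x y e → y :+ e := x :+ (y :+ :- x :+ e)) refl (seq x n) (seq y n) ε)) (h ε ε>0)

  pointwise-≤ℝ : ∀ {x y} → (∀ n → seq x n ≤ seq y n) → x ≤ℝ y
  pointwise-≤ℝ {x} {y} h ε ε>0 = always λ n → ≤-trans (h n)
    (≤-by-difference ε (<⇒≤ ε>0) refl)

  pointwise-≃ℝ : ∀ {x y} → (∀ n → seq x n ≡ seq y n) → x ≃ℝ y
  pointwise-≃ℝ {x} {y} h ε ε>0 = always λ n → subst (_≤ ε)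
    (sym (cong ∣_∣ (trans (cong (_- seq y n) (h n)) (+-inverseʳ (seq y n))))) (<⇒≤ ε>0)

  ≃ℝ⇒≤ℝ : ∀ {x y} → x ≃ℝ y → x ≤ℝ y
  ≃ℝ⇒≤ℝ {x} {y} h ε ε>0 = eventually-map (λ n d → ≤-by-difference _ (0≤-difference (∣p∣≤⇒p≤ d))
    (solve 3 (λ x y e → y :+ e := x :+ (e :+ :- (x :+ :- y))) refl (seq x n) (seq y n) ε)) (h ε ε>0)

  ≤ℝ-antisym : ∀ {x y} → x ≤ℝ y → y ≤ℝ x → x ≃ℝ y
  ≤ℝ-antisym {x} {y} h k ε ε>0 = eventually-map₂ (λ n p q → ∣p∣≤
    (≤-by-difference _ (0≤-difference p)
      (solve 3 (λ x y e → e := (x :+ :- y) :+ (y :+ e :+ :- x)) refl (seq x n) (seq y n) ε))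
    (≤-by-difference _ (0≤-difference q)
      (solve 3 (λ x y e → e := :- (x :+ :- y) :+ (x :+ e :+ :- y)) refl (seq x n) (seq y n) ε)))
    (h ε ε>0) (k ε ε>0)

  ≃ℝ-sym : ∀ {x y} → x ≃ℝ y → y ≃ℝ x
  ≃ℝ-sym {x} {y} h ε ε>0 = eventually-map (λ n d → subst (_≤ ε)
    (trans (sym (∣-p∣≡∣p∣ (seq x n - seq y n)))
      (cong ∣_∣ (solve 2 (λ x y → :- (x :+ :- y) := y :+ :- x) refl (seq x n) (seq y n)))) d) (h ε ε>0)

  ≤ℝ-trans : ∀ {x y z} → x ≤ℝ y → y ≤ℝ z → x ≤ℝ z
  ≤ℝ-trans {x} {y} {z} h k ε ε>0 = eventually-map₂ (λ n p q →
    ≤-trans p (subst (seq y n + ½ * ε ≤_)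
      (trans (+-assoc (seq z n) (½ * ε) (½ * ε)) (cong (seq z n +_) (halves ε)))
      (+-monoˡ-≤ (½ * ε) q))) (h _ (half ε>0)) (k _ (half ε>0))

  ≃ℝ-trans : ∀ {x y z} → x ≃ℝ y → y ≃ℝ z → x ≃ℝ z
  ≃ℝ-trans {x} {y} {z} h k = ≤ℝ-antisym {x} {z}
    (≤ℝ-trans {x} {y} {z} (≃ℝ⇒≤ℝ {x} {y} h) (≃ℝ⇒≤ℝ {y} {z} k))
    (≤ℝ-trans {z} {y} {x} (≃ℝ⇒≤ℝ {z} {y} (≃ℝ-sym {y} {z} k)) (≃ℝ⇒≤ℝ {y} {x} (≃ℝ-sym {x} {y} h)))

  +ℝ-mono-≤ℝ : ∀ {x y u v} → x ≤ℝ y → u ≤ℝ v → x +ℝ u ≤ℝ y +ℝ v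
  +ℝ-mono-≤ℝ {x} {y} {u} {v} h k ε ε>0 = eventually-map₂ (λ n p q →
    subst (seq x n + seq u n ≤_)
      (trans (solve 3 (λ y v e → (y :+ e) :+ (v :+ e) := y :+ v :+ (e :+ e)) refl (seq y n) (seq v n) (½ * ε))
        (cong (seq y n + seq v n +_) (halves ε)))
      (+-mono-≤ p q)) (h _ (half ε>0)) (k _ (half ε>0))

  +ℝ-cong : ∀ {x y u v} → x ≃ℝ y → u ≃ℝ v → x +ℝ u ≃ℝ y +ℝ v
  +ℝ-cong {x} {y} {u} {v} h k = ≤ℝ-antisym {x +ℝ u} {y +ℝ v}
    (+ℝ-mono-≤ℝ {x} {y} {u} {v} (≃ℝ⇒≤ℝ {x} {y} h) (≃ℝ⇒≤ℝ {u} {v} k))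
    (+ℝ-mono-≤ℝ {y} {x} {v} {u} (≃ℝ⇒≤ℝ {y} {x} (≃ℝ-sym {x} {y} h)) (≃ℝ⇒≤ℝ {v} {u} (≃ℝ-sym {u} {v} k)))

  -ℝ-cong : ∀ {x y} → x ≃ℝ y → -ℝ x ≃ℝ -ℝ y
  -ℝ-cong {x} {y} h ε ε>0 = eventually-map (λ n d → subst (_≤ ε)
    (trans (sym (∣-p∣≡∣p∣ (seq x n - seq y n)))
      (cong ∣_∣ (solve 2 (λ x y → :- (x :+ :- y) := :- x :+ :- :- y) refl (seq x n) (seq y n)))) d) (h ε ε>0)

  bounded : ∀ x → ∃[ B ] 0ℚ < B × Eventually (λ n → ∣ seq x n ∣ ≤ B)
  bounded x with cauchy x 1ℚ (positive⁻¹ 1ℚ)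
  ... | N , h = 1ℚ + ∣ seq x N ∣ ,
    <-≤-trans (positive⁻¹ 1ℚ) (subst (_≤ 1ℚ + ∣ seq x N ∣) (+-identityʳ 1ℚ) (+-monoʳ-≤ 1ℚ (0≤∣p∣ (seq x N)))) ,
    N , λ n N≤n → ≤-trans
      (subst (λ d → ∣ d ∣ ≤ ∣ seq x n - seq x N ∣ + ∣ seq x N ∣)
        (solve 2 (λ a b → a :- b :+ b := a) refl (seq x n) (seq x N))
        (∣p+q∣≤∣p∣+∣q∣ (seq x n - seq x N) (seq x N)))
      (+-monoˡ-≤ ∣ seq x N ∣ (h n N N≤n ℕₚ.≤-refl))

  *ℝ-congʳ : ∀ {x y} z → x ≃ℝ y → x *ℝ z ≃ℝ y *ℝ z
  *ℝ-congʳ {x} {y} z h ε ε>0 =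
    let B , B>0 , b = bounded z
        δ , δ>0 , δB≡ε = share B ε>0 B>0
    in eventually-map₂ (λ n d z≤B → subst₂ _≤_
          (trans (sym (∣p*q∣≡∣p∣*∣q∣ (seq x n - seq y n) (seq z n)))
            (cong ∣_∣ (solve 3 (λ x y z → (x :+ :- y) :* z := x :* z :+ :- (y :* z)) refl (seq x n) (seq y n) (seq z n))))
          δB≡ε
          (*-mono-≤-nonneg (<⇒≤ δ>0) (0≤∣p∣ (seq z n)) d z≤B)) (h δ δ>0) b

  *ℝ-comm : ∀ x y → x *ℝ y ≃ℝ y *ℝ x
  *ℝ-comm x y = pointwise-≃ℝ {x *ℝ y} {y *ℝ x} λ n → *-comm (seq x n) (seq y n)

  *ℝ-cong : ∀ {x y u v} → x ≃ℝ y → u ≃ℝ v → x *ℝ u ≃ℝ y *ℝ v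
  *ℝ-cong {x} {y} {u} {v} h k = ≃ℝ-trans {x *ℝ u} {y *ℝ u} {y *ℝ v} (*ℝ-congʳ {x} {y} u h)
    (≃ℝ-trans {y *ℝ u} {u *ℝ y} {y *ℝ v} (*ℝ-comm y u)
      (≃ℝ-trans {u *ℝ y} {v *ℝ y} {y *ℝ v} (*ℝ-congʳ {u} {v} y k) (*ℝ-comm v y)))

  ℝ-commutativeRing : CommutativeRing 0ℓ 0ℓ
  ℝ-commutativeRing = record
    { Carrier = ℝ ; _≈_ = _≃ℝ_ ; _+_ = _+ℝ_ ; _*_ = _*ℝ_ ; -_ = -ℝ_ ; 0# = 0ℝ ; 1# = 1ℝ
    ; isCommutativeRing = record
      { isRing = record
        { +-isAbelianGroup = record
          { isGroup = record
            { isMonoid = record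
              { isSemigroup = record
                { isMagma = record
                  { isEquivalence = record
                    { refl = λ {x} → pointwise-≃ℝ {x} {x} λ _ → refl
                    ; sym = λ {x} {y} → ≃ℝ-sym {x} {y}
                    ; trans = λ {x} {y} {z} → ≃ℝ-trans {x} {y} {z} }
                  ; ∙-cong = λ {x} {y} {u} {v} → +ℝ-cong {x} {y} {u} {v} }
                ; assoc = λ x y z → pointwise-≃ℝ {x +ℝ y +ℝ z} {x +ℝ (y +ℝ z)}
                    λ n → +-assoc (seq x n) (seq y n) (seq z n) }
              ; identity = (λ x → pointwise-≃ℝ {0ℝ +ℝ x} {x} λ n → +-identityˡ (seq x n))
                         , (λ x → pointwise-≃ℝ {x +ℝ 0ℝ} {x} λ n → +-identityʳ (seq x n)) }
            ; inverse = (λ x → pointwise-≃ℝ { -ℝ x +ℝ x} {0ℝ} λ n → +-inverseˡ (seq x n))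
                      , (λ x → pointwise-≃ℝ {x +ℝ -ℝ x} {0ℝ} λ n → +-inverseʳ (seq x n))
            ; ⁻¹-cong = λ {x} {y} → -ℝ-cong {x} {y} }
          ; comm = λ x y → pointwise-≃ℝ {x +ℝ y} {y +ℝ x} λ n → +-comm (seq x n) (seq y n) }
        ; *-cong = λ {x} {y} {u} {v} → *ℝ-cong {x} {y} {u} {v}
        ; *-assoc = λ x y z → pointwise-≃ℝ {x *ℝ y *ℝ z} {x *ℝ (y *ℝ z)}
            λ n → *-assoc (seq x n) (seq y n) (seq z n)
        ; *-identity = (λ x → pointwise-≃ℝ {1ℝ *ℝ x} {x} λ n → *-identityˡ (seq x n))
                     , (λ x → pointwise-≃ℝ {x *ℝ 1ℝ} {x} λ n → *-identityʳ (seq x n))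
        ; distrib = (λ x y z → pointwise-≃ℝ {x *ℝ (y +ℝ z)} {x *ℝ y +ℝ x *ℝ z}
                      λ n → *-distribˡ-+ (seq x n) (seq y n) (seq z n))
                  , (λ x y z → pointwise-≃ℝ {(y +ℝ z) *ℝ x} {y *ℝ x +ℝ z *ℝ x}
                      λ n → *-distribʳ-+ (seq x n) (seq y n) (seq z n)) }
      ; *-comm = *ℝ-comm } }

  fromℚ-mono : ∀ {p q} → p ≤ q → fromℚ p ≤ℝ fromℚ q
  fromℚ-mono {p} {q} p≤q = pointwise-≤ℝ {fromℚ p} {fromℚ q} λ _ → p≤q

  Positive : ℝ → Set
  Positive x = ∃[ δ ] 0ℚ < δ × Eventually (λ n → δ ≤ seq x n)

  small-or-negative : ∀ x ε → 0ℚ < ε →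
    Eventually (λ n → 0ℚ ≤ seq x n + ε) ⊎ Positive (-ℝ x)
  small-or-negative x ε ε>0 = split (- (½ * ε) ≤? seq x N)
    where
    N = proj₁ (cauchy x (½ * (½ * ε)) (half (half ε>0)))
    h = proj₂ (cauchy x (½ * (½ * ε)) (half (half ε>0)))
    split : Dec (- (½ * ε) ≤ seq x N) → _
    split (yes p) = inj₁ (N , λ n N≤n → ≤-by-difference _
      (0≤-sum (0≤-difference p)
        (0≤-sum (0≤-difference (∣p∣≤⇒-p≤ (h n N N≤n ℕₚ.≤-refl))) (<⇒≤ (half (half ε>0)))))
      (solve 3 (λ a b e → a :+ e := con 0ℚ :+
          (b :+ :- :- (con ½ :* e) :+ (con ½ :* (con ½ :* e) :+ :- :- (a :+ :- b) :+ con ½ :* (con ½ :* e))))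
        refl (seq x n) (seq x N) ε))
    split (no ¬p) = inj₂ (½ * (½ * ε) , half (half ε>0) , N , λ n N≤n → ≤-by-difference _
      (0≤-sum (0≤-difference (<⇒≤ (≰⇒> ¬p))) (0≤-difference (∣p∣≤⇒p≤ (h n N N≤n ℕₚ.≤-refl))))
      (solve 3 (λ a b e → :- a := con ½ :* (con ½ :* e) :+
          (:- (con ½ :* e) :+ :- b :+ (con ½ :* (con ½ :* e) :+ :- (a :+ :- b))))
        refl (seq x n) (seq x N) ε))

  Positive⇒¬≤0 : ∀ {x} → Positive x → ¬ x ≤ℝ 0ℝ
  Positive⇒¬≤0 {x} (δ , δ>0 , p) h =
    let n , δ≤ = eventually-witness (eventually-map₂ (λ n a b → ≤-trans a b) p (h (½ * δ) (half δ>0)))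
    in <-irrefl refl (<-≤-trans
          (subst₂ _<_ (+-identityˡ (½ * δ)) (halves δ) (+-monoˡ-< (½ * δ) (half δ>0)))
          (subst (δ ≤_) (+-identityˡ (½ * δ)) δ≤))

  Positive-neg⇒¬0≤ : ∀ {x} → Positive (-ℝ x) → ¬ 0ℝ ≤ℝ x
  Positive-neg⇒¬0≤ {x} p h = Positive⇒¬≤0 { -ℝ x} p λ ε ε>0 → eventually-map
    (λ n 0≤ → ≤-by-difference _ 0≤
      (solve 2 (λ a e → con 0ℚ :+ e := :- a :+ (a :+ e)) refl (seq x n) ε)) (h ε ε>0)

  Positive⇒0≤ : ∀ {x} → Positive x → 0ℝ ≤ℝ x
  Positive⇒0≤ {x} (δ , δ>0 , p) ε ε>0 = eventually-map
    (λ n δ≤ → 0≤-sum (≤-trans (<⇒≤ δ>0) δ≤) (<⇒≤ ε>0)) p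

  0≤ℝ-stable : ∀ {x} → ¬ ¬ 0ℝ ≤ℝ x → 0ℝ ≤ℝ x
  0≤ℝ-stable {x} h ε ε>0 = [ id , (λ p → ⊥-elim (h (Positive-neg⇒¬0≤ {x} p))) ]′
    (small-or-negative x ε ε>0)

  ≤ℝ-stable : ∀ {x y} → ¬ ¬ x ≤ℝ y → x ≤ℝ y
  ≤ℝ-stable {x} {y} h = 0≤ℝ⇒≤ℝ {x} {y} (0≤ℝ-stable {y -ℝ x} λ k → h λ x≤y → k (≤ℝ⇒0≤ℝ {x} {y} x≤y))

  ¬Positive⇒≤0 : ∀ {x} → ¬ Positive x → x ≤ℝ 0ℝ
  ¬Positive⇒≤0 {x} ¬p ε ε>0 = [ eventually-map (λ n 0≤ → ≤-by-difference _ 0≤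
          (solve 2 (λ a e → con 0ℚ :+ e := a :+ (:- a :+ e)) refl (seq x n) ε))
    , (λ (δ , δ>0 , p) → ⊥-elim (¬p (δ , δ>0 , eventually-map (λ n →
          subst (δ ≤_) (solve 1 (λ a → :- :- a := a) refl (seq x n))) p))) ]′
    (small-or-negative (-ℝ x) ε ε>0)

  ≤ℝ-total : ∀ x y → ¬ ¬ (x ≤ℝ y ⊎ y ≤ℝ x)
  ≤ℝ-total x y k = k (inj₁ (0≤ℝ⇒≤ℝ {x} {y} (0≤ℝ-stable {y -ℝ x} λ ¬h → k (inj₂
    (0≤ℝ⇒≤ℝ {y} {x} (≤ℝ-trans {0ℝ} { -ℝ (y -ℝ x)} {x -ℝ y}
      (λ ε ε>0 → eventually-map (λ n le → ≤-by-difference _ (0≤-difference le)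
          (solve 2 (λ a e → :- a :+ e := con 0ℚ :+ (con 0ℚ :+ e :+ :- a)) refl (seq y n - seq x n) ε))
        (¬Positive⇒≤0 {y -ℝ x} (λ p → ¬h (Positive⇒0≤ {y -ℝ x} p)) ε ε>0))
      (pointwise-≤ℝ { -ℝ (y -ℝ x)} {x -ℝ y} λ n → ≤-reflexive
        (solve 2 (λ x y → :- (y :+ :- x) := x :+ :- y) refl (seq x n) (seq y n)))))))))

  Positive-product : ∀ {x y} → Positive x → Positive y → Positive (x *ℝ y)
  Positive-product {x} {y} (δ , δ>0 , p) (η , η>0 , q) = δ * η , 0<-product δ>0 η>0 ,
    eventually-map₂ (λ n a b → *-mono-≤-nonneg (≤-trans (<⇒≤ δ>0) a) (<⇒≤ η>0) a b) p q

  *ℝ-cancel-≤0 : ∀ {x y} → ¬ x ≤ℝ 0ℝ → x *ℝ y ≤ℝ 0ℝ → y ≤ℝ 0ℝ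
  *ℝ-cancel-≤0 {x} {y} ¬x≤0 xy≤0 = ¬Positive⇒≤0 {y} λ py →
    ¬x≤0 (¬Positive⇒≤0 {x} λ px → Positive⇒¬≤0 {x *ℝ y} (Positive-product {x} {y} px py) xy≤0)

  0≤ℝ-product : ∀ {x y} → 0ℝ ≤ℝ x → 0ℝ ≤ℝ y → 0ℝ ≤ℝ x *ℝ y
  0≤ℝ-product {x} {y} h k ε ε>0 =
    eventually-map₂ (λ n (hx , bx) (ky , cy) → body n hx bx ky cy)
      (eventually-map₂ (λ n → _,_) (h δ δ>0) (proj₂ (proj₂ (bounded x))))
      (eventually-map₂ (λ n → _,_) (k δ δ>0) (proj₂ (proj₂ (bounded y))))
    where
    B = proj₁ (bounded x)
    C = proj₁ (bounded y)
    B>0 = proj₁ (proj₂ (bounded x))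
    C>0 = proj₁ (proj₂ (bounded y))
    scale = share (B + C) ε>0 (+-mono-< B>0 C>0)
    δ = proj₁ scale
    δ>0 = proj₁ (proj₂ scale)
    δ[B+C]≡ε = proj₂ (proj₂ scale)
    small : ∀ {a b D E} → a ≤ 0ℚ → 0ℚ ≤ a + δ → ∣ b ∣ ≤ D → 0ℚ ≤ E → D + E ≡ B + C → 0ℚ ≤ a * b + ε
    small {a} {b} {D} {E} a≤0 0≤a+δ b≤D 0≤E e = ≤-by-difference _
      (0≤-sum (0≤-difference (∣p∣≤⇒-p≤ (subst (_≤ δ * D) (sym (∣p*q∣≡∣p∣*∣q∣ a b))
        (*-mono-≤-nonneg (<⇒≤ δ>0) (0≤∣p∣ b)
          (∣p∣≤ (≤-trans a≤0 (<⇒≤ δ>0)) (≤-by-difference _ 0≤a+δ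
            (solve 2 (λ a d → d := :- a :+ (a :+ d)) refl a δ))) b≤D))))
        (0≤-product (<⇒≤ δ>0) 0≤E))
      (trans (cong (a * b +_) (trans (sym δ[B+C]≡ε) (cong (δ *_) (sym e))))
        (solve 4 (λ p d D E → p :+ d :* (D :+ E) := con 0ℚ :+ (d :* D :+ :- :- p :+ d :* E)) refl (a * b) δ D E))
    body : ∀ n → 0ℚ ≤ seq x n + δ → ∣ seq x n ∣ ≤ B → 0ℚ ≤ seq y n + δ → ∣ seq y n ∣ ≤ C →
      0ℚ ≤ seq x n * seq y n + ε
    body n hx bx ky cy =
      [ (λ 0≤x → [ (λ 0≤y → 0≤-sum (0≤-product 0≤x 0≤y) (<⇒≤ ε>0))
                 , (λ y≤0 → subst (λ p → 0ℚ ≤ p + ε) (*-comm (seq y n) (seq x n))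
                     (small y≤0 ky bx (<⇒≤ C>0) refl)) ]′ (≤-total 0ℚ (seq y n)))
      , (λ x≤0 → small x≤0 hx cy (<⇒≤ B>0) (+-comm C B)) ]′ (≤-total 0ℚ (seq x n))

  √ℝ-nonneg : ∀ x → 0ℝ ≤ℝ √ℝ x
  √ℝ-nonneg x = pointwise-≤ℝ {0ℝ} {√ℝ x} λ n → root-nonneg (seq x n) n

  √ℝ-square : ∀ {x} → 0ℝ ≤ℝ x → √ℝ x *ℝ √ℝ x ≃ℝ x
  √ℝ-square {x} 0≤x = ≤ℝ-antisym {√ℝ x *ℝ √ℝ x} {x} below above
    where
    below : √ℝ x *ℝ √ℝ x ≤ℝ x
    below ε ε>0 = eventually-map (λ n 0≤x+ε → case n 0≤x+ε (root-below (seq x n) n)) (0≤x ε ε>0)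
      where
      case : ∀ n → 0ℚ ≤ seq x n + ε → rootℚ (seq x n) n ≡ 0ℚ ⊎ rootℚ (seq x n) n * rootℚ (seq x n) n ≤ seq x n →
        rootℚ (seq x n) n * rootℚ (seq x n) n ≤ seq x n + ε
      case n h (inj₁ e) = subst (_≤ seq x n + ε) (sym (trans (cong (λ r → r * r) e) (*-zeroˡ 0ℚ))) h
      case n h (inj₂ r²≤) = ≤-trans r²≤ (≤-by-difference ε (<⇒≤ ε>0) refl)
    above : x ≤ℝ √ℝ x *ℝ √ℝ x
    above ε ε>0 = eventually-map₂ (λ n (1/n≤δ , 1/n≤1) r≤B → step n 1/n≤δ 1/n≤1 r≤B)
          (eventually-map₂ (λ n → _,_) (archimedean δ δ>0) (archimedean 1ℚ (positive⁻¹ 1ℚ)))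
          (proj₂ (proj₂ (bounded (√ℝ x))))
      where
      B = proj₁ (bounded (√ℝ x))
      B>0 = proj₁ (proj₂ (bounded (√ℝ x)))
      scale = share (B + B + 1ℚ) ε>0 (+-mono-< (+-mono-< B>0 B>0) (positive⁻¹ 1ℚ))
      δ = proj₁ scale
      δ>0 = proj₁ (proj₂ scale)
      δC≡ε = proj₂ (proj₂ scale)
      step : ∀ n → ℤ.+ 1 / suc n ≤ δ → ℤ.+ 1 / suc n ≤ 1ℚ → ∣ seq (√ℝ x) n ∣ ≤ B →
        seq x n ≤ seq (√ℝ x *ℝ √ℝ x) n + ε
      step n η≤δ η≤1 r≤B = ≤-trans (<⇒≤ (root-above (seq x n) n)) (≤-by-difference _
        (0≤-sum (0≤-difference (*-mono-≤-nonneg {η} {δ} {r + r + η} {B + B + 1ℚ} (<⇒≤ δ>0)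
           (0≤-sum (0≤-sum (root-nonneg (seq x n) n) (root-nonneg (seq x n) n)) (0≤1/suc n)) η≤δ
           (+-mono-≤ (+-mono-≤ (∣p∣≤⇒p≤ r≤B) (∣p∣≤⇒p≤ r≤B)) η≤1))) ≤-refl)
        (trans (cong (r * r +_) (sym δC≡ε))
          (solve 3 (λ r e d → r :* r :+ d := (r :+ e) :* (r :+ e) :+ (d :+ :- (e :* (r :+ r :+ e)) :+ con 0ℚ)) refl r η (δ * (B + B + 1ℚ)))))
        where
        r = rootℚ (seq x n) n
        η = ℤ.+ 1 / suc n

  fromℚ-reflects-≤ : ∀ {p q} → fromℚ p ≤ℝ fromℚ q → p ≤ q
  fromℚ-reflects-≤ {p} {q} h = ≮⇒≥ λ q<p →
    Positive⇒¬≤0 {fromℚ (p - q)}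
      (p - q , subst (_< p - q) (+-inverseʳ q) (+-monoˡ-< (- q) q<p) , always λ _ → ≤-refl)
      λ ε ε>0 → eventually-map (λ _ p≤ → ≤-by-difference _ (0≤-difference p≤)
        (solve 3 (λ p q e → con 0ℚ :+ e := p :+ :- q :+ (q :+ e :+ :- p)) refl p q ε)) (h ε ε>0)

  ≤ℝ-archimedean : ∀ {x} → (∀ ε → 0ℚ < ε → x ≤ℝ fromℚ ε) → x ≤ℝ 0ℝ
  ≤ℝ-archimedean {x} h ε ε>0 = eventually-map
    (λ n → subst (seq x n ≤_) (trans (halves ε) (sym (+-identityˡ ε))))
    (h (½ * ε) (half ε>0) (½ * ε) (half ε>0))

  ceiling-bound : ∀ q → q ≤ ℤ.+ ℤ.∣ ℚ.↥ q ∣ / 1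
  ceiling-bound q = toℚᵘ-cancel-≤
    (ℚᵘₚ.≤-respʳ-≃ (ℚᵘₚ.≃-sym (toℚᵘ-/ (ℤ.+ ℤ.∣ ℚ.↥ q ∣) 0)) (numerator q))
    where
    numerator : ∀ q → ℚ.toℚᵘ q ℚᵘ.≤ mkℚᵘ (ℤ.+ ℤ.∣ ℚ.↥ q ∣) 0
    numerator (ℚ.mkℚ (ℤ.+ a) d _) = ℚᵘ.*≤* (subst₂ ℤ._≤_ (ℤₚ.pos-* a 1) (ℤₚ.pos-* a (suc d))
      (ℤ.+≤+ (ℕₚ.*-monoʳ-≤ a (ℕ.s≤s ℕ.z≤n))))
    numerator (ℚ.mkℚ ℤ.-[1+ a ] d _) = ℚᵘ.*≤* ℤ.-≤+

  ≤ℝ-upper-bound : ∀ x → ∃[ n ] x ≤ℝ fromℚ (ℤ.+ n / 1)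
  ≤ℝ-upper-bound x =
    let B , _ , b = bounded x
    in ℤ.∣ ℚ.↥ B ∣ , λ ε ε>0 → eventually-map (λ n x≤B →
      ≤-trans (∣p∣≤⇒p≤ x≤B) (≤-trans (ceiling-bound B) (≤-by-difference ε (<⇒≤ ε>0) refl))) b

module Ordered where

  open import Algebra.Bundles using (CommutativeRing)
  import Algebra.Solver.Ring as RingSolver
  open import Algebra.Solver.Ring.AlmostCommutativeRing using (fromCommutativeRing; _-Raw-AlmostCommutative⟶_)
  open import Data.Integer.Base using (+_)
  open import Data.Maybe.Base using (Maybe; just; nothing)
  open import Relation.Binary.Bundles using (Preorder)
  import Relation.Binary.Reasoning.Preorder

  record ℚ-Algebra : Set₁ where
    field
      commutativeRing : CommutativeRing 0ℓ 0ℓ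
    open CommutativeRing commutativeRing public
    field
      ι      : ℚ → Carrier
      ι-+    : ∀ p q → ι (p ℚ.+ q) ≈ ι p + ι q
      ι-*    : ∀ p q → ι (p ℚ.* q) ≈ ι p * ι q
      ι-neg  : ∀ p → ι (ℚ.- p) ≈ - ι p
      ι-0    : ι 0ℚ ≈ 0#
      ι-1    : ι 1ℚ ≈ 1#

    private
      coefficient≟ : ∀ p q → Maybe (ι p ≈ ι q)
      coefficient≟ p q with p ℚₚ.≟ q
      ... | yes ≡.refl = just refl
      ... | no _ = nothing

      almostCommutativeRing = fromCommutativeRing commutativeRing

      ι-morphism : ℚₚ.+-*-rawRing -Raw-AlmostCommutative⟶ almostCommutativeRing
      ι-morphism = record
        { ⟦_⟧ = ι ; +-homo = ι-+ ; *-homo = ι-* ; -‿homo = ι-neg ; 0-homo = ι-0 ; 1-homo = ι-1 }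

    module Solver = RingSolver ℚₚ.+-*-rawRing almostCommutativeRing ι-morphism coefficient≟

  -- An ordered field with square roots whose order is only classically total.
  record RealField : Set₁ where
    field
      algebra : ℚ-Algebra
    open ℚ-Algebra algebra public
    infix 4 _≤_
    field
      _≤_          : Carrier → Carrier → Set
      ≤-reflexive  : ∀ {x y} → x ≈ y → x ≤ y
      ≤-trans      : ∀ {x y z} → x ≤ y → y ≤ z → x ≤ z
      ≤-antisym    : ∀ {x y} → x ≤ y → y ≤ x → x ≈ y
      +-mono-≤     : ∀ {x y u v} → x ≤ y → u ≤ v → x + u ≤ y + v
      *-nonneg     : ∀ {x y} → 0# ≤ x → 0# ≤ y → 0# ≤ x * y
      ≤-stable     : ∀ {x y} → ¬ ¬ x ≤ y → x ≤ y
      ≤-total      : ∀ x y → ¬ ¬ (x ≤ y ⊎ y ≤ x)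
      *-cancel-≤0  : ∀ {x y} → ¬ x ≤ 0# → x * y ≤ 0# → y ≤ 0#
      ι-mono       : ∀ {p q} → p ℚ.≤ q → ι p ≤ ι q
      ι-reflects-≤ : ∀ {p q} → ι p ≤ ι q → p ℚ.≤ q
      archimedean  : ∀ {x} → (∀ ε → 0ℚ ℚ.< ε → x ≤ ι ε) → x ≤ 0#
      upper-bound  : ∀ x → ∃[ n ] x ≤ ι (+ n ℚ./ 1)
      √            : Carrier → Carrier
      √-nonneg     : ∀ x → 0# ≤ √ x
      √-square     : ∀ {x} → 0# ≤ x → √ x * √ x ≈ x

  record ComplexField (F : RealField) : Set₁ where
    private module R = RealField F
    field
      algebra : ℚ-Algebra
    open ℚ-Algebra algebra public
    field
      real          : R.Carrier → Carrier
      real-cong     : ∀ {x y} → x R.≈ y → real x ≈ real y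
      real-injective : ∀ {x y} → real x ≈ real y → x R.≈ y
      real-+        : ∀ x y → real (x R.+ y) ≈ real x + real y
      real-*        : ∀ x y → real (x R.* y) ≈ real x * real y
      real-ι        : ∀ q → real (R.ι q) ≈ ι q
      conj          : Carrier → Carrier
      conj-cong     : ∀ {z w} → z ≈ w → conj z ≈ conj w
      conj-+        : ∀ z w → conj (z + w) ≈ conj z + conj w
      conj-*        : ∀ z w → conj (z * w) ≈ conj z * conj w
      conj-real     : ∀ x → conj (real x) ≈ real x
      ∣_∣           : Carrier → R.Carrier
      ∣∣-cong       : ∀ {z w} → z ≈ w → ∣ z ∣ R.≈ ∣ w ∣
      ∣∣-nonneg     : ∀ z → R.0# R.≤ ∣ z ∣
      ∣∣-triangle   : ∀ z w → ∣ z + w ∣ R.≤ ∣ z ∣ R.+ ∣ w ∣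
      ∣∣-*          : ∀ z w → ∣ z * w ∣ R.≈ ∣ z ∣ R.* ∣ w ∣
      ∣∣-square     : ∀ z → real (∣ z ∣ R.* ∣ z ∣) ≈ z * conj z
      ∣∣-conj       : ∀ z → ∣ conj z ∣ R.≈ ∣ z ∣
      ∣∣-real       : ∀ {x} → R.0# R.≤ x → ∣ real x ∣ R.≈ x
      ∣∣-zero       : ∀ {z} → ∣ z ∣ R.≤ R.0# → z ≈ 0#

  module RealFieldProperties (F : RealField) where
    open RealField F hiding (_-_)
    open Solver

    ≤-refl : ∀ {x} → x ≤ x
    ≤-refl = ≤-reflexive refl

    ≤-preorder : Preorder 0ℓ 0ℓ 0ℓ
    ≤-preorder = record
      { _≈_ = _≈_ ; _≲_ = _≤_
      ; isPreorder = record { isEquivalence = isEquivalence ; reflexive = ≤-reflexive ; trans = ≤-trans } }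

    module ≤-Reasoning = Relation.Binary.Reasoning.Preorder ≤-preorder

    ≤-respˡ : ∀ {x y z} → x ≈ y → x ≤ z → y ≤ z
    ≤-respˡ e = ≤-trans (≤-reflexive (sym e))

    ≤-respʳ : ∀ {x y z} → y ≈ z → x ≤ y → x ≤ z
    ≤-respʳ e h = ≤-trans h (≤-reflexive e)

    ≤-resp : ∀ {x x′ y y′} → x ≈ x′ → y ≈ y′ → x ≤ y → x′ ≤ y′
    ≤-resp e e′ h = ≤-respˡ e (≤-respʳ e′ h)

    ≤-by-difference : ∀ {x y} d → 0# ≤ d → y ≈ x + d → x ≤ y
    ≤-by-difference {x} d 0≤d e = ≤-resp (+-identityʳ x) (sym e) (+-mono-≤ ≤-refl 0≤d)

    0≤-difference : ∀ {x y} → x ≤ y → 0# ≤ y + - x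
    0≤-difference {x} x≤y = ≤-respˡ (-‿inverseʳ x) (+-mono-≤ x≤y ≤-refl)

    +-nonneg : ∀ {x y} → 0# ≤ x → 0# ≤ y → 0# ≤ x + y
    +-nonneg h k = ≤-respˡ (+-identityʳ 0#) (+-mono-≤ h k)

    *-mono-≤ : ∀ {a b c d} → 0# ≤ b → 0# ≤ c → a ≤ b → c ≤ d → a * c ≤ b * d
    *-mono-≤ {a} {b} {c} {d} 0≤b 0≤c a≤b c≤d = ≤-by-difference
      (c * (b + - a) + b * (d + - c))
      (+-nonneg (*-nonneg 0≤c (0≤-difference a≤b)) (*-nonneg 0≤b (0≤-difference c≤d)))
      (solve 4 (λ a b c d → b :* d := a :* c :+ (c :* (b :+ :- a) :+ b :* (d :+ :- c))) refl a b c d)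

    neg-nonneg : ∀ {x} → x ≤ 0# → 0# ≤ - x
    neg-nonneg {x} h = ≤-respʳ (+-identityˡ (- x)) (0≤-difference h)

    square-nonneg : ∀ x → 0# ≤ x * x
    square-nonneg x = ≤-stable λ k → ≤-total 0# x [
      (λ 0≤x → k (*-nonneg 0≤x 0≤x)) ,
      (λ x≤0 → k (≤-respʳ (solve 1 (λ x → :- x :* :- x := x :* x) refl x)
        (*-nonneg (neg-nonneg x≤0) (neg-nonneg x≤0)))) ]′

    square-cancel-≤ : ∀ {x y} → 0# ≤ y → x * x ≤ y * y → x ≤ y
    square-cancel-≤ {x} {y} 0≤y x²≤y² = ≤-stable λ ¬x≤y →
      ¬x≤y (≤-by-difference (- (x + - y))
        (neg-nonneg (*-cancel-≤0
          (λ x+y≤0 → ¬x≤y (≤-by-difference _ (+-nonneg (neg-nonneg x+y≤0) (+-nonneg 0≤y 0≤y))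
            (solve 2 (λ x y → y := x :+ (:- (x :+ y) :+ (y :+ y))) refl x y)))
          (≤-by-difference _ (0≤-difference x²≤y²)
            (trans (sym ι-0) (solve 2 (λ x y → con 0ℚ := (x :+ y) :* (x :+ :- y) :+ (y :* y :+ :- (x :* x))) refl x y)))))
        (solve 2 (λ x y → y := x :+ :- (x :+ :- y)) refl x y))

    square-injective : ∀ {x y} → 0# ≤ x → 0# ≤ y → x * x ≈ y * y → x ≈ y
    square-injective 0≤x 0≤y e = ≤-antisym
      (square-cancel-≤ 0≤y (≤-reflexive e)) (square-cancel-≤ 0≤x (≤-reflexive (sym e)))

    norm : Carrier → Carrier → Carrier
    norm a b = √ (a * a + b * b)

    norm-nonneg : ∀ a b → 0# ≤ norm a b
    norm-nonneg a b = √-nonneg (a * a + b * b)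

    norm-square : ∀ a b → norm a b * norm a b ≈ a * a + b * b
    norm-square a b = √-square (+-nonneg (square-nonneg a) (square-nonneg b))

    norm-unique : ∀ {a b r} → 0# ≤ r → r * r ≈ a * a + b * b → norm a b ≈ r
    norm-unique {a} {b} 0≤r e = square-injective (norm-nonneg a b) 0≤r (trans (norm-square a b) (sym e))

    norm-cong : ∀ {a b c d} → a ≈ c → b ≈ d → norm a b ≈ norm c d
    norm-cong {a} {b} {c} {d} a≈c b≈d = norm-unique (norm-nonneg c d)
      (trans (norm-square c d) (sym (+-cong (*-cong a≈c a≈c) (*-cong b≈d b≈d))))

    norm-* : ∀ a b c d → norm (a * c + - (b * d)) (a * d + b * c) ≈ norm a b * norm c d
    norm-* a b c d = norm-unique (*-nonneg (norm-nonneg a b) (norm-nonneg c d)) (trans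
      (trans (solve 2 (λ m n → m :* n :* (m :* n) := m :* m :* (n :* n)) refl (norm a b) (norm c d))
        (*-cong (norm-square a b) (norm-square c d)))
      (solve 4 (λ a b c d → (a :* a :+ b :* b) :* (c :* c :+ d :* d) :=
        (a :* c :+ :- (b :* d)) :* (a :* c :+ :- (b :* d)) :+ (a :* d :+ b :* c) :* (a :* d :+ b :* c)) refl a b c d))

    dot≤norm*norm : ∀ a b c d → a * c + b * d ≤ norm a b * norm c d
    dot≤norm*norm a b c d = square-cancel-≤ (*-nonneg (norm-nonneg a b) (norm-nonneg c d))
      (≤-by-difference ((a * d + - (b * c)) * (a * d + - (b * c))) (square-nonneg _) (trans
        (trans (solve 2 (λ m n → m :* n :* (m :* n) := m :* m :* (n :* n)) refl (norm a b) (norm c d))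
          (*-cong (norm-square a b) (norm-square c d)))
        (solve 4 (λ a b c d → (a :* a :+ b :* b) :* (c :* c :+ d :* d) :=
          (a :* c :+ b :* d) :* (a :* c :+ b :* d) :+ (a :* d :+ :- (b :* c)) :* (a :* d :+ :- (b :* c))) refl a b c d)))

    norm-triangle : ∀ a b c d → norm (a + c) (b + d) ≤ norm a b + norm c d
    norm-triangle a b c d = square-cancel-≤ (+-nonneg (norm-nonneg a b) (norm-nonneg c d))
      (≤-by-difference (m * n + - (a * c + b * d) + (m * n + - (a * c + b * d)))
        (+-nonneg (0≤-difference (dot≤norm*norm a b c d)) (0≤-difference (dot≤norm*norm a b c d)))
        (trans
          (trans (solve 2 (λ m n → (m :+ n) :* (m :+ n) := m :* m :+ n :* n :+ (m :* n :+ m :* n)) refl m n)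
            (+-congʳ (+-cong (norm-square a b) (norm-square c d))))
          (trans (solve 5 (λ a b c d e → a :* a :+ b :* b :+ (c :* c :+ d :* d) :+ (e :+ e) :=
              (a :+ c) :* (a :+ c) :+ (b :+ d) :* (b :+ d) :+ (e :+ :- (a :* c :+ b :* d) :+ (e :+ :- (a :* c :+ b :* d))))
              refl a b c d (m * n))
            (+-congʳ (sym (norm-square (a + c) (b + d)))))))
      where
      m = norm a b
      n = norm c d

    norm-real : ∀ {x} → 0# ≤ x → norm x 0# ≈ x
    norm-real {x} 0≤x = norm-unique 0≤x
      (sym (trans (+-congˡ (zeroʳ 0#)) (+-identityʳ (x * x))))

    norm-neg : ∀ a b → norm a (- b) ≈ norm a b
    norm-neg a b = norm-unique (norm-nonneg a b) (trans (norm-square a b)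
      (solve 2 (λ a b → a :* a :+ b :* b := a :* a :+ :- b :* :- b) refl a b))

    square-zero : ∀ {x} → x * x ≤ 0# → x ≈ 0#
    square-zero {x} h = ≤-antisym (below h)
      (≤-respʳ (solve 1 (λ x → :- :- x := x) refl x)
        (neg-nonneg (below (≤-respˡ (solve 1 (λ x → x :* x := :- x :* :- x) refl x) h))))
      where
      below : ∀ {y} → y * y ≤ 0# → y ≤ 0#
      below h = square-cancel-≤ ≤-refl (≤-respʳ (sym (zeroʳ 0#)) h)

    norm-zero : ∀ {a b} → norm a b ≤ 0# → a ≈ 0# × b ≈ 0#
    norm-zero {a} {b} h = part (square-nonneg b) a²+b²≤0 ,
      part (square-nonneg a) (≤-respˡ (+-comm (a * a) (b * b)) a²+b²≤0)
      where
      a²+b²≤0 : a * a + b * b ≤ 0#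
      a²+b²≤0 = ≤-resp (norm-square a b) (zeroʳ 0#)
        (*-mono-≤ ≤-refl (norm-nonneg a b) h h)
      part : ∀ {x y} → 0# ≤ y → x * x + y ≤ 0# → x ≈ 0#
      part 0≤y h = square-zero (≤-trans (≤-by-difference _ 0≤y refl) h)

module Complex where

  open import Defs
  open Reals
  open Ordered
  open import Algebra.Bundles using (CommutativeRing)
  open import Data.Rational.Base using (_+_; _*_; -_)
  open import Data.Rational.Properties using (+-inverseʳ; +-identityʳ)
  open import Relation.Binary.PropositionalEquality using (_≡_; refl; sym; trans)

  ℝ-algebra : ℚ-Algebra
  ℝ-algebra = record
    { commutativeRing = ℝ-commutativeRing
    ; ι = fromℚ
    ; ι-+ = λ p q → pointwise-≃ℝ {fromℚ (p + q)} {fromℚ p +ℝ fromℚ q} λ _ → refl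
    ; ι-* = λ p q → pointwise-≃ℝ {fromℚ (p * q)} {fromℚ p *ℝ fromℚ q} λ _ → refl
    ; ι-neg = λ p → pointwise-≃ℝ {fromℚ (- p)} { -ℝ fromℚ p} λ _ → refl
    ; ι-0 = pointwise-≃ℝ {fromℚ 0ℚ} {0ℝ} λ _ → refl
    ; ι-1 = pointwise-≃ℝ {fromℚ 1ℚ} {1ℝ} λ _ → refl }

  ℝ-field : RealField
  ℝ-field = record
    { algebra = ℝ-algebra
    ; _≤_ = _≤ℝ_
    ; ≤-reflexive = λ {x} {y} → ≃ℝ⇒≤ℝ {x} {y}
    ; ≤-trans = λ {x} {y} {z} → ≤ℝ-trans {x} {y} {z}
    ; ≤-antisym = λ {x} {y} → ≤ℝ-antisym {x} {y}
    ; +-mono-≤ = λ {x} {y} {u} {v} → +ℝ-mono-≤ℝ {x} {y} {u} {v}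
    ; *-nonneg = λ {x} {y} → 0≤ℝ-product {x} {y}
    ; ≤-stable = λ {x} {y} → ≤ℝ-stable {x} {y}
    ; ≤-total = ≤ℝ-total
    ; *-cancel-≤0 = λ {x} {y} → *ℝ-cancel-≤0 {x} {y}
    ; ι-mono = fromℚ-mono
    ; ι-reflects-≤ = fromℚ-reflects-≤
    ; archimedean = λ {x} → ≤ℝ-archimedean {x}
    ; upper-bound = ≤ℝ-upper-bound
    ; √ = √ℝ
    ; √-nonneg = √ℝ-nonneg
    ; √-square = λ {x} → √ℝ-square {x} }

  private
    module R where
      open CommutativeRing ℝ-commutativeRing public
      open RealFieldProperties ℝ-field public

  pointwise-≃ℂ : ∀ {z w} → (∀ n → seq (re z) n ≡ seq (re w) n) → (∀ n → seq (im z) n ≡ seq (im w) n) → z ≃ℂ w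
  pointwise-≃ℂ {z} {w} p q = pointwise-≃ℝ {re z} {re w} p , pointwise-≃ℝ {im z} {im w} q

  module _ where
    open ℚSolver.+-*-Solver

    +ℂ-cong : ∀ {z z′ w w′} → z ≃ℂ z′ → w ≃ℂ w′ → z +ℂ w ≃ℂ z′ +ℂ w′
    +ℂ-cong {a +i b} {a′ +i b′} {c +i d} {c′ +i d′} (p , q) (r , s) =
      +ℝ-cong {a} {a′} {c} {c′} p r , +ℝ-cong {b} {b′} {d} {d′} q s

    *ℂ-cong : ∀ {z z′ w w′} → z ≃ℂ z′ → w ≃ℂ w′ → z *ℂ w ≃ℂ z′ *ℂ w′
    *ℂ-cong {a +i b} {a′ +i b′} {c +i d} {c′ +i d′} (p , q) (r , s) =
      +ℝ-cong {a *ℝ c} {a′ *ℝ c′} { -ℝ (b *ℝ d)} { -ℝ (b′ *ℝ d′)}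
        (*ℝ-cong {a} {a′} {c} {c′} p r)
        (-ℝ-cong {b *ℝ d} {b′ *ℝ d′} (*ℝ-cong {b} {b′} {d} {d′} q s)) ,
      +ℝ-cong {a *ℝ d} {a′ *ℝ d′} {b *ℝ c} {b′ *ℝ c′}
        (*ℝ-cong {a} {a′} {d} {d′} p s) (*ℝ-cong {b} {b′} {c} {c′} q r)

    ℂ-commutativeRing : CommutativeRing 0ℓ 0ℓ
    ℂ-commutativeRing = record
      { Carrier = ℂ ; _≈_ = _≃ℂ_ ; _+_ = _+ℂ_ ; _*_ = _*ℂ_ ; -_ = -ℂ_ ; 0# = 0ℂ ; 1# = 1ℂ
      ; isCommutativeRing = record
        { isRing = record
          { +-isAbelianGroup = record
            { isGroup = record
              { isMonoid = record
                { isSemigroup = record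
                  { isMagma = record
                    { isEquivalence = record
                      { refl = λ {z} → pointwise-≃ℂ {z} {z} (λ _ → refl) (λ _ → refl)
                      ; sym = λ {z} {w} (p , q) → ≃ℝ-sym {re z} {re w} p , ≃ℝ-sym {im z} {im w} q
                      ; trans = λ {z} {w} {v} (p , q) (r , s) →
                          ≃ℝ-trans {re z} {re w} {re v} p r , ≃ℝ-trans {im z} {im w} {im v} q s }
                    ; ∙-cong = λ {z} {z′} {w} {w′} → +ℂ-cong {z} {z′} {w} {w′} }
                  ; assoc = λ z w v → pointwise-≃ℂ {z +ℂ w +ℂ v} {z +ℂ (w +ℂ v)}
                      (λ n → assoc+ (seq (re z) n) (seq (re w) n) (seq (re v) n))
                      (λ n → assoc+ (seq (im z) n) (seq (im w) n) (seq (im v) n)) }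
                ; identity = (λ z → pointwise-≃ℂ {0ℂ +ℂ z} {z}
                               (λ n → identity+ (seq (re z) n)) (λ n → identity+ (seq (im z) n)))
                           , (λ z → pointwise-≃ℂ {z +ℂ 0ℂ} {z}
                               (λ n → +-identityʳ (seq (re z) n)) (λ n → +-identityʳ (seq (im z) n))) }
              ; inverse = (λ z → pointwise-≃ℂ { -ℂ z +ℂ z} {0ℂ}
                            (λ n → inverse+ (seq (re z) n)) (λ n → inverse+ (seq (im z) n)))
                        , (λ z → pointwise-≃ℂ {z +ℂ -ℂ z} {0ℂ}
                            (λ n → +-inverseʳ (seq (re z) n)) (λ n → +-inverseʳ (seq (im z) n)))
              ; ⁻¹-cong = λ {z} {w} (p , q) → -ℝ-cong {re z} {re w} p , -ℝ-cong {im z} {im w} q }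
            ; comm = λ z w → pointwise-≃ℂ {z +ℂ w} {w +ℂ z}
                (λ n → comm+ (seq (re z) n) (seq (re w) n)) (λ n → comm+ (seq (im z) n) (seq (im w) n)) }
          ; *-cong = λ {z} {z′} {w} {w′} → *ℂ-cong {z} {z′} {w} {w′}
          ; *-assoc = λ z w v → pointwise-≃ℂ {z *ℂ w *ℂ v} {z *ℂ (w *ℂ v)}
              (λ n → solve 6 (λ a b c d e f →
                 (a :* c :+ :- (b :* d)) :* e :+ :- ((a :* d :+ b :* c) :* f) :=
                 a :* (c :* e :+ :- (d :* f)) :+ :- (b :* (c :* f :+ d :* e))) refl
                 (seq (re z) n) (seq (im z) n) (seq (re w) n) (seq (im w) n) (seq (re v) n) (seq (im v) n))
              (λ n → solve 6 (λ a b c d e f →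
                 (a :* c :+ :- (b :* d)) :* f :+ (a :* d :+ b :* c) :* e :=
                 a :* (c :* f :+ d :* e) :+ b :* (c :* e :+ :- (d :* f))) refl
                 (seq (re z) n) (seq (im z) n) (seq (re w) n) (seq (im w) n) (seq (re v) n) (seq (im v) n))
          ; *-identity = (λ z → pointwise-≃ℂ {1ℂ *ℂ z} {z}
                           (λ n → solve 2 (λ a b → con 1ℚ :* a :+ :- (con 0ℚ :* b) := a) refl (seq (re z) n) (seq (im z) n))
                           (λ n → solve 2 (λ a b → con 1ℚ :* b :+ con 0ℚ :* a := b) refl (seq (re z) n) (seq (im z) n)))
                       , (λ z → pointwise-≃ℂ {z *ℂ 1ℂ} {z}
                           (λ n → solve 2 (λ a b → a :* con 1ℚ :+ :- (b :* con 0ℚ) := a) refl (seq (re z) n) (seq (im z) n))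
                           (λ n → solve 2 (λ a b → a :* con 0ℚ :+ b :* con 1ℚ := b) refl (seq (re z) n) (seq (im z) n)))
          ; distrib = (λ z w v → pointwise-≃ℂ {z *ℂ (w +ℂ v)} {z *ℂ w +ℂ z *ℂ v}
                (λ n → solve 6 (λ a b c d e f →
                   a :* (c :+ e) :+ :- (b :* (d :+ f)) := a :* c :+ :- (b :* d) :+ (a :* e :+ :- (b :* f))) refl
                   (seq (re z) n) (seq (im z) n) (seq (re w) n) (seq (im w) n) (seq (re v) n) (seq (im v) n))
                (λ n → solve 6 (λ a b c d e f →
                   a :* (d :+ f) :+ b :* (c :+ e) := a :* d :+ b :* c :+ (a :* f :+ b :* e)) refl
                   (seq (re z) n) (seq (im z) n) (seq (re w) n) (seq (im w) n) (seq (re v) n) (seq (im v) n)))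
            , (λ z w v → pointwise-≃ℂ {(w +ℂ v) *ℂ z} {w *ℂ z +ℂ v *ℂ z}
                (λ n → solve 6 (λ a b c d e f →
                   (c :+ e) :* a :+ :- ((d :+ f) :* b) := c :* a :+ :- (d :* b) :+ (e :* a :+ :- (f :* b))) refl
                   (seq (re z) n) (seq (im z) n) (seq (re w) n) (seq (im w) n) (seq (re v) n) (seq (im v) n))
                (λ n → solve 6 (λ a b c d e f →
                   (c :+ e) :* b :+ (d :+ f) :* a := c :* b :+ d :* a :+ (e :* b :+ f :* a)) refl
                   (seq (re z) n) (seq (im z) n) (seq (re w) n) (seq (im w) n) (seq (re v) n) (seq (im v) n))) }
        ; *-comm = λ z w → pointwise-≃ℂ {z *ℂ w} {w *ℂ z}
            (λ n → solve 4 (λ a b c d → a :* c :+ :- (b :* d) := c :* a :+ :- (d :* b)) refl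
              (seq (re z) n) (seq (im z) n) (seq (re w) n) (seq (im w) n))
            (λ n → solve 4 (λ a b c d → a :* d :+ b :* c := c :* b :+ d :* a) refl
              (seq (re z) n) (seq (im z) n) (seq (re w) n) (seq (im w) n)) } }
      where
      assoc+ = solve 3 (λ a b c → a :+ b :+ c := a :+ (b :+ c)) refl
      identity+ = solve 1 (λ a → con 0ℚ :+ a := a) refl
      inverse+ = solve 1 (λ a → :- a :+ a := con 0ℚ) refl
      comm+ = solve 2 (λ a b → a :+ b := b :+ a) refl

    fromℝ-+ : ∀ x y → fromℝ (x +ℝ y) ≃ℂ fromℝ x +ℂ fromℝ y
    fromℝ-+ x y = pointwise-≃ℂ {fromℝ (x +ℝ y)} {fromℝ x +ℂ fromℝ y} (λ _ → refl) (λ _ → refl)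

    fromℝ-* : ∀ x y → fromℝ (x *ℝ y) ≃ℂ fromℝ x *ℂ fromℝ y
    fromℝ-* x y = pointwise-≃ℂ {fromℝ (x *ℝ y)} {fromℝ x *ℂ fromℝ y}
      (λ n → solve 2 (λ a b → a :* b := a :* b :+ :- (con 0ℚ :* con 0ℚ)) refl (seq x n) (seq y n))
      (λ n → solve 2 (λ a b → con 0ℚ := a :* con 0ℚ :+ con 0ℚ :* b) refl (seq x n) (seq y n))

    ℂ-algebra : ℚ-Algebra
    ℂ-algebra = record
      { commutativeRing = ℂ-commutativeRing
      ; ι = λ q → fromℝ (fromℚ q)
      ; ι-+ = λ p q → fromℝ-+ (fromℚ p) (fromℚ q)
      ; ι-* = λ p q → fromℝ-* (fromℚ p) (fromℚ q)
      ; ι-neg = λ p → pointwise-≃ℂ {fromℝ (fromℚ (- p))} { -ℂ fromℝ (fromℚ p)} (λ _ → refl) (λ _ → refl)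
      ; ι-0 = pointwise-≃ℂ {fromℝ (fromℚ 0ℚ)} {0ℂ} (λ _ → refl) (λ _ → refl)
      ; ι-1 = pointwise-≃ℂ {fromℝ (fromℚ 1ℚ)} {1ℂ} (λ _ → refl) (λ _ → refl) }

    conj-*ℂ : ∀ z w → conj (z *ℂ w) ≃ℂ conj z *ℂ conj w
    conj-*ℂ z w = pointwise-≃ℂ {conj (z *ℂ w)} {conj z *ℂ conj w}
      (λ n → solve 4 (λ a b c d → a :* c :+ :- (b :* d) := a :* c :+ :- (:- b :* :- d)) refl
              (seq (re z) n) (seq (im z) n) (seq (re w) n) (seq (im w) n))
      (λ n → solve 4 (λ a b c d → :- (a :* d :+ b :* c) := a :* :- d :+ :- b :* c) refl
              (seq (re z) n) (seq (im z) n) (seq (re w) n) (seq (im w) n))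

    conj-+ℂ : ∀ z w → conj (z +ℂ w) ≃ℂ conj z +ℂ conj w
    conj-+ℂ z w = pointwise-≃ℂ {conj (z +ℂ w)} {conj z +ℂ conj w} (λ _ → refl)
      (λ n → solve 2 (λ b d → :- (b :+ d) := :- b :+ :- d) refl (seq (im z) n) (seq (im w) n))

    ℂ-field : ComplexField ℝ-field
    ℂ-field = record
      { algebra = ℂ-algebra
      ; real = fromℝ
      ; real-cong = λ {x} {y} e → e , pointwise-≃ℝ {0ℝ} {0ℝ} λ _ → refl
      ; real-injective = proj₁
      ; real-+ = fromℝ-+
      ; real-* = fromℝ-*
      ; real-ι = λ q → pointwise-≃ℂ {fromℝ (fromℚ q)} {fromℝ (fromℚ q)} (λ _ → refl) (λ _ → refl)
      ; conj = conj
      ; conj-cong = λ {z} {w} (p , q) → p , -ℝ-cong {im z} {im w} q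
      ; conj-+ = conj-+ℂ
      ; conj-* = conj-*ℂ
      ; conj-real = λ x → pointwise-≃ℂ {conj (fromℝ x)} {fromℝ x} (λ _ → refl) (λ _ → refl)
      ; ∣_∣ = ∣_∣ℂ
      ; ∣∣-cong = λ {z} {w} (p , q) → R.norm-cong {re z} {im z} {re w} {im w} p q
      ; ∣∣-nonneg = λ z → R.norm-nonneg (re z) (im z)
      ; ∣∣-triangle = λ z w → R.norm-triangle (re z) (im z) (re w) (im w)
      ; ∣∣-* = λ z w → R.norm-* (re z) (im z) (re w) (im w)
      ; ∣∣-square = λ z →
          ≃ℝ-trans {∣ z ∣ℂ *ℝ ∣ z ∣ℂ} {re z *ℝ re z +ℝ im z *ℝ im z} {re (z *ℂ conj z)}
            (R.norm-square (re z) (im z))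
            (pointwise-≃ℝ {re z *ℝ re z +ℝ im z *ℝ im z} {re (z *ℂ conj z)} λ n →
              solve 2 (λ a b → a :* a :+ b :* b := a :* a :+ :- (b :* :- b)) refl (seq (re z) n) (seq (im z) n)) ,
          pointwise-≃ℝ {0ℝ} {im (z *ℂ conj z)} λ n →
              solve 2 (λ a b → con 0ℚ := a :* :- b :+ b :* a) refl (seq (re z) n) (seq (im z) n)
      ; ∣∣-conj = λ z → R.norm-neg (re z) (im z)
      ; ∣∣-real = λ {x} → R.norm-real {x}
      ; ∣∣-zero = λ {z} → R.norm-zero {re z} {im z} }

module Series where

  open Reals using (toℚᵘ-/)
  open Ordered
  open import Data.Fin.Base as Fin using (toℕ)
  open import Data.Integer.Base as ℤ using (+_)
  open import Data.Nat.Base using (_!)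
  open import Data.Rational.Base using (_/_)
  open import Data.Rational.Unnormalised.Base as ℚᵘ using (mkℚᵘ)
  import Data.Rational.Unnormalised.Properties as ℚᵘₚ
  open ≡ using (_≡_)

  fromℕℚ : ℕ → ℚ
  fromℕℚ n = + n / 1

  reciprocal-* : ∀ m k d .{{_ : NonZero k}} .{{_ : NonZero d}} → d ≡ suc m ℕ.* k →
    fromℕℚ (suc m) ℚ.* (+ 1 / d) ≡ + 1 / k
  reciprocal-* m (suc k) (suc d) e = ℚₚ.toℚᵘ-injective (begin
    ℚ.toℚᵘ (fromℕℚ (suc m) ℚ.* (+ 1 / suc d))
      ≈⟨ ℚₚ.toℚᵘ-homo-* (fromℕℚ (suc m)) (+ 1 / suc d) ⟩
    ℚ.toℚᵘ (fromℕℚ (suc m)) ℚᵘ.* ℚ.toℚᵘ (+ 1 / suc d)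
      ≈⟨ ℚᵘₚ.*-cong (toℚᵘ-/ (+ suc m) 0) (toℚᵘ-/ (+ 1) d) ⟩
    mkℚᵘ (+ suc m) 0 ℚᵘ.* mkℚᵘ (+ 1) d
      ≈⟨ ℚᵘ.*≡* cross ⟩
    mkℚᵘ (+ 1) k
      ≈⟨ ℚᵘₚ.≃-sym (toℚᵘ-/ (+ 1) k) ⟩
    ℚ.toℚᵘ (+ 1 / suc k) ∎)
    where
    open ℚᵘₚ.≃-Reasoning
    cross : (+ suc m ℤ.* + 1) ℤ.* + suc k ≡ + 1 ℤ.* + (1 ℕ.* suc d)
    cross = ≡.trans (≡.cong (ℤ._* + suc k) (ℤₚ.*-identityʳ (+ suc m)))
      (≡.trans (≡.sym (ℤₚ.pos-* (suc m) (suc k)))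
        (≡.trans (≡.cong +_ (≡.trans (≡.sym e) (≡.sym (ℕₚ.*-identityˡ (suc d)))))
          (≡.sym (ℤₚ.*-identityˡ (+ (1 ℕ.* suc d))))))

  fromℕℚ-suc : ∀ n → fromℕℚ (suc n) ≡ fromℕℚ n ℚ.+ 1ℚ
  fromℕℚ-suc n = ℚₚ.toℚᵘ-injective (begin
    ℚ.toℚᵘ (fromℕℚ (suc n)) ≈⟨ toℚᵘ-/ (+ suc n) 0 ⟩
    mkℚᵘ (+ suc n) 0 ≈⟨ ℚᵘ.*≡* (≡.cong (ℤ._* + 1) (≡.trans (≡.cong +_ (ℕₚ.+-comm 1 n))
       (≡.cong (ℤ._+ + 1) (≡.sym (ℤₚ.*-identityʳ (+ n)))))) ⟩
    mkℚᵘ (+ n) 0 ℚᵘ.+ mkℚᵘ (+ 1) 0 ≈⟨ ℚᵘₚ.+-congˡ (mkℚᵘ (+ 1) 0) (ℚᵘₚ.≃-sym (toℚᵘ-/ (+ n) 0)) ⟩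
    ℚ.toℚᵘ (fromℕℚ n) ℚᵘ.+ ℚ.toℚᵘ 1ℚ ≈⟨ ℚᵘₚ.≃-sym (ℚₚ.toℚᵘ-homo-+ (fromℕℚ n) 1ℚ) ⟩
    ℚ.toℚᵘ (fromℕℚ n ℚ.+ 1ℚ) ∎)
    where open ℚᵘₚ.≃-Reasoning

  1/! : ℕ → ℚ
  1/! k = (+ 1 / (k !)) {{k ℕₚ.!≢0}}

  1/!-suc : ∀ k → fromℕℚ (suc k) ℚ.* 1/! (suc k) ≡ 1/! k
  1/!-suc k = reciprocal-* k (k !) (suc k !) {{k ℕₚ.!≢0}} {{suc k ℕₚ.!≢0}} ≡.refl

  module PowerSeries (A : ℚ-Algebra) where
    open ℚ-Algebra A hiding (_-_)
    open Solver
    open import Algebra.Properties.Semiring.Exp semiring public using (_^_; ^-congˡ)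
    open import Algebra.Properties.Semiring.Sum semiring public using (sum)
    open import Relation.Binary.Reasoning.Setoid setoid

    nat : ℕ → Carrier
    nat n = ι (fromℕℚ n)

    nat-suc : ∀ n → nat (suc n) ≈ nat n + 1#
    nat-suc n = trans (reflexive (≡.cong ι (fromℕℚ-suc n))) (trans (ι-+ (fromℕℚ n) 1ℚ) (+-congˡ ι-1))

    partialSum : (ℕ → Carrier) → ℕ → Carrier
    partialSum g zero    = 0#
    partialSum g (suc n) = partialSum g n + g n

    partialSum-cong : ∀ {g h} n → (∀ k → g k ≈ h k) → partialSum g n ≈ partialSum h n
    partialSum-cong zero    e = refl
    partialSum-cong (suc n) e = +-cong (partialSum-cong n e) (e n)

    partialSum-suc : ∀ g n → partialSum g (suc n) ≈ g 0 + partialSum (g ∘ suc) n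
    partialSum-suc g zero    = +-comm 0# (g 0)
    partialSum-suc g (suc n) = trans (+-congʳ (partialSum-suc g n)) (+-assoc _ _ _)

    sum≈partialSum : ∀ g n → sum {n} (λ i → g (toℕ i)) ≈ partialSum g n
    sum≈partialSum g zero    = refl
    sum≈partialSum g (suc n) = trans (+-congˡ (sum≈partialSum (g ∘ suc) n)) (sym (partialSum-suc g n))

    infixl 7 _⋆_
    _⋆_ : (ℕ → Carrier) → (ℕ → Carrier) → ℕ → Carrier
    (a ⋆ b) zero    = a 0 * b 0
    (a ⋆ b) (suc n) = a 0 * b (suc n) + ((a ∘ suc) ⋆ b) n

    ⋆-cong : ∀ {a a′ b b′} n → (∀ k → a k ≈ a′ k) → (∀ k → b k ≈ b′ k) → (a ⋆ b) n ≈ (a′ ⋆ b′) n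
    ⋆-cong zero    e f = *-cong (e 0) (f 0)
    ⋆-cong (suc n) e f = +-cong (*-cong (e 0) (f (suc n))) (⋆-cong n (e ∘ suc) f)

    ⋆-+ : ∀ a a′ b n → ((λ k → a k + a′ k) ⋆ b) n ≈ (a ⋆ b) n + (a′ ⋆ b) n
    ⋆-+ a a′ b zero    = distribʳ (b 0) (a 0) (a′ 0)
    ⋆-+ a a′ b (suc n) = trans (+-congˡ (⋆-+ (a ∘ suc) (a′ ∘ suc) b n))
      (solve 5 (λ x y z u v → (x :+ y) :* z :+ (u :+ v) := x :* z :+ u :+ (y :* z :+ v)) refl
        (a 0) (a′ 0) (b (suc n)) (((a ∘ suc) ⋆ b) n) (((a′ ∘ suc) ⋆ b) n))

    ⋆-scaleˡ : ∀ c a b n → ((λ k → c * a k) ⋆ b) n ≈ c * (a ⋆ b) n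
    ⋆-scaleˡ c a b zero    = *-assoc c (a 0) (b 0)
    ⋆-scaleˡ c a b (suc n) = trans (+-congˡ (⋆-scaleˡ c (a ∘ suc) b n))
      (solve 4 (λ c x z u → c :* x :* z :+ c :* u := c :* (x :* z :+ u)) refl
        c (a 0) (b (suc n)) (((a ∘ suc) ⋆ b) n))

    ⋆-scaleʳ : ∀ c a b n → (a ⋆ (λ k → c * b k)) n ≈ c * (a ⋆ b) n
    ⋆-scaleʳ c a b zero    = solve 3 (λ c x y → x :* (c :* y) := c :* (x :* y)) refl c (a 0) (b 0)
    ⋆-scaleʳ c a b (suc n) = trans (+-congˡ (⋆-scaleʳ c (a ∘ suc) b n))
      (solve 4 (λ c x z u → x :* (c :* z) :+ c :* u := c :* (x :* z :+ u)) refl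
        c (a 0) (b (suc n)) (((a ∘ suc) ⋆ b) n))

    derivative : (ℕ → Carrier) → ℕ → Carrier
    derivative a k = nat (suc k) * a (suc k)

    derivative-shift : ∀ a k → derivative a (suc k) ≈ derivative (a ∘ suc) k + a (suc (suc k))
    derivative-shift a k = trans (*-congʳ (nat-suc (suc k)))
      (trans (distribʳ (a (suc (suc k))) (nat (suc k)) 1#) (+-congˡ (*-identityˡ _)))

    leibniz : ∀ a b n → derivative (a ⋆ b) n ≈ (derivative a ⋆ b) n + (a ⋆ derivative b) n
    leibniz a b zero = begin
      nat 1 * (a 0 * b 1 + a 1 * b 0)
        ≈⟨ solve 5 (λ n x y z w → n :* (x :* y :+ z :* w) := n :* z :* w :+ x :* (n :* y)) refl
             (nat 1) (a 0) (b 1) (a 1) (b 0) ⟩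
      nat 1 * a 1 * b 0 + a 0 * (nat 1 * b 1) ∎
    leibniz a b (suc n) = begin
      nat (suc (suc n)) * (a 0 * b (suc (suc n)) + c)
        ≈⟨ solve 4 (λ m x y c → m :* (x :* y :+ c) := x :* (m :* y) :+ m :* c) refl
             (nat (suc (suc n))) (a 0) (b (suc (suc n))) c ⟩
      a 0 * derivative b (suc n) + nat (suc (suc n)) * c
        ≈⟨ +-congˡ (trans (*-congʳ (nat-suc (suc n))) (trans (distribʳ c (nat (suc n)) 1#)
             (+-cong (leibniz (a ∘ suc) b n) (*-identityˡ c)))) ⟩
      a 0 * derivative b (suc n) + ((derivative (a ∘ suc) ⋆ b) n + ((a ∘ suc) ⋆ derivative b) n
        + (a 1 * b (suc n) + ((a ∘ suc ∘ suc) ⋆ b) n))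
        ≈⟨ solve 5 (λ x d e y f → x :+ (d :+ e :+ (y :+ f)) := y :+ (d :+ f) :+ (x :+ e)) refl
             (a 0 * derivative b (suc n)) ((derivative (a ∘ suc) ⋆ b) n) (((a ∘ suc) ⋆ derivative b) n)
             (a 1 * b (suc n)) (((a ∘ suc ∘ suc) ⋆ b) n) ⟩
      a 1 * b (suc n) + ((derivative (a ∘ suc) ⋆ b) n + ((a ∘ suc ∘ suc) ⋆ b) n)
        + (a 0 * derivative b (suc n) + ((a ∘ suc) ⋆ derivative b) n)
        ≈⟨ +-congʳ (+-cong (*-congʳ (trans (sym (*-identityˡ (a 1))) (*-congʳ (sym ι-1))))
             (trans (sym (⋆-+ (derivative (a ∘ suc)) (a ∘ suc ∘ suc) b n))
               (⋆-cong n (λ k → sym (derivative-shift a k)) (λ _ → refl)))) ⟩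
      derivative a 0 * b (suc n) + ((derivative a ∘ suc) ⋆ b) n
        + (a 0 * derivative b (suc n) + ((a ∘ suc) ⋆ derivative b) n) ∎
      where
      c = ((a ∘ suc) ⋆ b) (suc n)

    expTerm : Carrier → ℕ → Carrier
    expTerm z k = ι (1/! k) * z ^ k

    expSum : Carrier → ℕ → Carrier
    expSum z = partialSum (expTerm z)

    derivative-expTerm : ∀ z k → derivative (expTerm z) k ≈ z * expTerm z k
    derivative-expTerm z k = begin
      nat (suc k) * (ι (1/! (suc k)) * (z * z ^ k)) ≈⟨ *-assoc _ _ _ ⟨
      nat (suc k) * ι (1/! (suc k)) * (z * z ^ k)
        ≈⟨ *-congʳ (trans (sym (ι-* (fromℕℚ (suc k)) (1/! (suc k)))) (reflexive (≡.cong ι (1/!-suc k)))) ⟩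
      ι (1/! k) * (z * z ^ k)
        ≈⟨ solve 3 (λ i z w → i :* (z :* w) := z :* (i :* w)) refl (ι (1/! k)) z (z ^ k) ⟩
      z * (ι (1/! k) * z ^ k) ∎

    1/suc : ∀ k → ι (+ 1 / suc k) * nat (suc k) ≈ 1#
    1/suc k = trans (sym (ι-* (+ 1 / suc k) (fromℕℚ (suc k)))) (trans
      (reflexive (≡.cong ι (≡.trans (ℚₚ.*-comm (+ 1 / suc k) (fromℕℚ (suc k)))
        (reciprocal-* k 1 (suc k) (≡.sym (ℕₚ.*-identityʳ (suc k))))))) ι-1)

    -- A series is determined by its constant term and its derivative.
    expTerm-unique : ∀ {a z} → a 0 ≈ 1# → (∀ k → derivative a k ≈ z * a k) → ∀ k → a k ≈ expTerm z k
    expTerm-unique a0 a′ zero = trans a0 (sym (trans (*-identityʳ (ι (1/! 0))) ι-1))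
    expTerm-unique {a} {z} a0 a′ (suc k) = begin
      a (suc k) ≈⟨ divide (a (suc k)) ⟩
      ι (+ 1 / suc k) * derivative a k ≈⟨ *-congˡ (trans (a′ k) (*-congˡ (expTerm-unique a0 a′ k))) ⟩
      ι (+ 1 / suc k) * (z * expTerm z k) ≈⟨ *-congˡ (derivative-expTerm z k) ⟨
      ι (+ 1 / suc k) * derivative (expTerm z) k ≈⟨ divide (expTerm z (suc k)) ⟨
      expTerm z (suc k) ∎
      where
      divide : ∀ x → x ≈ ι (+ 1 / suc k) * (nat (suc k) * x)
      divide x = sym (trans (sym (*-assoc _ _ x)) (trans (*-congʳ (1/suc k)) (*-identityˡ x)))

    expTerm-0 : ∀ z → expTerm z 0 ≈ 1#
    expTerm-0 z = trans (*-identityʳ (ι (1/! 0))) ι-1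

    expTerm-+ : ∀ z w n → (expTerm z ⋆ expTerm w) n ≈ expTerm (z + w) n
    expTerm-+ z w = expTerm-unique
      (trans (*-cong (expTerm-0 z) (expTerm-0 w)) (*-identityˡ 1#))
      λ k → begin
        derivative (expTerm z ⋆ expTerm w) k ≈⟨ leibniz (expTerm z) (expTerm w) k ⟩
        (derivative (expTerm z) ⋆ expTerm w) k + (expTerm z ⋆ derivative (expTerm w)) k
          ≈⟨ +-cong (⋆-cong k (derivative-expTerm z) (λ _ → refl)) (⋆-cong k (λ _ → refl) (derivative-expTerm w)) ⟩
        ((λ i → z * expTerm z i) ⋆ expTerm w) k + (expTerm z ⋆ (λ i → w * expTerm w i)) k
          ≈⟨ +-cong (⋆-scaleˡ z (expTerm z) (expTerm w) k) (⋆-scaleʳ w (expTerm z) (expTerm w) k) ⟩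
        z * (expTerm z ⋆ expTerm w) k + w * (expTerm z ⋆ expTerm w) k
          ≈⟨ distribʳ _ z w ⟨
        (z + w) * (expTerm z ⋆ expTerm w) k ∎

    expSum-cong : ∀ {x y} → x ≈ y → ∀ n → expSum x n ≈ expSum y n
    expSum-cong x≈y n = partialSum-cong n λ k → *-congˡ (^-congˡ k x≈y)

    expSum-0 : ∀ n → expSum 0# (suc n) ≈ 1#
    expSum-0 zero    = trans (+-identityˡ _) (expTerm-0 0#)
    expSum-0 (suc n) = trans (+-cong (expSum-0 n) (trans (*-congˡ (zeroˡ _)) (zeroʳ _))) (+-identityʳ 1#)

    -- Σ_{j+k<n} a_j b_k
    triangle : (ℕ → Carrier) → (ℕ → Carrier) → ℕ → Carrier
    triangle a b zero    = 0#
    triangle a b (suc n) = a 0 * partialSum b (suc n) + triangle (a ∘ suc) b n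

    triangle-suc : ∀ a b n → triangle a b (suc n) ≈ triangle a b n + (a ⋆ b) n
    triangle-suc a b zero = trans (+-identityʳ _) (trans (*-congˡ (+-identityˡ (b 0))) (sym (+-identityˡ _)))
    triangle-suc a b (suc n) = trans (+-congˡ (triangle-suc (a ∘ suc) b n))
      (solve 5 (λ x s y t c → x :* (s :+ y) :+ (t :+ c) := x :* s :+ t :+ (x :* y :+ c)) refl
        (a 0) (partialSum b (suc n)) (b (suc n)) (triangle (a ∘ suc) b n) (((a ∘ suc) ⋆ b) n))

    triangle≈partialSum : ∀ a b n → triangle a b n ≈ partialSum (a ⋆ b) n
    triangle≈partialSum a b zero    = refl
    triangle≈partialSum a b (suc n) = trans (triangle-suc a b n) (+-congʳ (triangle≈partialSum a b n))

    triangle-exp : ∀ z w n → triangle (expTerm z) (expTerm w) n ≈ expSum (z + w) n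
    triangle-exp z w n = trans (triangle≈partialSum (expTerm z) (expTerm w) n)
      (partialSum-cong n (expTerm-+ z w))

module Exp where

  open Reals using (Eventually; archimedean; share)
  open Ordered
  open Series
  open import Data.Integer.Base as ℤ using (+_)
  open import Data.Nat.Base using (_!)
  open import Data.Rational.Base using (_/_)
  open ≡ using (_≡_)

  module NonnegativeSeries (F : RealField) where
    open RealField F hiding (_-_; archimedean)
    open RealFieldProperties F public
    open PowerSeries algebra public
    open Solver

    0≤1 : 0# ≤ 1#
    0≤1 = ≤-resp ι-0 ι-1 (ι-mono (ℚₚ.<⇒≤ (ℚₚ.positive⁻¹ 1ℚ)))

    ι-nonneg : ∀ {q} → 0ℚ ℚ.≤ q → 0# ≤ ι q
    ι-nonneg h = ≤-respˡ ι-0 (ι-mono h)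

    nat-0 : nat 0 ≈ 0#
    nat-0 = ι-0

    nat-1 : nat 1 ≈ 1#
    nat-1 = ι-1

    nat-nonneg : ∀ n → 0# ≤ nat n
    nat-nonneg zero    = ≤-reflexive (sym nat-0)
    nat-nonneg (suc n) = ≤-respʳ (sym (nat-suc n)) (+-nonneg (nat-nonneg n) 0≤1)

    nat-+ : ∀ m n → nat (m ℕ.+ n) ≈ nat m + nat n
    nat-+ zero    n = trans (sym (+-identityˡ (nat n))) (+-congʳ (sym nat-0))
    nat-+ (suc m) n = trans (nat-suc (m ℕ.+ n)) (trans (+-congʳ (nat-+ m n))
      (trans (solve 3 (λ a b c → a :+ b :+ c := a :+ c :+ b) refl (nat m) (nat n) 1#)
        (+-congʳ (sym (nat-suc m)))))

    nat-* : ∀ m n → nat (m ℕ.* n) ≈ nat m * nat n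
    nat-* zero    n = trans nat-0 (trans (sym (zeroˡ (nat n))) (*-congʳ (sym nat-0)))
    nat-* (suc m) n = trans (nat-+ n (m ℕ.* n)) (trans (+-congˡ (nat-* m n))
      (sym (trans (*-congʳ (nat-suc m)) (trans (distribʳ (nat n) (nat m) 1#)
        (trans (+-congˡ (*-identityˡ (nat n))) (+-comm _ _))))))

    nat-mono : ∀ {m n} → m ℕ.≤ n → nat m ≤ nat n
    nat-mono {m} {n} m≤n = ≤-respʳ
      (trans (sym (nat-+ m (n ℕ.∸ m))) (reflexive (≡.cong nat (ℕₚ.m+[n∸m]≡n m≤n))))
      (≤-by-difference (nat (n ℕ.∸ m)) (nat-nonneg (n ℕ.∸ m)) refl)

    1/suc-nonneg : ∀ k → 0# ≤ ι (+ 1 / suc k)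
    1/suc-nonneg k = ι-nonneg (ℚₚ.nonNegative⁻¹ _ {{ℚₚ.normalize-nonNeg 1 (suc k)}})

    scale : ∀ x ε → 0ℚ ℚ.< ε → ∃[ δ ] 0ℚ ℚ.< δ × ι δ * x ≤ ι ε
    scale x ε ε>0 =
      let m , x≤m = upper-bound x
          δ , δ>0 , δ*≡ε = share (fromℕℚ m ℚ.+ 1ℚ) ε>0 (0<m+1 m)
      in δ , δ>0 , ≤-trans (*-mono-≤-nonneg (ι-nonneg (ℚₚ.<⇒≤ δ>0)) x≤m)
        (≤-by-difference (ι δ) (ι-nonneg (ℚₚ.<⇒≤ δ>0))
          (trans (reflexive (≡.cong ι (≡.sym δ*≡ε))) (trans (ι-* δ _)
            (trans (*-congˡ (trans (ι-+ (fromℕℚ m) 1ℚ) (+-congˡ ι-1)))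
              (trans (distribˡ (ι δ) (nat m) 1#) (+-congˡ (*-identityʳ (ι δ))))))))
      where
      0<m+1 : ∀ m → 0ℚ ℚ.< fromℕℚ m ℚ.+ 1ℚ
      0<m+1 m = ℚₚ.≤-<-trans (ℚₚ.nonNegative⁻¹ (fromℕℚ m) {{ℚₚ.normalize-nonNeg m 1}})
        (≡.subst (ℚ._< fromℕℚ m ℚ.+ 1ℚ) (ℚₚ.+-identityʳ (fromℕℚ m)) (ℚₚ.+-monoʳ-< (fromℕℚ m) (ℚₚ.positive⁻¹ 1ℚ)))
      *-mono-≤-nonneg : ∀ {c x y} → 0# ≤ c → x ≤ y → c * x ≤ c * y
      *-mono-≤-nonneg {c} {x} {y} 0≤c x≤y = ≤-by-difference _ (*-nonneg 0≤c (0≤-difference x≤y))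
        (solve 3 (λ c x y → c :* y := c :* x :+ c :* (y :+ :- x)) refl c x y)

    partialSum-nonneg : ∀ {g} → (∀ k → 0# ≤ g k) → ∀ n → 0# ≤ partialSum g n
    partialSum-nonneg 0≤g zero    = ≤-refl
    partialSum-nonneg 0≤g (suc n) = +-nonneg (partialSum-nonneg 0≤g n) (0≤g n)

    partialSum-mono : ∀ {g} → (∀ k → 0# ≤ g k) → ∀ {m n} → m ℕ.≤′ n → partialSum g m ≤ partialSum g n
    partialSum-mono 0≤g (ℕ.≤′-reflexive ≡.refl) = ≤-refl
    partialSum-mono 0≤g (ℕ.≤′-step {n} m≤n) =
      ≤-trans (partialSum-mono 0≤g m≤n) (≤-by-difference _ (0≤g n) refl)

    module _ {a b : ℕ → Carrier} (0≤b : ∀ k → 0# ≤ b k) where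

      triangle≤product : (∀ k → 0# ≤ a k) → ∀ n m → n ℕ.≤ m →
        triangle a b n ≤ partialSum a n * partialSum b m
      triangle≤product = go a
        where
        go : ∀ a → (∀ k → 0# ≤ a k) → ∀ n m → n ℕ.≤ m → triangle a b n ≤ partialSum a n * partialSum b m
        go a 0≤a zero    m n≤m = ≤-reflexive (sym (zeroˡ _))
        go a 0≤a (suc n) m n≤m = ≤-respʳ
          (trans (sym (distribʳ (partialSum b m) (a 0) (partialSum (a ∘ suc) n))) (*-congʳ (sym (partialSum-suc a n))))
          (+-mono-≤ (*-mono-≤ (0≤a 0) (partialSum-nonneg 0≤b (suc n)) ≤-refl (partialSum-mono 0≤b (ℕₚ.≤⇒≤′ n≤m)))
            (go (a ∘ suc) (0≤a ∘ suc) n m (ℕₚ.≤-trans (ℕₚ.n≤1+n n) n≤m)))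

      product≤triangle : (∀ k → 0# ≤ a k) → ∀ n m →
        partialSum a n * partialSum b m ≤ triangle a b (n ℕ.+ m)
      product≤triangle = go a
        where
        triangle-nonneg : ∀ a → (∀ k → 0# ≤ a k) → ∀ n → 0# ≤ triangle a b n
        triangle-nonneg a 0≤a zero    = ≤-refl
        triangle-nonneg a 0≤a (suc n) =
          +-nonneg (*-nonneg (0≤a 0) (partialSum-nonneg 0≤b (suc n))) (triangle-nonneg (a ∘ suc) (0≤a ∘ suc) n)
        go : ∀ a → (∀ k → 0# ≤ a k) → ∀ n m → partialSum a n * partialSum b m ≤ triangle a b (n ℕ.+ m)
        go a 0≤a zero    m = ≤-respˡ (sym (zeroˡ _)) (triangle-nonneg a 0≤a m)
        go a 0≤a (suc n) m = ≤-respˡ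
          (trans (sym (distribʳ (partialSum b m) (a 0) (partialSum (a ∘ suc) n))) (*-congʳ (sym (partialSum-suc a n))))
          (+-mono-≤ (*-mono-≤ (0≤a 0) (partialSum-nonneg 0≤b m) ≤-refl
              (partialSum-mono 0≤b (ℕₚ.≤⇒≤′ (ℕₚ.m≤n+m m (suc n)))))
            (go (a ∘ suc) (0≤a ∘ suc) n m))

    -- If g (suc k) ≤ q * g k, then c = 1 / (1 - q) will do.
    geometric-tail : ∀ {g} c M → (∀ k → M ℕ.≤ k → g k + c * g (suc k) ≤ c * g k) →
      ∀ n → partialSum g (n ℕ.+ M) + c * g (n ℕ.+ M) ≤ partialSum g M + c * g M
    geometric-tail c M h zero    = ≤-refl
    geometric-tail {g} c M h (suc n) = ≤-trans
      (≤-respˡ (sym (+-assoc _ _ _)) (+-mono-≤ ≤-refl (h (n ℕ.+ M) (ℕₚ.m≤n+m M n))))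
      (geometric-tail c M h n)

    ^-nonneg : ∀ {x} → 0# ≤ x → ∀ k → 0# ≤ x ^ k
    ^-nonneg 0≤x zero    = 0≤1
    ^-nonneg 0≤x (suc k) = *-nonneg 0≤x (^-nonneg 0≤x k)

    ^-mono : ∀ {x y} → 0# ≤ x → x ≤ y → ∀ k → x ^ k ≤ y ^ k
    ^-mono 0≤x x≤y zero    = ≤-refl
    ^-mono 0≤x x≤y (suc k) = *-mono-≤ (≤-trans 0≤x x≤y) (^-nonneg 0≤x k) x≤y (^-mono 0≤x x≤y k)

    1/!-nonneg : ∀ k → 0# ≤ ι (1/! k)
    1/!-nonneg k = ι-nonneg (ℚₚ.nonNegative⁻¹ _ {{ℚₚ.normalize-nonNeg 1 (k !) {{k ℕₚ.!≢0}}}})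

    expTerm-nonneg : ∀ {x} → 0# ≤ x → ∀ k → 0# ≤ expTerm x k
    expTerm-nonneg 0≤x k = *-nonneg (1/!-nonneg k) (^-nonneg 0≤x k)

    expTerm-mono : ∀ {x y} → 0# ≤ x → x ≤ y → ∀ k → expTerm x k ≤ expTerm y k
    expTerm-mono 0≤x x≤y k = *-mono-≤ (1/!-nonneg k) (^-nonneg 0≤x k) ≤-refl (^-mono 0≤x x≤y k)

    expSum-mono : ∀ {x y} → 0# ≤ x → x ≤ y → ∀ n → expSum x n ≤ expSum y n
    expSum-mono 0≤x x≤y zero    = ≤-refl
    expSum-mono 0≤x x≤y (suc n) = +-mono-≤ (expSum-mono 0≤x x≤y n) (expTerm-mono 0≤x x≤y n)

    expSum-nonneg : ∀ {x} → 0# ≤ x → ∀ n → 0# ≤ expSum x n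
    expSum-nonneg 0≤x = partialSum-nonneg (expTerm-nonneg 0≤x)

    expSum-+-≤ : ∀ {x y} → 0# ≤ x → 0# ≤ y → ∀ n → expSum (x + y) n ≤ expSum x n * expSum y n
    expSum-+-≤ {x} {y} 0≤x 0≤y n = ≤-respˡ (triangle-exp x y n)
      (triangle≤product (expTerm-nonneg 0≤y) (expTerm-nonneg 0≤x) n n ℕₚ.≤-refl)

    expSum-scale : ∀ {x} → 0# ≤ x → ∀ j n → expSum (nat j * x) (suc n) ≤ expSum x (suc n) ^ j
    expSum-scale {x} 0≤x zero n = ≤-reflexive (trans (expSum-cong (trans (*-congʳ nat-0) (zeroˡ x)) (suc n))
      (expSum-0 n))
    expSum-scale {x} 0≤x (suc j) n = ≤-respˡ
      (expSum-cong (sym (trans (*-congʳ (nat-suc j)) (trans (distribʳ x (nat j) 1#)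
        (trans (+-congˡ (*-identityˡ x)) (+-comm _ _))))) (suc n))
      (≤-trans (expSum-+-≤ 0≤x (*-nonneg (nat-nonneg j) 0≤x) (suc n))
        (*-mono-≤ (expSum-nonneg 0≤x (suc n)) (expSum-nonneg (*-nonneg (nat-nonneg j) 0≤x) (suc n)) ≤-refl
          (expSum-scale 0≤x j n)))

    expTerm-suc : ∀ x k → expTerm x (suc k) ≈ ι (+ 1 / suc k) * x * expTerm x k
    expTerm-suc x k = begin
      expTerm x (suc k) ≈⟨ *-identityˡ _ ⟨
      1# * expTerm x (suc k) ≈⟨ *-congʳ (1/suc k) ⟨
      ι (+ 1 / suc k) * nat (suc k) * expTerm x (suc k) ≈⟨ *-assoc _ _ _ ⟩
      ι (+ 1 / suc k) * derivative (expTerm x) k ≈⟨ *-congˡ (derivative-expTerm x k) ⟩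
      ι (+ 1 / suc k) * (x * expTerm x k) ≈⟨ *-assoc _ _ _ ⟨
      ι (+ 1 / suc k) * x * expTerm x k ∎
      where open import Relation.Binary.Reasoning.Setoid setoid

    module _ (r : ℕ) where
      private
        x = nat r
        t = expTerm x
        2r = r ℕ.+ r
        0≤t = expTerm-nonneg (nat-nonneg r)
        C = partialSum t 2r + nat 2 * t 2r

      nat-2* : ∀ y → nat 2 * y ≈ y + y
      nat-2* y = trans (*-congʳ (trans (nat-suc 1) (+-congʳ nat-1))) (trans (distribʳ y 1# 1#)
        (+-cong (*-identityˡ y) (*-identityˡ y)))

      halving : ∀ k → 2r ℕ.≤ k → t k + nat 2 * t (suc k) ≤ nat 2 * t k
      halving k 2r≤k = ≤-respʳ (sym (nat-2* (t k))) (+-mono-≤ ≤-refl (begin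
        nat 2 * t (suc k) ≈⟨ *-congˡ (expTerm-suc x k) ⟩
        nat 2 * (i * x * t k) ≈⟨ solve 4 (λ a i x t → a :* (i :* x :* t) := i :* (a :* x) :* t) refl (nat 2) i x (t k) ⟩
        i * (nat 2 * x) * t k ≈⟨ *-congʳ (*-congˡ (trans (nat-2* x) (sym (nat-+ r r)))) ⟩
        i * nat 2r * t k ≲⟨ *-mono-≤ (*-nonneg (1/suc-nonneg k) (nat-nonneg (suc k))) (0≤t k)
          (*-mono-≤ (1/suc-nonneg k) (nat-nonneg 2r) ≤-refl (nat-mono (ℕₚ.≤-trans 2r≤k (ℕₚ.n≤1+n k)))) ≤-refl ⟩
        i * nat (suc k) * t k ≈⟨ trans (*-congʳ (1/suc k)) (*-identityˡ (t k)) ⟩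
        t k ∎))
        where
        open ≤-Reasoning
        i = ι (+ 1 / suc k)

      expTerm-bounded : ∀ k → 2r ℕ.≤ k → t k ≤ C
      expTerm-bounded k 2r≤k = begin
        t k ≲⟨ ≤-by-difference (partialSum t k + t k)
          (+-nonneg (partialSum-nonneg 0≤t k) (0≤t k))
          (trans (+-congˡ (nat-2* (t k))) (solve 2 (λ s t → s :+ (t :+ t) := t :+ (s :+ t)) refl (partialSum t k) (t k))) ⟩
        partialSum t k + nat 2 * t k
          ≈⟨ reflexive (≡.cong (λ k → partialSum t k + nat 2 * t k) (≡.sym (ℕₚ.m∸n+n≡m 2r≤k))) ⟩
        partialSum t (k ℕ.∸ 2r ℕ.+ 2r) + nat 2 * t (k ℕ.∸ 2r ℕ.+ 2r)
          ≲⟨ geometric-tail (nat 2) 2r halving (k ℕ.∸ 2r) ⟩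
        C ∎
        where open ≤-Reasoning

      expSum-tail : ∀ ε → 0ℚ ℚ.< ε → Eventually λ k → ∀ n → partialSum t (n ℕ.+ k) ≤ partialSum t k + ι ε
      expSum-tail ε ε>0 =
        let δ , δ>0 , δ*≤ε = scale (nat 2 * (x * C)) ε ε>0
            N , 1/k≤δ = archimedean δ δ>0
        in suc (N ℕ.⊔ 2r) , λ where
          (suc k) (ℕ.s≤s N⊔2r≤k) n →
            let 2r≤k = ℕₚ.m⊔n≤o⇒n≤o N 2r N⊔2r≤k in begin
            partialSum t (n ℕ.+ suc k) ≲⟨ ≤-by-difference _ (*-nonneg (nat-nonneg 2) (0≤t (n ℕ.+ suc k))) refl ⟩
            partialSum t (n ℕ.+ suc k) + nat 2 * t (n ℕ.+ suc k)
              ≲⟨ geometric-tail (nat 2) (suc k) (λ i k<i → halving i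
                   (ℕₚ.≤-trans 2r≤k (ℕₚ.≤-trans (ℕₚ.n≤1+n k) k<i))) n ⟩
            partialSum t (suc k) + nat 2 * t (suc k) ≲⟨ +-mono-≤ ≤-refl (begin
              nat 2 * t (suc k) ≈⟨ *-congˡ (expTerm-suc x k) ⟩
              nat 2 * (ι (+ 1 / suc k) * x * t k)
                ≈⟨ solve 4 (λ a i x t → a :* (i :* x :* t) := i :* (a :* (x :* t))) refl (nat 2) _ x (t k) ⟩
              ι (+ 1 / suc k) * (nat 2 * (x * t k))
                ≲⟨ *-mono-≤ (ι-nonneg (ℚₚ.<⇒≤ δ>0)) (*-nonneg (nat-nonneg 2) (*-nonneg (nat-nonneg r) (0≤t k)))
                     (ι-mono (1/k≤δ k (ℕₚ.m⊔n≤o⇒m≤o N 2r N⊔2r≤k)))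
                     (*-mono-≤ (nat-nonneg 2) (*-nonneg (nat-nonneg r) (0≤t k)) ≤-refl
                         (*-mono-≤ (nat-nonneg r) (0≤t k) ≤-refl (expTerm-bounded k 2r≤k))) ⟩
              ι δ * (nat 2 * (x * C)) ≲⟨ δ*≤ε ⟩
              ι ε ∎) ⟩
            partialSum t (suc k) + ι ε ∎
        where open ≤-Reasoning

module ComplexExp where

  open Reals using (Eventually; eventually-map; eventually-map₂; eventually-witness; half; halves)
  open Ordered
  open Series
  open Exp
  open import Data.Integer.Base as ℤ using (+_)
  open import Data.Fin.Base as Fin using (toℕ)
  open import Data.Nat.Base using (_!)
  open ≡ using (_≡_)

  module ComplexFieldProperties {F : RealField} (C : ComplexField F) where
    module R where
      open RealField F public hiding (_-_)
      open NonnegativeSeries F public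
    open ComplexField C hiding (_-_) public
    open R using (_≤_)
    open Solver
    open PowerSeries algebra public
    open R.Solver public using ()
      renaming (solve to solveR; _:+_ to _⊞_; _:*_ to _⊠_; :-_ to ⊟_; _:=_ to _⊜_; con to conR)

    real-1 : real R.1# ≈ 1#
    real-1 = trans (real-cong (R.sym R.ι-1)) (trans (real-ι 1ℚ) ι-1)

    real-0 : real R.0# ≈ 0#
    real-0 = trans (real-cong (R.sym R.ι-0)) (trans (real-ι 0ℚ) ι-0)

    ∣ι∣ : ∀ {q} → 0ℚ ℚ.≤ q → ∣ ι q ∣ R.≈ R.ι q
    ∣ι∣ {q} 0≤q = R.trans (∣∣-cong (sym (real-ι q))) (∣∣-real (R.ι-nonneg 0≤q))

    ∣0∣ : ∣ 0# ∣ R.≈ R.0#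
    ∣0∣ = R.trans (∣∣-cong (sym real-0)) (∣∣-real R.≤-refl)

    ∣1∣ : ∣ 1# ∣ R.≈ R.1#
    ∣1∣ = R.trans (∣∣-cong (sym real-1)) (∣∣-real R.0≤1)

    ∣neg∣ : ∀ z → ∣ - z ∣ R.≈ ∣ z ∣
    ∣neg∣ z = R.square-injective (∣∣-nonneg (- z)) (∣∣-nonneg z)
      (R.trans (R.sym (∣∣-* (- z) (- z))) (R.trans
        (∣∣-cong (solve 1 (λ z → :- z :* :- z := z :* z) refl z)) (∣∣-* z z)))

    ∣-∣-sym : ∀ z w → ∣ z + - w ∣ R.≈ ∣ w + - z ∣
    ∣-∣-sym z w = R.trans (R.sym (∣neg∣ _))
      (∣∣-cong (solve 2 (λ z w → :- (z :+ :- w) := w :+ :- z) refl z w))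

    ∣^∣ : ∀ z k → ∣ z ^ k ∣ R.≈ ∣ z ∣ R.^ k
    ∣^∣ z zero    = ∣1∣
    ∣^∣ z (suc k) = R.trans (∣∣-* z (z ^ k)) (R.*-congˡ (∣^∣ z k))

    conj-1 : conj 1# ≈ 1#
    conj-1 = trans (conj-cong (sym real-1)) (trans (conj-real R.1#) real-1)

    conj-0 : conj 0# ≈ 0#
    conj-0 = trans (conj-cong (sym real-0)) (trans (conj-real R.0#) real-0)

    conj-ι : ∀ q → conj (ι q) ≈ ι q
    conj-ι q = trans (conj-cong (sym (real-ι q))) (trans (conj-real (R.ι q)) (real-ι q))

    conj-^ : ∀ z k → conj (z ^ k) ≈ conj z ^ k
    conj-^ z zero    = conj-1
    conj-^ z (suc k) = trans (conj-* z (z ^ k)) (*-congˡ (conj-^ z k))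

    real-neg : ∀ x → real (R.- x) ≈ - real x
    real-neg x = begin
      real (R.- x) ≈⟨ solve 2 (λ a b → a := :- b :+ (b :+ a)) refl (real (R.- x)) (real x) ⟩
      - real x + (real x + real (R.- x))
        ≈⟨ +-congˡ (trans (sym (real-+ x (R.- x))) (trans (real-cong (R.-‿inverseʳ x)) real-0)) ⟩
      - real x + 0# ≈⟨ +-identityʳ _ ⟩
      - real x ∎
      where open import Relation.Binary.Reasoning.Setoid setoid

    real-^ : ∀ x k → real (x R.^ k) ≈ real x ^ k
    real-^ x zero    = real-1
    real-^ x (suc k) = trans (real-* x (x R.^ k)) (*-congˡ (real-^ x k))

    x≤∣real∣ : ∀ x → x ≤ ∣ real x ∣
    x≤∣real∣ x = R.square-cancel-≤ (∣∣-nonneg (real x)) (R.≤-reflexive (real-injective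
      (trans (real-* x x) (trans (*-congˡ (sym (conj-real x))) (sym (∣∣-square (real x)))))))

    expTerm-∣∣ : ∀ {z x} → ∣ z ∣ ≤ x → ∀ k → ∣ expTerm z k ∣ ≤ R.expTerm x k
    expTerm-∣∣ {z} {x} z≤x k = R.≤-respˡ
      (R.sym (R.trans (∣∣-* (ι (1/! k)) (z ^ k))
        (R.*-cong (∣ι∣ (ℚₚ.nonNegative⁻¹ _ {{ℚₚ.normalize-nonNeg 1 (k !) {{k ℕₚ.!≢0}}}})) (∣^∣ z k))))
      (R.expTerm-mono (∣∣-nonneg z) z≤x k)

    real-expSum : ∀ x n → real (R.expSum x n) ≈ expSum (real x) n
    real-expSum x zero    = real-0
    real-expSum x (suc n) = trans (real-+ _ _) (+-cong (real-expSum x n)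
      (trans (real-* _ _) (*-cong (real-ι (1/! n)) (real-^ x n))))

    module _ {b : ℕ → Carrier} {B : ℕ → R.Carrier} (b≤B : ∀ k → ∣ b k ∣ ≤ B k) where

      private
        0≤B : ∀ k → R.0# ≤ B k
        0≤B k = R.≤-trans (∣∣-nonneg (b k)) (b≤B k)

      partialSum-majorant : ∀ {m n} → m ℕ.≤′ n →
        ∣ partialSum b n + - partialSum b m ∣ ≤ R.partialSum B n R.+ R.- R.partialSum B m
      partialSum-majorant {m} (ℕ.≤′-reflexive ≡.refl) = R.≤-reflexive (R.trans (R.trans
        (∣∣-cong (-‿inverseʳ _)) ∣0∣) (R.sym (R.-‿inverseʳ _)))
      partialSum-majorant {m} (ℕ.≤′-step {n} m≤n) = R.≤-resp
        (∣∣-cong refl) (solveR 3 (λ x y z → x ⊞ ⊟ y ⊞ z ⊜ x ⊞ z ⊞ ⊟ y)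
          R.refl _ _ _)
        (R.≤-trans (R.≤-reflexive (∣∣-cong (solve 3 (λ x y z → x :+ z :+ :- y := x :+ :- y :+ z) refl _ _ _)))
          (R.≤-trans (∣∣-triangle _ _) (R.+-mono-≤ (partialSum-majorant m≤n) (b≤B n))))

      product-majorant : ∀ {a A} → (∀ k → ∣ a k ∣ ≤ A k) → ∀ n m → n ℕ.≤ m →
        ∣ partialSum a n * partialSum b m + - triangle a b n ∣
          ≤ R.partialSum A n R.* R.partialSum B m R.+ R.- R.triangle A B n
      product-majorant a≤A zero m n≤m = R.≤-reflexive (R.trans
        (∣∣-cong (trans (+-congʳ (zeroˡ _)) (-‿inverseʳ 0#)))
        (R.trans ∣0∣ (R.sym (R.trans (R.+-congʳ (R.zeroˡ _)) (R.-‿inverseʳ R.0#)))))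
      product-majorant {a} {A} a≤A (suc n) m n<m = R.≤-resp
        (∣∣-cong (trans
          (solve 5 (λ x s t S r → x :* (S :+ :- s) :+ (t :* S :+ :- r) := (x :+ t) :* S :+ :- (x :* s :+ r)) refl
            (a 0) (partialSum b (suc n)) (partialSum (a ∘ suc) n) (partialSum b m) (triangle (a ∘ suc) b n))
          (+-congʳ (*-congʳ (sym (partialSum-suc a n))))))
        (R.trans
          (solveR 5 (λ x s t S r → x ⊠ (S ⊞ ⊟ s) ⊞ (t ⊠ S ⊞ ⊟ r)
              ⊜ (x ⊞ t) ⊠ S ⊞ ⊟ (x ⊠ s ⊞ r)) R.refl
            (A 0) (R.partialSum B (suc n)) (R.partialSum (A ∘ suc) n) (R.partialSum B m) (R.triangle (A ∘ suc) B n))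
          (R.+-congʳ (R.*-congʳ (R.sym (R.partialSum-suc A n)))))
        (R.≤-trans (∣∣-triangle _ _) (R.+-mono-≤
          (R.≤-respˡ (R.sym (∣∣-* _ _))
            (R.*-mono-≤ (R.≤-trans (∣∣-nonneg _) (a≤A 0)) (∣∣-nonneg _) (a≤A 0) (partialSum-majorant (ℕₚ.≤⇒≤′ n<m))))
          (product-majorant (a≤A ∘ suc) n m (ℕₚ.≤-trans (ℕₚ.n≤1+n n) n<m))))

    -- The error is dominated by the same expression for a real r ≥ |z|, |w|, which is at most
    -- expSum (r + r) (n + n) - expSum (r + r) n.
    expSum-product-error : ∀ z w ε → 0ℚ ℚ.< ε → Eventually λ n →
      ∣ expSum z n * expSum w n + - expSum (z + w) n ∣ ≤ R.ι ε
    expSum-product-error z w ε ε>0 =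
      let r , z+w≤r = R.upper-bound (∣ z ∣ R.+ ∣ w ∣)
          x = R.nat r
          t = R.expTerm x
          0≤t = R.expTerm-nonneg (R.nat-nonneg r)
          z≤r = R.≤-trans (R.≤-by-difference _ (∣∣-nonneg w) R.refl) z+w≤r
          w≤r = R.≤-trans (R.≤-by-difference _ (∣∣-nonneg z) (R.+-comm _ _)) z+w≤r
          x+x = R.nat-+ r r
      in eventually-map (λ n tail → let open R.≤-Reasoning in begin
        ∣ expSum z n * expSum w n + - expSum (z + w) n ∣
          ≈⟨ ∣∣-cong (+-congˡ (-‿cong (sym (triangle-exp z w n)))) ⟩
        ∣ expSum z n * expSum w n + - triangle (expTerm z) (expTerm w) n ∣
          ≲⟨ product-majorant (expTerm-∣∣ w≤r) (expTerm-∣∣ z≤r) n n ℕₚ.≤-refl ⟩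
        R.expSum x n R.* R.expSum x n R.+ R.- R.triangle t t n
          ≲⟨ R.+-mono-≤ (R.product≤triangle 0≤t 0≤t n n) R.≤-refl ⟩
        R.triangle t t (n ℕ.+ n) R.+ R.- R.triangle t t n
          ≈⟨ R.+-cong (R.trans (R.triangle-exp x x (n ℕ.+ n)) (R.expSum-cong (R.sym x+x) (n ℕ.+ n)))
               (R.-‿cong (R.trans (R.triangle-exp x x n) (R.expSum-cong (R.sym x+x) n))) ⟩
        R.expSum (R.nat (r ℕ.+ r)) (n ℕ.+ n) R.+ R.- R.expSum (R.nat (r ℕ.+ r)) n
          ≲⟨ R.≤-respʳ (solveR 2 (λ s e → s ⊞ e ⊞ ⊟ s ⊜ e) R.refl _ (R.ι ε))
               (R.+-mono-≤ (tail n) R.≤-refl) ⟩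
        R.ι ε ∎) (R.expSum-tail (r ℕ.+ r) ε ε>0)

    infix 4 _⟶_
    _⟶_ : (ℕ → Carrier) → Carrier → Set
    u ⟶ z = ∀ ε → 0ℚ ℚ.< ε → Eventually λ n → ∣ u n + - z ∣ ≤ R.ι ε

    ι-halves : ∀ ε → R.ι (½ ℚ.* ε) R.+ R.ι (½ ℚ.* ε) R.≈ R.ι ε
    ι-halves ε = R.trans (R.sym (R.ι-+ _ _)) (R.reflexive (≡.cong R.ι (halves ε)))

    ∣-∣-triangle : ∀ z w v → ∣ z + - v ∣ ≤ ∣ z + - w ∣ R.+ ∣ w + - v ∣
    ∣-∣-triangle z w v = R.≤-respˡ
      (∣∣-cong (solve 3 (λ z w v → z :+ :- w :+ (w :+ :- v) := z :+ :- v) refl z w v)) (∣∣-triangle _ _)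

    ⟶-cong : ∀ {u v z w} → (∀ n → u n ≈ v n) → z ≈ w → u ⟶ z → v ⟶ w
    ⟶-cong u≈v z≈w h ε ε>0 = eventually-map
      (λ n → R.≤-respˡ (∣∣-cong (+-cong (u≈v n) (-‿cong z≈w)))) (h ε ε>0)

    ⟶-close : ∀ {u v z} → u ⟶ z → (∀ ε → 0ℚ ℚ.< ε → Eventually λ n → ∣ u n + - v n ∣ ≤ R.ι ε) → v ⟶ z
    ⟶-close {u} {v} {z} h k ε ε>0 = eventually-map₂
      (λ n p q → R.≤-trans (∣-∣-triangle (v n) (u n) z)
        (R.≤-respʳ (ι-halves ε) (R.+-mono-≤ (R.≤-respˡ (∣-∣-sym (u n) (v n)) q) p)))
      (h _ (half ε>0)) (k _ (half ε>0))

    ⟶-unique : ∀ {u z w} → u ⟶ z → u ⟶ w → z ≈ w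
    ⟶-unique {u} {z} {w} h k = trans (solve 2 (λ z w → z := z :+ :- w :+ w) refl z w)
      (trans (+-congʳ (∣∣-zero (R.archimedean λ ε ε>0 →
        let n , p , q = eventually-witness (eventually-map₂ (λ n → _,_) (h _ (half ε>0)) (k _ (half ε>0)))
        in R.≤-trans (∣-∣-triangle z (u n) w)
          (R.≤-respʳ (ι-halves ε) (R.+-mono-≤ (R.≤-respˡ (∣-∣-sym (u n) z) p) q)))))
        (+-identityˡ w))

    ⟶-* : ∀ {u v z w} → u ⟶ z → v ⟶ w → (λ n → u n * v n) ⟶ z * w
    ⟶-* {u} {v} {z} {w} h k ε ε>0 =
      let δ , δ>0 , δ*≤ε = R.scale (∣ w ∣ R.+ R.ι 1ℚ R.+ ∣ z ∣) ε ε>0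
          0≤δ = R.ι-nonneg (ℚₚ.<⇒≤ δ>0)
      in eventually-map₂ (λ n p (q , q′) → let open R.≤-Reasoning in begin
          ∣ u n * v n + - (z * w) ∣
            ≈⟨ ∣∣-cong (solve 4 (λ u v z w → u :* v :+ :- (z :* w) := (u :+ :- z) :* v :+ (v :+ :- w) :* z) refl (u n) (v n) z w) ⟩
          ∣ (u n + - z) * v n + (v n + - w) * z ∣ ≲⟨ ∣∣-triangle _ _ ⟩
          ∣ (u n + - z) * v n ∣ R.+ ∣ (v n + - w) * z ∣ ≈⟨ R.+-cong (∣∣-* _ _) (∣∣-* _ _) ⟩
          ∣ u n + - z ∣ R.* ∣ v n ∣ R.+ ∣ v n + - w ∣ R.* ∣ z ∣
            ≲⟨ R.+-mono-≤ (R.*-mono-≤ 0≤δ (∣∣-nonneg _) p (R.≤-trans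
                   (R.≤-respˡ (∣∣-cong (solve 2 (λ v w → w :+ (v :+ :- w) := v) refl (v n) w)) (∣∣-triangle w _))
                   (R.+-mono-≤ R.≤-refl q′)))
                 (R.*-mono-≤ 0≤δ (∣∣-nonneg _) q R.≤-refl) ⟩
          R.ι δ R.* (∣ w ∣ R.+ R.ι 1ℚ) R.+ R.ι δ R.* ∣ z ∣ ≈⟨ R.distribˡ _ _ _ ⟨
          R.ι δ R.* (∣ w ∣ R.+ R.ι 1ℚ R.+ ∣ z ∣) ≲⟨ δ*≤ε ⟩
          R.ι ε ∎)
        (h δ δ>0) (eventually-map₂ (λ n → _,_) (k δ δ>0) (k 1ℚ (ℚₚ.positive⁻¹ 1ℚ)))

    infix 4 _IsExp_
    _IsExp_ : Carrier → Carrier → Set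
    w IsExp z = (λ n → sum {n} λ i → expTerm z (toℕ i)) ⟶ w

    fromIsExp : ∀ {w z} → w IsExp z → expSum z ⟶ w
    fromIsExp {w} {z} = ⟶-cong (sum≈partialSum (expTerm z)) refl

    toIsExp : ∀ {w z} → expSum z ⟶ w → w IsExp z
    toIsExp {w} {z} = ⟶-cong (λ n → sym (sum≈partialSum (expTerm z) n)) refl

    IsExp-+ : ∀ {u v z w} → u IsExp z → v IsExp w → u * v IsExp z + w
    IsExp-+ {z = z} {w} p q = toIsExp
      (⟶-close (⟶-* (fromIsExp p) (fromIsExp q)) (expSum-product-error z w))

    IsExp-unique : ∀ {u v z} → u IsExp z → v IsExp z → u ≈ v
    IsExp-unique = ⟶-unique

    IsExp-cong : ∀ {u z w} → z ≈ w → u IsExp z → u IsExp w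
    IsExp-cong z≈w p = toIsExp (⟶-cong (expSum-cong z≈w) refl (fromIsExp p))

    IsExp-0 : 1# IsExp 0#
    IsExp-0 = toIsExp λ ε ε>0 → 1 , λ where
      (suc n) _ → R.≤-respˡ (R.sym (R.trans (∣∣-cong (trans (+-congʳ (expSum-0 n)) (-‿inverseʳ 1#))) ∣0∣))
        (R.ι-nonneg (ℚₚ.<⇒≤ ε>0))

    conj-expSum : ∀ z n → conj (expSum z n) ≈ expSum (conj z) n
    conj-expSum z zero    = conj-0
    conj-expSum z (suc n) = trans (conj-+ _ _) (+-cong (conj-expSum z n)
      (trans (conj-* _ _) (*-cong (conj-ι (1/! n)) (conj-^ z n))))

    conj-neg : ∀ z → conj (- z) ≈ - conj z
    conj-neg z = trans (conj-cong (solve 1 (λ z → :- z := con (ℚ.- 1ℚ) :* z) refl z))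
      (trans (conj-* _ _) (trans (*-congʳ (conj-ι _)) (solve 1 (λ z → con (ℚ.- 1ℚ) :* z := :- z) refl (conj z))))

    IsExp-conj : ∀ {u z} → u IsExp z → conj u IsExp conj z
    IsExp-conj {u} {z} p = toIsExp λ ε ε>0 → eventually-map (λ n → R.≤-respˡ (R.trans
        (R.sym (∣∣-conj _)) (∣∣-cong (trans (conj-+ _ _) (+-cong (conj-expSum z n) (conj-neg u))))))
      (fromIsExp p ε ε>0)

    IsExp-^ : ∀ {u z} → u IsExp z → ∀ k → u ^ k IsExp nat k * z
    IsExp-^ {z = z} h zero    = IsExp-cong (sym (trans (*-congʳ ι-0) (zeroˡ z))) IsExp-0
    IsExp-^ {z = z} h (suc k) = IsExp-cong (sym (trans (*-congʳ (nat-suc k))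
      (trans (distribʳ z (nat k) 1#) (trans (+-comm _ _) (+-congʳ (*-identityˡ z))))))
      (IsExp-+ h (IsExp-^ h k))

    IsExp-imaginary : ∀ {u z} → z + conj z ≈ 0# → u IsExp z → u * conj u ≈ 1#
    IsExp-imaginary z+z̄≈0 h = IsExp-unique (IsExp-cong z+z̄≈0 (IsExp-+ h (IsExp-conj h))) IsExp-0

    -- If e^y is real, then (e^y)² = |e^y|² = 1.
    IsExp-root : ∀ {u z w y} p → u IsExp z → w IsExp y → nat p * z ≈ y + y →
      y + conj y ≈ 0# → w ≈ conj w → u ^ p ≈ 1#
    IsExp-root {w = w} p u-exp w-exp pz≈2y imaginary w≈w̄ = trans
      (IsExp-unique (IsExp-cong pz≈2y (IsExp-^ u-exp p)) (IsExp-+ w-exp w-exp))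
      (trans (*-congˡ w≈w̄) (IsExp-imaginary imaginary w-exp))

module Logarithm where

  open Reals using (Eventually; eventually-map; eventually-map₂)
  open Ordered
  open Series
  open Exp
  open ComplexExp
  open import Data.Integer.Base as ℤ using (+_)
  open import Data.Rational.Base using (_/_)
  open ≡ using (_≡_)
  open import Relation.Nullary.Decidable using (from-yes; from-no)

  ^-distribʳ-* : ∀ j m n → (m ℕ.* n) ℕ.^ j ≡ m ℕ.^ j ℕ.* n ℕ.^ j
  ^-distribʳ-* zero    m n = ≡.refl
  ^-distribʳ-* (suc j) m n = ≡.trans (≡.cong (m ℕ.* n ℕ.*_) (^-distribʳ-* j m n))
    (ℕₚ.[m*n]*[o*p]≡[m*o]*[n*p] m n (m ℕ.^ j) (n ℕ.^ j))

  module NaturalsInField (F : RealField) where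
    open RealField F hiding (_-_)
    open NonnegativeSeries F

    ¬1≤0 : ¬ 1# ≤ 0#
    ¬1≤0 h = from-no (1ℚ ℚₚ.≤? 0ℚ) (ι-reflects-≤ (≤-resp (sym ι-1) (sym ι-0) h))

    nat-reflects-≤ : ∀ {m n} → nat m ≤ nat n → m ℕ.≤ n
    nat-reflects-≤ {m} {n} h = ℕₚ.≮⇒≥ λ n<m → ¬1≤0 (≤-resp
      (trans (+-congʳ (nat-suc n)) (solve 2 (λ a b → a :+ b :+ :- a := b) refl (nat n) 1#)) (-‿inverseʳ (nat n))
      (+-mono-≤ (≤-trans (nat-mono n<m) h) (≤-refl { - nat n})))
      where open Solver

    nat-^ : ∀ m j → nat (m ℕ.^ j) ≈ nat m ^ j
    nat-^ m zero    = nat-1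
    nat-^ m (suc j) = trans (nat-* m (m ℕ.^ j)) (*-congˡ (nat-^ m j))

    expSum-1/8 : ∀ n → expSum (ι (+ 1 / 8)) n ≤ ι (+ 8 / 7)
    expSum-1/8 n = begin
      expSum x n ≲⟨ ≤-by-difference (c * t n) (*-nonneg 0≤c (0≤t n)) refl ⟩
      expSum x n + c * t n ≈⟨ reflexive (≡.cong (λ m → expSum x m + c * t m) (≡.sym (ℕₚ.+-identityʳ n))) ⟩
      expSum x (n ℕ.+ 0) + c * t (n ℕ.+ 0) ≲⟨ geometric-tail c 0 (λ k _ → ratio k) n ⟩
      0# + c * t 0 ≈⟨ trans (+-identityˡ _) (trans (*-congˡ (expTerm-0 x)) (*-identityʳ c)) ⟩
      c ∎
      where
      open ≤-Reasoning
      open Solver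
      x = ι (+ 1 / 8)
      c = ι (+ 8 / 7)
      t = expTerm x
      0≤x = ι-nonneg (from-yes (0ℚ ℚₚ.≤? (+ 1 / 8)))
      0≤c = ι-nonneg (from-yes (0ℚ ℚₚ.≤? (+ 8 / 7)))
      0≤t = expTerm-nonneg 0≤x
      1/suc≤1 : ∀ k → ι (+ 1 / suc k) ≤ 1#
      1/suc≤1 k = ≤-resp (*-identityʳ _) (1/suc k)
        (*-mono-≤ (1/suc-nonneg k) 0≤1 ≤-refl (≤-respˡ nat-1 (nat-mono (ℕ.s≤s (ℕ.z≤n {k})))))
      ratio : ∀ k → t k + c * t (suc k) ≤ c * t k
      ratio k = begin
        t k + c * t (suc k) ≈⟨ +-congˡ (*-congˡ (trans (expTerm-suc x k) (*-assoc _ x (t k)))) ⟩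
        t k + c * (ι (+ 1 / suc k) * (x * t k))
          ≲⟨ +-mono-≤ ≤-refl (*-mono-≤ 0≤c (*-nonneg (1/suc-nonneg k) (*-nonneg 0≤x (0≤t k))) ≤-refl
               (*-mono-≤ 0≤1 (*-nonneg 0≤x (0≤t k)) (1/suc≤1 k) ≤-refl)) ⟩
        t k + c * (1# * (x * t k)) ≈⟨ +-congˡ (*-congˡ (*-identityˡ _)) ⟩
        t k + c * (x * t k)
          ≈⟨ solve 1 (λ t → t :+ con (+ 8 / 7) :* (con (+ 1 / 8) :* t) := con (+ 8 / 7) :* t) refl (t k) ⟩
        c * t k ∎

  module LogarithmBounds {F : RealField} (C : ComplexField F) where
    open ComplexFieldProperties C hiding (nat)
    open R using (_≤_; nat)
    open NaturalsInField F

    module _ {ℓ : R.Carrier} {s : ℕ} (e^ℓ≡s : ι (fromℕℚ s) IsExp real ℓ) where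

      private
        real-difference : ∀ n → expSum (real ℓ) n + - ι (fromℕℚ s) ≈ real (R.expSum ℓ n R.+ R.- nat s)
        real-difference n = sym (trans (real-+ _ _) (+-cong (real-expSum ℓ n)
          (trans (real-neg _) (-‿cong (real-ι _)))))

        below : ∀ ε → 0ℚ ℚ.< ε → Eventually λ n → R.expSum ℓ n ≤ nat s R.+ R.ι ε
        below ε ε>0 = eventually-map (λ n d → R.≤-resp
            (solveR 2 (λ a b → b ⊞ (a ⊞ ⊟ b) ⊜ a) R.refl _ _) R.refl
            (R.+-mono-≤ R.≤-refl (R.≤-trans (x≤∣real∣ _) (R.≤-respˡ (∣∣-cong (real-difference n)) d))))
          (fromIsExp e^ℓ≡s ε ε>0)

        above : ∀ ε → 0ℚ ℚ.< ε → Eventually λ n → nat s ≤ R.expSum ℓ n R.+ R.ι ε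
        above ε ε>0 = eventually-map (λ n d → R.≤-resp
            (solveR 2 (λ a b → a ⊞ ⊟ (a ⊞ ⊟ b) ⊜ b) R.refl _ _) R.refl
            (R.+-mono-≤ R.≤-refl (R.≤-trans (x≤∣real∣ _)
              (R.≤-respˡ (R.trans (R.sym (∣neg∣ _)) (∣∣-cong (trans (-‿cong (real-difference n)) (sym (real-neg _))))) d))))
          (fromIsExp e^ℓ≡s ε ε>0)

        -- For y = -ℓ ≥ 0, expSum ℓ n * expSum y n is close to 1, and expSum y n ≥ 1 + y.
        product-bound : ∀ {y} → y R.≈ R.- ℓ → R.0# ≤ y → 1 ℕ.≤ s → nat s R.* (R.1# R.+ y) ≤ R.1#
        product-bound {y} y≈-ℓ 0≤y 1≤s = R.≤-by-difference _ (R.neg-nonneg (R.archimedean λ ε ε>0 →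
          let δ , δ>0 , δ*≤ε = R.scale (R.1# R.+ (R.1# R.+ y)) ε ε>0
              N , close = eventually-map₂ (λ n → _,_)
                (eventually-map₂ (λ n → _,_) (above δ δ>0) (above 1ℚ (ℚₚ.positive⁻¹ 1ℚ)))
                (expSum-product-error (real ℓ) (real y) δ δ>0)
              n = N ℕ.⊔ 2
              (s≤ , s≤′) , error = close n (ℕₚ.m≤m⊔n N 2)
          in estimate δ δ>0 δ*≤ε n (ℕₚ.m≤n⊔m N 2) s≤ s≤′ error))
          (solveR 2 (λ a b → b ⊜ a ⊞ ⊟ (a ⊞ ⊟ b)) R.refl _ _)
          where
          1+y≤ : ∀ n → 2 ℕ.≤ n → R.1# R.+ y ≤ R.expSum y n
          1+y≤ n 2≤n = R.≤-trans
            (R.≤-reflexive (R.sym (R.+-cong (R.trans (R.+-identityˡ _) (R.expTerm-0 y))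
              (R.trans (R.*-cong R.ι-1 (R.*-identityʳ y)) (R.*-identityˡ y)))))
            (R.partialSum-mono (R.expTerm-nonneg 0≤y) (ℕₚ.≤⇒≤′ 2≤n))
          estimate : ∀ δ → 0ℚ ℚ.< δ → ∀ {ε} → R.ι δ R.* (R.1# R.+ (R.1# R.+ y)) ≤ R.ι ε → ∀ n → 2 ℕ.≤ n →
            nat s ≤ R.expSum ℓ n R.+ R.ι δ → nat s ≤ R.expSum ℓ n R.+ R.ι 1ℚ →
            ∣ expSum (real ℓ) n * expSum (real y) n + - expSum (real ℓ + real y) n ∣ ≤ R.ι δ →
            nat s R.* (R.1# R.+ y) R.+ R.- R.1# ≤ R.ι ε
          estimate δ δ>0 {ε} δ*≤ε n@(suc m) 2≤n s≤ s≤′ error = begin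
            nat s R.* u R.+ R.- R.1#
              ≲⟨ R.+-mono-≤ (R.*-mono-≤ (R.+-nonneg 0≤a (R.ι-nonneg (ℚₚ.<⇒≤ δ>0))) 0≤u s≤ R.≤-refl) R.≤-refl ⟩
            (a R.+ R.ι δ) R.* u R.+ R.- R.1#
              ≈⟨ R.+-congʳ (R.distribʳ u a (R.ι δ)) ⟩
            a R.* u R.+ R.ι δ R.* u R.+ R.- R.1#
              ≲⟨ R.+-mono-≤ (R.+-mono-≤ (R.*-mono-≤ 0≤a 0≤u R.≤-refl (1+y≤ n 2≤n)) R.≤-refl) R.≤-refl ⟩
            a R.* b R.+ R.ι δ R.* u R.+ R.- R.1#
              ≈⟨ solveR 3 (λ x y z → x ⊞ y ⊞ ⊟ z ⊜ (x ⊞ ⊟ z) ⊞ y) R.refl _ _ _ ⟩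
            (a R.* b R.+ R.- R.1#) R.+ R.ι δ R.* u
              ≲⟨ R.+-mono-≤ (R.≤-trans (x≤∣real∣ _) (R.≤-respˡ (∣∣-cong (sym real-error)) error)) R.≤-refl ⟩
            R.ι δ R.+ R.ι δ R.* u
              ≈⟨ R.trans (R.+-congʳ (R.sym (R.*-identityʳ _))) (R.sym (R.distribˡ _ _ _)) ⟩
            R.ι δ R.* (R.1# R.+ u) ≲⟨ δ*≤ε ⟩
            R.ι ε ∎
            where
            open R.≤-Reasoning
            a = R.expSum ℓ n
            b = R.expSum y n
            u = R.1# R.+ y
            0≤u = R.+-nonneg R.0≤1 0≤y
            0≤a : R.0# ≤ a
            0≤a = R.≤-resp (R.-‿inverseʳ R.1#)
              (R.trans (R.+-congˡ (R.-‿cong (R.sym R.ι-1)))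
                (solveR 2 (λ a b → a ⊞ b ⊞ ⊟ b ⊜ a) R.refl _ _))
              (R.+-mono-≤ (R.≤-trans (R.≤-respˡ R.nat-1 (R.nat-mono 1≤s)) s≤′) (R.≤-refl {R.- R.1#}))
            real-error : real (a R.* b R.+ R.- R.1#) ≈
              expSum (real ℓ) n * expSum (real y) n + - expSum (real ℓ + real y) n
            real-error = trans (real-+ _ _) (+-cong
              (trans (real-* a b) (*-cong (real-expSum ℓ n) (real-expSum y n)))
              (trans (real-neg R.1#) (-‿cong (trans real-1 (sym (trans
                (expSum-cong (trans (sym (real-+ ℓ y)) (trans
                  (real-cong (R.trans (R.+-congˡ y≈-ℓ) (R.-‿inverseʳ ℓ))) real-0)) n) (expSum-0 m)))))))

      log-nonneg : 1 ℕ.≤ s → R.0# ≤ ℓ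
      log-nonneg 1≤s = R.≤-stable λ ¬0≤ℓ → R.≤-total R.0# ℓ [ ¬0≤ℓ , (λ ℓ≤0 → ¬0≤ℓ
        (R.≤-respʳ (solveR 1 (λ l → ⊟ ⊟ l ⊜ l) R.refl ℓ) (R.neg-nonneg (-ℓ≤0 (R.neg-nonneg ℓ≤0))))) ]′
        where
        -ℓ≤0 : R.0# ≤ R.- ℓ → R.- ℓ ≤ R.0#
        -ℓ≤0 0≤-ℓ = R.≤-resp (solveR 2 (λ o y → ⊟ o ⊞ (o ⊞ y) ⊜ y) R.refl R.1# _) (R.-‿inverseˡ R.1#)
          (R.+-mono-≤ (R.≤-refl {R.- R.1#}) (R.≤-trans
            (R.≤-respˡ (R.*-identityˡ _) (R.*-mono-≤ (R.nat-nonneg s) (R.+-nonneg R.0≤1 0≤-ℓ)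
              (R.≤-respˡ R.nat-1 (R.nat-mono 1≤s)) R.≤-refl))
            (product-bound R.refl 0≤-ℓ 1≤s)))

      log-lower-bound : ∀ j → 1 ℕ.≤ s → 2 ℕ.^ j ℕ.≤ s ℕ.* s → nat j ≤ nat 8 R.* ℓ
      log-lower-bound zero 1≤s _ = R.≤-respˡ (R.sym R.nat-0)
        (R.*-nonneg (R.nat-nonneg 8) (log-nonneg 1≤s))
      log-lower-bound j@(suc _) 1≤s 2^j≤s² = R.≤-stable λ ¬j≤8ℓ → R.≤-total (nat j) (nat 8 R.* ℓ)
        [ ¬j≤8ℓ , (λ 8ℓ≤j → absurd (bound 8ℓ≤j)) ]′
        where
        x = R.ι (+ 1 / 8)
        0≤x = R.ι-nonneg (from-yes (0ℚ ℚₚ.≤? (+ 1 / 8)))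
        ℓ≤jx : nat 8 R.* ℓ ≤ nat j → ℓ ≤ nat j R.* x
        ℓ≤jx 8ℓ≤j = R.≤-resp (solveR 1 (λ l → conR (+ 1 / 8) ⊠ (conR (+ 8 / 1) ⊠ l) ⊜ l) R.refl ℓ) (R.*-comm x (nat j))
          (R.*-mono-≤ 0≤x (R.*-nonneg (R.nat-nonneg 8) (log-nonneg 1≤s)) R.≤-refl 8ℓ≤j)
        bound : nat 8 R.* ℓ ≤ nat j → 7 ℕ.^ j ℕ.* s ℕ.≤ 8 ℕ.^ j
        bound 8ℓ≤j = nat-reflects-≤ (R.≤-resp
          (R.trans (R.*-congʳ (R.sym (nat-^ 7 j))) (R.sym (R.nat-* (7 ℕ.^ j) s)))
          (R.trans (R.sym (^-distrib-* (nat 7) (R.ι (+ 8 / 7)) j))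
            (R.trans (R.^-congˡ j (R.sym (R.ι-* _ _))) (R.sym (nat-^ 8 j))))
          (R.*-mono-≤ (R.^-nonneg (R.nat-nonneg 7) j) (R.nat-nonneg s) R.≤-refl s≤))
          where
          open import Algebra.Properties.CommutativeSemiring.Exp R.commutativeSemiring using (^-distrib-*)
          s≤ : nat s ≤ R.ι (+ 8 / 7) R.^ j
          s≤ = R.≤-by-difference _ (R.neg-nonneg (R.archimedean λ ε ε>0 →
            let N , s≤E+ε = above ε ε>0
                s≤′ = s≤E+ε (suc N) (ℕₚ.n≤1+n N)
                E≤ = R.≤-trans (R.expSum-mono (log-nonneg 1≤s) (ℓ≤jx 8ℓ≤j) (suc N)) (R.≤-trans
                  (R.expSum-scale 0≤x j N)
                  (R.^-mono (R.expSum-nonneg 0≤x (suc N)) (expSum-1/8 (suc N)) j))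
            in R.≤-respʳ (solveR 2 (λ a b → a ⊞ b ⊞ ⊟ a ⊜ b) R.refl _ _)
                 (R.+-mono-≤ (R.≤-trans s≤′ (R.+-mono-≤ E≤ R.≤-refl)) R.≤-refl)))
            (solveR 2 (λ a b → b ⊜ a ⊞ ⊟ (a ⊞ ⊟ b)) R.refl _ _)
        absurd : 7 ℕ.^ j ℕ.* s ℕ.≤ 8 ℕ.^ j → ⊥
        absurd h = ℕₚ.<⇒≱ (ℕₚ.^-monoˡ-< j (from-yes (64 ℕₚ.<? 98))) (begin
          98 ℕ.^ j ≡⟨ ^-distribʳ-* j 49 2 ⟩
          49 ℕ.^ j ℕ.* 2 ℕ.^ j ≤⟨ ℕₚ.*-monoʳ-≤ (49 ℕ.^ j) 2^j≤s² ⟩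
          49 ℕ.^ j ℕ.* (s ℕ.* s) ≡⟨ ≡.cong (ℕ._* (s ℕ.* s)) (^-distribʳ-* j 7 7) ⟩
          7 ℕ.^ j ℕ.* 7 ℕ.^ j ℕ.* (s ℕ.* s) ≡⟨ ℕₚ.[m*n]*[o*p]≡[m*o]*[n*p] (7 ℕ.^ j) (7 ℕ.^ j) s s ⟩
          7 ℕ.^ j ℕ.* s ℕ.* (7 ℕ.^ j ℕ.* s) ≤⟨ ℕₚ.*-mono-≤ h h ⟩
          8 ℕ.^ j ℕ.* 8 ℕ.^ j ≡⟨ ^-distribʳ-* j 8 8 ⟨
          64 ℕ.^ j ∎)
          where open ℕₚ.≤-Reasoning

module Roots where

  open import Defs
  open Reals
  open Ordered
  open Complex
  open Series using (fromℕℚ)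
  open ComplexExp
  open import Data.Integer.Base as ℤ using (+_)
  open import Data.Fin.Base using (Fin; zero; suc; toℕ)
  open import Data.Nat.Base using (_!)
  open import Data.Rational.Base using (_/_; _+_; _*_; -_; _-_; _<_; _≤_)
  open import Data.Rational.Properties
  open import Data.Rational.Unnormalised.Base as ℚᵘ using (mkℚᵘ)
  import Data.Rational.Unnormalised.Properties as ℚᵘₚ
  open ≡ using (_≡_; cong; subst; subst₂)
  open ℚSolver.+-*-Solver using (solve; _:+_; _:*_; :-_; _:=_; con)

  private
    module ℂₚ = ComplexFieldProperties ℂ-field

  p*2/p : ∀ p .{{_ : NonZero p}} → fromℕℚ p * (+ 2 / p) ≡ 1ℚ + 1ℚ
  p*2/p (suc k) = toℚᵘ-injective (begin
    ℚ.toℚᵘ (fromℕℚ (suc k) * (+ 2 / suc k)) ≈⟨ toℚᵘ-homo-* (fromℕℚ (suc k)) (+ 2 / suc k) ⟩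
    ℚ.toℚᵘ (fromℕℚ (suc k)) ℚᵘ.* ℚ.toℚᵘ (+ 2 / suc k)
      ≈⟨ ℚᵘₚ.*-cong (toℚᵘ-/ (+ suc k) 0) (toℚᵘ-/ (+ 2) k) ⟩
    mkℚᵘ (+ suc k) 0 ℚᵘ.* mkℚᵘ (+ 2) k
      ≈⟨ ℚᵘ.*≡* (≡.trans (ℤₚ.*-identityʳ (+ suc k ℤ.* + 2)) (≡.trans (ℤₚ.*-comm (+ suc k) (+ 2))
           (cong (λ d → + 2 ℤ.* + d) (≡.sym (ℕₚ.*-identityˡ (suc k)))))) ⟩
    ℚ.toℚᵘ (1ℚ + 1ℚ) ∎)
    where open ℚᵘₚ.≃-Reasoning

  2/p-positive : ∀ p .{{_ : NonZero p}} → 0ℚ < + 2 / p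
  2/p-positive p = positive⁻¹ _ {{normalize-pos 2 p}}

  2/p<1 : ∀ p .{{_ : NonZero p}} → 2 ℕ.< p → + 2 / p < 1ℚ
  2/p<1 (suc k) 2<p = toℚᵘ-cancel-< (ℚᵘₚ.<-respˡ-≃ (ℚᵘₚ.≃-sym (toℚᵘ-/ (+ 2) k))
    (ℚᵘ.*<* (subst₂ ℤ._<_ (ℤₚ.pos-* 2 1) (ℤₚ.pos-* 1 (suc k))
      (ℤ.+<+ (subst (2 ℕ.<_) (≡.sym (ℕₚ.*-identityˡ (suc k))) 2<p)))))

  -- The conversions are proved componentwise: comparing the Cauchy moduli of two
  -- definitionally equal sums is prohibitively slow.
  expPartial-term : ℂ → ℕ → ℂ
  expPartial-term z k = fromℝ (fromℚ ((+ 1 / (k !)) {{k ℕₚ.!≢0}})) *ℂ z ^ℂ k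

  sumℂ-cong : ∀ n {f g : Fin n → ℂ} → (∀ i → f i ≃ℂ g i) → sumℂ {n} f ≃ℂ ℂₚ.sum {n} g
  sumℂ-cong zero            e = ℂₚ.refl {0ℂ}
  sumℂ-cong (suc n) {f} {g} e = +ℂ-cong {f zero} {g zero}
    {sumℂ {n} (λ i → f (suc i))} {ℂₚ.sum {n} (λ i → g (suc i))} (e zero) (sumℂ-cong n (λ i → e (suc i)))

  expPartial≃ : ∀ z n → expPartial z n ≃ℂ ℂₚ.sum {n} λ i → expPartial-term z (toℕ i)
  expPartial≃ z n = sumℂ-cong n {λ i → expPartial-term z (toℕ i)} {λ i → expPartial-term z (toℕ i)}
    λ i → ℂₚ.refl {expPartial-term z (toℕ i)}

  expPartial-term≃ : ∀ z k → expPartial-term z k ≃ℂ ℂₚ.expTerm z k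
  expPartial-term≃ z k = pointwise-≃ℂ {expPartial-term z k} {ℂₚ.expTerm z k} (λ _ → ≡.refl) (λ _ → ≡.refl)

  IsExpOf⇒IsExp : ∀ {w z} → w IsExpOf z → w ℂₚ.IsExp z
  IsExpOf⇒IsExp {w} {z} = ℂₚ.⟶-cong {expPartial z} {λ n → ℂₚ.sum {n} λ i → ℂₚ.expTerm z (toℕ i)} {w} {w}
    (λ n → sumℂ-cong n {λ i → expPartial-term z (toℕ i)} {λ i → ℂₚ.expTerm z (toℕ i)}
      λ i → expPartial-term≃ z (toℕ i))
    (ℂₚ.refl {w})

  imaginary : ∀ t → (0ℝ +i t) +ℂ conj (0ℝ +i t) ≃ℂ 0ℂ
  imaginary t = pointwise-≃ℂ {(0ℝ +i t) +ℂ conj (0ℝ +i t)} {0ℂ} (λ _ → ≡.refl) (λ n → +-inverseʳ (seq t n))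

  imaginary-exp-unit : ∀ {w t} → w IsExpOf (0ℝ +i t) → w *ℂ conj w ≃ℂ 1ℂ
  imaginary-exp-unit {w} {t} h = ℂₚ.IsExp-imaginary {w} {0ℝ +i t} (imaginary t) (IsExpOf⇒IsExp {w} {0ℝ +i t} h)

  real≃conj : ∀ {w} → im w ≃ℝ 0ℝ → w ≃ℂ conj w
  real≃conj {w} im≃0 = pointwise-≃ℝ {re w} {re w} (λ _ → ≡.refl) ,
    ≃ℝ-trans {im w} {0ℝ} { -ℝ im w} im≃0
      (≃ℝ-trans {0ℝ} { -ℝ 0ℝ} { -ℝ im w} (pointwise-≃ℝ {0ℝ} { -ℝ 0ℝ} λ _ → ≡.refl)
        (-ℝ-cong {0ℝ} {im w} (≃ℝ-sym {im w} {0ℝ} im≃0)))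

  imaginary-exp-root : ∀ p {t u} → (∀ n → fromℕℚ p * seq t n ≡ seq u n + seq u n) →
    ∀ {ω w} → ω IsExpOf (0ℝ +i t) → w IsExpOf (0ℝ +i u) → im w ≃ℝ 0ℝ → ω ^ℂ p ≃ℂ 1ℂ
  imaginary-exp-root p {t} {u} pt≡2u {ω} {w} ω-exp w-exp im≃0 =
    ℂₚ.IsExp-root {ω} {0ℝ +i t} {w} {0ℝ +i u} p
      (IsExpOf⇒IsExp {ω} {0ℝ +i t} ω-exp) (IsExpOf⇒IsExp {w} {0ℝ +i u} w-exp)
      (pointwise-≃ℂ {ℂₚ.nat p *ℂ (0ℝ +i t)} {(0ℝ +i u) +ℂ (0ℝ +i u)}
        (λ n → solve 2 (λ a b → a :* con 0ℚ :+ :- (con 0ℚ :* b) := con 0ℚ :+ con 0ℚ) ≡.refl (fromℕℚ p) (seq t n))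
        (λ n → ≡.trans (solve 2 (λ a b → a :* b :+ con 0ℚ :* con 0ℚ := a :* b) ≡.refl (fromℕℚ p) (seq t n)) (pt≡2u n)))
      (imaginary u) (real≃conj {w} im≃0)

  module _ (p : ℕ) .{{_ : NonZero p}} {π : ℝ} (isPi : IsPi π) where

    private
      t = fromℚ (+ 2 / p) *ℝ π

    ω*conj : ∀ {ω z} → z ≡ 0ℝ +i t → ω IsExpOf z → ω *ℂ conj ω ≃ℂ 1ℂ
    ω*conj {ω} ≡.refl ω-exp = imaginary-exp-unit {ω} {t} ω-exp

    ω^p : ∀ {ω z} → z ≡ 0ℝ +i t → ω IsExpOf z → ω ^ℂ p ≃ℂ 1ℂ
    ω^p {ω} ≡.refl ω-exp = imaginary-exp-root p {t} {π}
      (λ n → ≡.trans (≡.sym (*-assoc (fromℕℚ p) (+ 2 / p) (seq π n)))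
        (≡.trans (cong (_* seq π n) (p*2/p p))
          (solve 1 (λ c → (con 1ℚ :+ con 1ℚ) :* c := c :+ c) ≡.refl (seq π n))))
      {ω} {proj₁ (proj₁ (proj₂ isPi))} ω-exp
      (proj₁ (proj₂ (proj₁ (proj₂ isPi)))) (proj₂ (proj₂ (proj₁ (proj₂ isPi))))

    ω≄1 : ∀ {ω z} → z ≡ 0ℝ +i t → ω IsExpOf z → 2 ℕ.< p → ¬ ω ≃ℂ 1ℂ
    ω≄1 {ω} ≡.refl ω-exp 2<p (_ , im≃0) = Positive⇒¬≤0 {π -ℝ t} t<π
      (≤ℝ-trans {π -ℝ t} {t -ℝ t} {0ℝ}
        (+ℝ-mono-≤ℝ {π} {t} { -ℝ t} { -ℝ t} (proj₂ (proj₂ isPi) t 0<t (ω , ω-exp , im≃0))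
          (≃ℝ⇒≤ℝ { -ℝ t} { -ℝ t} (pointwise-≃ℝ { -ℝ t} { -ℝ t} λ _ → ≡.refl)))
        (pointwise-≤ℝ {t -ℝ t} {0ℝ} λ n → ≤-reflexive (+-inverseʳ (seq t n))))
      where
      scaled : ∀ c → 0ℚ < c → Positive (fromℚ c *ℝ π)
      scaled c c>0 =
        let ε , ε>0 , e = proj₁ isPi
        in Positive-product {fromℚ c} {π} (c , c>0 , always λ _ → ≤-refl)
             (ε , ε>0 , eventually-map (λ n → subst (_≤ seq π n) (+-identityˡ ε)) e)
      0<t : 0ℝ <ℝ t
      0<t =
        let ε , ε>0 , e = scaled (+ 2 / p) (2/p-positive p)
        in ε , ε>0 , eventually-map (λ n → subst (_≤ seq t n) (≡.sym (+-identityˡ ε))) e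
      t<π : Positive (π -ℝ t)
      t<π =
        let ε , ε>0 , e = scaled (1ℚ - + 2 / p) (subst (_< 1ℚ - + 2 / p) (+-inverseʳ (+ 2 / p)) (+-monoˡ-< (- (+ 2 / p)) (2/p<1 p 2<p)))
        in ε , ε>0 , eventually-map (λ n → subst (ε ≤_)
             (solve 2 (λ c x → (con 1ℚ :+ :- c) :* x := x :+ :- (c :* x)) ≡.refl (+ 2 / p) (seq π n))) e

module Modular where

  open import Defs using (ℤ^; ⟨_,_⟩)
  open import Algebra.Bundles using (CommutativeRing; AbelianGroup)
  import Algebra.Properties.AbelianGroup
  import Algebra.Properties.CommutativeSemigroup
  import Algebra.Properties.Ring
  import Algebra.Solver.Ring.NaturalCoefficients.Default as NaturalSolver
  open import Data.Fin.Base using (Fin; toℕ)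
  open import Data.Fin.Properties using (toℕ-injective; toℕ-fromℕ<; toℕ<n; _≟_)
  open import Data.Nat.Coprimality using (prime⇒coprime; coprime-Bézout)
  open import Data.Nat.DivMod
  open import Data.Nat.GCD using (module Bézout)
  open import Data.Vec.Base as Vec using ([]; _∷_; zipWith; map; replicate)
  open import Data.Vec.Properties using (zipWith-assoc; zipWith-comm; zipWith-identityˡ; zipWith-identityʳ; zipWith-inverseˡ; zipWith-inverseʳ; ≡-dec)
  open import Relation.Binary.PropositionalEquality hiding ([_])
  open import Relation.Binary.Definitions using (DecidableEquality)

  module Arithmetic (p : ℕ) .{{_ : NonZero p}} where

    -- The bracket is a ring homomorphism from ℕ, so the laws of ℤ/p are inherited from ℕ.
    [_] : ℕ → Fin p
    [ m ] = m mod p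

    toℕ-[] : ∀ m → toℕ [ m ] ≡ m % p
    toℕ-[] m = toℕ-fromℕ< (m%n<n m p)

    []-cong : ∀ {m n} → m % p ≡ n % p → [ m ] ≡ [ n ]
    []-cong {m} {n} e = toℕ-injective (trans (toℕ-[] m) (trans e (sym (toℕ-[] n))))

    []-toℕ : ∀ a → [ toℕ a ] ≡ a
    []-toℕ a = toℕ-injective (trans (toℕ-[] (toℕ a)) (m<n⇒m%n≡m (toℕ<n a)))

    infixl 6 _⊕_
    infixl 7 _⊗_
    _⊕_ _⊗_ : Fin p → Fin p → Fin p
    a ⊕ b = [ toℕ a ℕ.+ toℕ b ]
    a ⊗ b = [ toℕ a ℕ.* toℕ b ]

    negate : Fin p → Fin p
    negate a = [ p ℕ.∸ toℕ a ]

    []-+ : ∀ m n → [ m ℕ.+ n ] ≡ [ m ] ⊕ [ n ]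
    []-+ m n = []-cong (trans (%-distribˡ-+ m n p)
      (cong₂ (λ a b → (a ℕ.+ b) % p) (sym (toℕ-[] m)) (sym (toℕ-[] n))))

    []-* : ∀ m n → [ m ℕ.* n ] ≡ [ m ] ⊗ [ n ]
    []-* m n = []-cong (trans (%-distribˡ-* m n p)
      (cong₂ (λ a b → (a ℕ.* b) % p) (sym (toℕ-[] m)) (sym (toℕ-[] n))))

    []-p : [ p ] ≡ [ 0 ]
    []-p = []-cong (trans (n%n≡0 p) (sym (m<n⇒m%n≡m (ℕ.>-nonZero⁻¹ p))))

    private
      lift₃ : (f g : Fin p → Fin p → Fin p → Fin p) →
        (∀ l m n → f [ l ] [ m ] [ n ] ≡ g [ l ] [ m ] [ n ]) → ∀ a b c → f a b c ≡ g a b c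
      lift₃ f g h a b c = subst₂ (λ a b → f a b c ≡ g a b c) ([]-toℕ a) ([]-toℕ b)
        (subst (λ c → f [ toℕ a ] [ toℕ b ] c ≡ g [ toℕ a ] [ toℕ b ] c) ([]-toℕ c) (h (toℕ a) (toℕ b) (toℕ c)))

      ⊕-comm : ∀ a b → a ⊕ b ≡ b ⊕ a
      ⊕-comm a b = cong [_] (ℕₚ.+-comm (toℕ a) (toℕ b))

      ⊗-comm : ∀ a b → a ⊗ b ≡ b ⊗ a
      ⊗-comm a b = cong [_] (ℕₚ.*-comm (toℕ a) (toℕ b))

      ⊕-assoc : ∀ a b c → a ⊕ b ⊕ c ≡ a ⊕ (b ⊕ c)
      ⊕-assoc = lift₃ (λ a b c → a ⊕ b ⊕ c) (λ a b c → a ⊕ (b ⊕ c)) λ l m n →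
        trans (cong (_⊕ [ n ]) (sym ([]-+ l m))) (trans (sym ([]-+ (l ℕ.+ m) n))
          (trans (cong [_] (ℕₚ.+-assoc l m n)) (trans ([]-+ l (m ℕ.+ n)) (cong ([ l ] ⊕_) ([]-+ m n)))))

      ⊗-assoc : ∀ a b c → a ⊗ b ⊗ c ≡ a ⊗ (b ⊗ c)
      ⊗-assoc = lift₃ (λ a b c → a ⊗ b ⊗ c) (λ a b c → a ⊗ (b ⊗ c)) λ l m n →
        trans (cong (_⊗ [ n ]) (sym ([]-* l m))) (trans (sym ([]-* (l ℕ.* m) n))
          (trans (cong [_] (ℕₚ.*-assoc l m n)) (trans ([]-* l (m ℕ.* n)) (cong ([ l ] ⊗_) ([]-* m n)))))

      ⊗-distribˡ : ∀ a b c → a ⊗ (b ⊕ c) ≡ a ⊗ b ⊕ a ⊗ c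
      ⊗-distribˡ = lift₃ (λ a b c → a ⊗ (b ⊕ c)) (λ a b c → a ⊗ b ⊕ a ⊗ c) λ l m n →
        trans (cong ([ l ] ⊗_) (sym ([]-+ m n))) (trans (sym ([]-* l (m ℕ.+ n)))
          (trans (cong [_] (ℕₚ.*-distribˡ-+ l m n)) (trans ([]-+ (l ℕ.* m) (l ℕ.* n)) (cong₂ _⊕_ ([]-* l m) ([]-* l n)))))

      ⊕-identityˡ : ∀ a → [ 0 ] ⊕ a ≡ a
      ⊕-identityˡ a = trans (cong ([ 0 ] ⊕_) (sym ([]-toℕ a))) (trans (sym ([]-+ 0 (toℕ a))) ([]-toℕ a))

      ⊗-identityˡ : ∀ a → [ 1 ] ⊗ a ≡ a
      ⊗-identityˡ a = trans (cong ([ 1 ] ⊗_) (sym ([]-toℕ a))) (trans (sym ([]-* 1 (toℕ a)))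
        (trans (cong [_] (ℕₚ.*-identityˡ (toℕ a))) ([]-toℕ a)))

      ⊕-inverseʳ : ∀ a → a ⊕ negate a ≡ [ 0 ]
      ⊕-inverseʳ a = trans (cong (_⊕ negate a) (sym ([]-toℕ a))) (trans (sym ([]-+ (toℕ a) (p ℕ.∸ toℕ a)))
        (trans (cong [_] (ℕₚ.m+[n∸m]≡n (ℕₚ.<⇒≤ (toℕ<n a)))) []-p))

    commutativeRing : CommutativeRing 0ℓ 0ℓ
    commutativeRing = record
      { Carrier = Fin p ; _≈_ = _≡_ ; _+_ = _⊕_ ; _*_ = _⊗_ ; -_ = negate ; 0# = [ 0 ] ; 1# = [ 1 ]
      ; isCommutativeRing = record
        { isRing = record
          { +-isAbelianGroup = record
            { isGroup = record
              { isMonoid = record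
                { isSemigroup = record
                  { isMagma = record { isEquivalence = isEquivalence ; ∙-cong = cong₂ _⊕_ } ; assoc = ⊕-assoc }
                ; identity = ⊕-identityˡ , λ a → trans (⊕-comm a [ 0 ]) (⊕-identityˡ a) }
              ; inverse = (λ a → trans (⊕-comm (negate a) a) (⊕-inverseʳ a)) , ⊕-inverseʳ
              ; ⁻¹-cong = cong negate }
            ; comm = ⊕-comm }
          ; *-cong = cong₂ _⊗_
          ; *-assoc = ⊗-assoc
          ; *-identity = ⊗-identityˡ , λ a → trans (⊗-comm a [ 1 ]) (⊗-identityˡ a)
          ; distrib = ⊗-distribˡ , λ a b c → trans (⊗-comm (b ⊕ c) a)
              (trans (⊗-distribˡ a b c) (cong₂ _⊕_ (⊗-comm a b) (⊗-comm a c))) }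
        ; *-comm = ⊗-comm } }

    module Zₚ = CommutativeRing commutativeRing
    private
      module Zₚₚ = Algebra.Properties.Ring Zₚ.ring
      open NaturalSolver Zₚ.commutativeSemiring using (solve; _:+_; _:*_; _:=_)

    inverse : Prime p → ∀ {a} → a ≢ [ 0 ] → ∃[ b ] a ⊗ b ≡ [ 1 ]
    inverse p-prime {a} a≢0 with coprime-Bézout (prime⇒coprime p-prime {{ℕ.≢-nonZero ta≢0}} (toℕ<n a))
      where
      ta≢0 : toℕ a ≢ 0
      ta≢0 e = a≢0 (trans (sym ([]-toℕ a)) (cong [_] e))
    ... | Bézout.-+ x y eq = [ y ] , (begin
        a ⊗ [ y ] ≡⟨ cong (_⊗ [ y ]) ([]-toℕ a) ⟨
        [ toℕ a ] ⊗ [ y ] ≡⟨ []-* (toℕ a) y ⟨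
        [ toℕ a ℕ.* y ] ≡⟨ cong [_] (trans (ℕₚ.*-comm (toℕ a) y) (sym eq)) ⟩
        [ 1 ℕ.+ x ℕ.* p ] ≡⟨ []-cong ([m+kn]%n≡m%n 1 x p) ⟩
        [ 1 ] ∎)
        where open ≡-Reasoning
    ... | Bézout.+- x y eq = negate [ y ] , (begin
        a ⊗ negate [ y ] ≡⟨ Zₚₚ.-‿distribʳ-* a [ y ] ⟨
        negate (a ⊗ [ y ]) ≡⟨ cong (λ a → negate (a ⊗ [ y ])) ([]-toℕ a) ⟨
        negate ([ toℕ a ] ⊗ [ y ]) ≡⟨ cong negate (trans (sym ([]-* (toℕ a) y)) (cong [_] (ℕₚ.*-comm (toℕ a) y))) ⟩
        negate [ y ℕ.* toℕ a ] ≡⟨ Zₚₚ.+-inverseˡ-unique [ 1 ] [ y ℕ.* toℕ a ] (begin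
          [ 1 ] ⊕ [ y ℕ.* toℕ a ] ≡⟨ []-+ 1 (y ℕ.* toℕ a) ⟨
          [ 1 ℕ.+ y ℕ.* toℕ a ] ≡⟨ cong [_] eq ⟩
          [ x ℕ.* p ] ≡⟨ []-cong ([m+kn]%n≡m%n 0 x p) ⟩
          [ 0 ] ∎) ⟨
        [ 1 ] ∎)
        where open ≡-Reasoning

    module Vectors where

      infix  8 ⊝_
      infixl 6 _+ᵥ_ _-ᵥ_
      infixl 7 _•_
      _+ᵥ_ : ∀ {n} → ℤ^ p n → ℤ^ p n → ℤ^ p n
      _+ᵥ_ = zipWith _⊕_

      ⊝_ : ∀ {n} → ℤ^ p n → ℤ^ p n
      ⊝_ = map negate

      _-ᵥ_ : ∀ {n} → ℤ^ p n → ℤ^ p n → ℤ^ p n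
      α -ᵥ β = α +ᵥ ⊝ β

      0ᵥ : ∀ {n} → ℤ^ p n
      0ᵥ = replicate _ [ 0 ]

      _•_ : ∀ {n} → Fin p → ℤ^ p n → ℤ^ p n
      k • α = map (k ⊗_) α

      infix 4 _≟ᵥ_
      _≟ᵥ_ : ∀ {n} → DecidableEquality (ℤ^ p n)
      _≟ᵥ_ = ≡-dec _≟_

      abelianGroup : ℕ → AbelianGroup 0ℓ 0ℓ
      abelianGroup n = record
        { Carrier = ℤ^ p n ; _≈_ = _≡_ ; _∙_ = _+ᵥ_ ; ε = 0ᵥ ; _⁻¹ = ⊝_
        ; isAbelianGroup = record
          { isGroup = record
            { isMonoid = record
              { isSemigroup = record
                { isMagma = record { isEquivalence = isEquivalence ; ∙-cong = cong₂ _+ᵥ_ }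
                ; assoc = zipWith-assoc Zₚ.+-assoc }
              ; identity = zipWith-identityˡ Zₚ.+-identityˡ , zipWith-identityʳ Zₚ.+-identityʳ }
            ; inverse = zipWith-inverseˡ Zₚ.-‿inverseˡ , zipWith-inverseʳ Zₚ.-‿inverseʳ
            ; ⁻¹-cong = cong ⊝_ }
          ; comm = zipWith-comm Zₚ.+-comm } }

      module V {n : ℕ} where
        open AbelianGroup (abelianGroup n) public
        open Algebra.Properties.AbelianGroup (abelianGroup n) public

      -ᵥ-cancel : ∀ {n} (α β : ℤ^ p n) → α +ᵥ β -ᵥ β ≡ α
      -ᵥ-cancel α β = trans (V.assoc α β (⊝ β)) (trans (cong (α +ᵥ_) (V.inverseʳ β)) (V.identityʳ α))

      +ᵥ-cancel : ∀ {n} (α β : ℤ^ p n) → α -ᵥ β +ᵥ β ≡ α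
      +ᵥ-cancel α β = trans (V.assoc α (⊝ β) β) (trans (cong (α +ᵥ_) (V.inverseˡ β)) (V.identityʳ α))

      -ᵥ≡0⇒≡ : ∀ {n} {α β : ℤ^ p n} → α -ᵥ β ≡ 0ᵥ → α ≡ β
      -ᵥ≡0⇒≡ {α = α} {β} e = trans (sym (+ᵥ-cancel α β)) (trans (cong (_+ᵥ β) e) (V.identityˡ β))

      ⟨⟩-∷ : ∀ {n} a b (α x : ℤ^ p n) → ⟨ a ∷ α , b ∷ x ⟩ ≡ a ⊗ b ⊕ ⟨ α , x ⟩
      ⟨⟩-∷ a b α x = []-+ (toℕ a ℕ.* toℕ b) _

      ⟨⟩-comm : ∀ {n} (α x : ℤ^ p n) → ⟨ α , x ⟩ ≡ ⟨ x , α ⟩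
      ⟨⟩-comm []      []      = refl
      ⟨⟩-comm (a ∷ α) (b ∷ x) = trans (⟨⟩-∷ a b α x)
        (trans (cong₂ _⊕_ (Zₚ.*-comm a b) (⟨⟩-comm α x)) (sym (⟨⟩-∷ b a x α)))

      ⟨⟩-+ˡ : ∀ {n} (α β x : ℤ^ p n) → ⟨ α +ᵥ β , x ⟩ ≡ ⟨ α , x ⟩ ⊕ ⟨ β , x ⟩
      ⟨⟩-+ˡ []      []      []      = sym (Zₚ.+-identityˡ [ 0 ])
      ⟨⟩-+ˡ (a ∷ α) (b ∷ β) (c ∷ x) = begin
        ⟨ a ⊕ b ∷ α +ᵥ β , c ∷ x ⟩ ≡⟨ ⟨⟩-∷ (a ⊕ b) c (α +ᵥ β) x ⟩
        (a ⊕ b) ⊗ c ⊕ ⟨ α +ᵥ β , x ⟩ ≡⟨ cong ((a ⊕ b) ⊗ c ⊕_) (⟨⟩-+ˡ α β x) ⟩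
        (a ⊕ b) ⊗ c ⊕ (⟨ α , x ⟩ ⊕ ⟨ β , x ⟩)
          ≡⟨ solve 5 (λ a b c d e → (a :+ b) :* c :+ (d :+ e) := a :* c :+ d :+ (b :* c :+ e)) refl a b c ⟨ α , x ⟩ ⟨ β , x ⟩ ⟩
        a ⊗ c ⊕ ⟨ α , x ⟩ ⊕ (b ⊗ c ⊕ ⟨ β , x ⟩) ≡⟨ cong₂ _⊕_ (⟨⟩-∷ a c α x) (⟨⟩-∷ b c β x) ⟨
        ⟨ a ∷ α , c ∷ x ⟩ ⊕ ⟨ b ∷ β , c ∷ x ⟩ ∎
        where open ≡-Reasoning

      ⟨⟩-•ˡ : ∀ {n} k (α x : ℤ^ p n) → ⟨ k • α , x ⟩ ≡ k ⊗ ⟨ α , x ⟩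
      ⟨⟩-•ˡ k []      []      = sym (Zₚ.zeroʳ k)
      ⟨⟩-•ˡ k (a ∷ α) (b ∷ x) = begin
        ⟨ k ⊗ a ∷ k • α , b ∷ x ⟩ ≡⟨ ⟨⟩-∷ (k ⊗ a) b (k • α) x ⟩
        k ⊗ a ⊗ b ⊕ ⟨ k • α , x ⟩ ≡⟨ cong (k ⊗ a ⊗ b ⊕_) (⟨⟩-•ˡ k α x) ⟩
        k ⊗ a ⊗ b ⊕ k ⊗ ⟨ α , x ⟩ ≡⟨ solve 4 (λ k a b d → k :* a :* b :+ k :* d := k :* (a :* b :+ d)) refl k a b ⟨ α , x ⟩ ⟩
        k ⊗ (a ⊗ b ⊕ ⟨ α , x ⟩) ≡⟨ cong (k ⊗_) (⟨⟩-∷ a b α x) ⟨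
        k ⊗ ⟨ a ∷ α , b ∷ x ⟩ ∎
        where open ≡-Reasoning

      ⟨⟩-0ˡ : ∀ {n} (x : ℤ^ p n) → ⟨ 0ᵥ , x ⟩ ≡ [ 0 ]
      ⟨⟩-0ˡ x = Zₚₚ.+-identityʳ-unique ⟨ 0ᵥ , x ⟩ ⟨ 0ᵥ , x ⟩
        (trans (sym (⟨⟩-+ˡ 0ᵥ 0ᵥ x)) (cong ⟨_, x ⟩ (V.identityˡ 0ᵥ)))

      ⟨⟩-negˡ : ∀ {n} (α x : ℤ^ p n) → ⟨ ⊝ α , x ⟩ ≡ negate ⟨ α , x ⟩
      ⟨⟩-negˡ α x = Zₚₚ.+-inverseˡ-unique ⟨ ⊝ α , x ⟩ ⟨ α , x ⟩
        (trans (sym (⟨⟩-+ˡ (⊝ α) α x)) (trans (cong ⟨_, x ⟩ (V.inverseˡ α)) (⟨⟩-0ˡ x)))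

      ⟨⟩-+ʳ : ∀ {n} (α x y : ℤ^ p n) → ⟨ α , x +ᵥ y ⟩ ≡ ⟨ α , x ⟩ ⊕ ⟨ α , y ⟩
      ⟨⟩-+ʳ α x y = trans (⟨⟩-comm α (x +ᵥ y)) (trans (⟨⟩-+ˡ x y α) (cong₂ _⊕_ (⟨⟩-comm x α) (⟨⟩-comm y α)))

      ⟨⟩-•ʳ : ∀ {n} k (α x : ℤ^ p n) → ⟨ α , k • x ⟩ ≡ k ⊗ ⟨ α , x ⟩
      ⟨⟩-•ʳ k α x = trans (⟨⟩-comm α (k • x)) (trans (⟨⟩-•ˡ k x α) (cong (k ⊗_) (⟨⟩-comm x α)))

      •-0ˡ : ∀ {n} (α : ℤ^ p n) → [ 0 ] • α ≡ 0ᵥ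
      •-0ˡ []      = refl
      •-0ˡ (a ∷ α) = cong₂ _∷_ (Zₚ.zeroˡ a) (•-0ˡ α)

      •-1ˡ : ∀ {n} (α : ℤ^ p n) → [ 1 ] • α ≡ α
      •-1ˡ []      = refl
      •-1ˡ (a ∷ α) = cong₂ _∷_ (Zₚ.*-identityˡ a) (•-1ˡ α)

      •-+ˡ : ∀ {n} k l (α : ℤ^ p n) → (k ⊕ l) • α ≡ k • α +ᵥ l • α
      •-+ˡ k l []      = refl
      •-+ˡ k l (a ∷ α) = cong₂ _∷_ (Zₚ.distribʳ a k l) (•-+ˡ k l α)

      dual-vector : Prime p → ∀ {n} {γ : ℤ^ p n} → γ ≢ 0ᵥ → ∃[ u ] ⟨ γ , u ⟩ ≡ [ 1 ]
      dual-vector p-prime {γ = []} γ≢0 = ⊥-elim (γ≢0 refl)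
      dual-vector p-prime {γ = a ∷ γ} γ≢0 with a ≟ [ 0 ]
      ... | no a≢0 =
        let b , ab≡1 = inverse p-prime a≢0
        in b ∷ 0ᵥ , trans (⟨⟩-∷ a b γ 0ᵥ)
             (trans (cong₂ _⊕_ ab≡1 (trans (⟨⟩-comm γ 0ᵥ) (⟨⟩-0ˡ γ))) (Zₚ.+-identityʳ [ 1 ]))
      ... | yes refl =
        let u , γu≡1 = dual-vector p-prime {γ = γ} λ γ≡0 → γ≢0 (cong ([ 0 ] ∷_) γ≡0)
        in [ 0 ] ∷ u , trans (⟨⟩-∷ [ 0 ] [ 0 ] γ u)
             (trans (cong₂ _⊕_ (Zₚ.zeroˡ [ 0 ]) γu≡1) (Zₚ.+-identityˡ [ 1 ]))

      module Projection {n} (γ u : ℤ^ p n) (γu≡1 : ⟨ γ , u ⟩ ≡ [ 1 ]) where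

        -- The projection along u onto the affine hyperplane ⟨γ,x⟩ = c, and the adjoint of its linear part.
        project : Fin p → ℤ^ p n → ℤ^ p n
        project c x = x +ᵥ (c ⊕ negate ⟨ γ , x ⟩) • u

        adjoint : ℤ^ p n → ℤ^ p n
        adjoint α = α -ᵥ ⟨ α , u ⟩ • γ

        project-fixes : ∀ {c x} → ⟨ γ , x ⟩ ≡ c → project c x ≡ x
        project-fixes {c} {x} refl = trans (cong (λ k → x +ᵥ k • u) (Zₚ.-‿inverseʳ ⟨ γ , x ⟩))
          (trans (cong (x +ᵥ_) (•-0ˡ u)) (V.identityʳ x))

        ⟨⟩-project : ∀ c α x → ⟨ α , project c x ⟩ ≡ ⟨ adjoint α , x ⟩ ⊕ c ⊗ ⟨ α , u ⟩
        ⟨⟩-project c α x = begin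
          ⟨ α , x +ᵥ (c ⊕ negate ⟨ γ , x ⟩) • u ⟩ ≡⟨ ⟨⟩-+ʳ α x ((c ⊕ negate ⟨ γ , x ⟩) • u) ⟩
          ⟨ α , x ⟩ ⊕ ⟨ α , (c ⊕ negate ⟨ γ , x ⟩) • u ⟩ ≡⟨ cong (⟨ α , x ⟩ ⊕_) (⟨⟩-•ʳ (c ⊕ negate ⟨ γ , x ⟩) α u) ⟩
          ⟨ α , x ⟩ ⊕ (c ⊕ negate ⟨ γ , x ⟩) ⊗ ⟨ α , u ⟩
            ≡⟨ solve 4 (λ d c m k → d :+ (c :+ m) :* k := d :+ m :* k :+ c :* k) refl ⟨ α , x ⟩ c (negate ⟨ γ , x ⟩) ⟨ α , u ⟩ ⟩
          ⟨ α , x ⟩ ⊕ negate ⟨ γ , x ⟩ ⊗ ⟨ α , u ⟩ ⊕ c ⊗ ⟨ α , u ⟩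
            ≡⟨ cong (λ d → ⟨ α , x ⟩ ⊕ d ⊕ c ⊗ ⟨ α , u ⟩) (trans (sym (Zₚₚ.-‿distribˡ-* ⟨ γ , x ⟩ ⟨ α , u ⟩))
                 (cong negate (Zₚ.*-comm ⟨ γ , x ⟩ ⟨ α , u ⟩))) ⟩
          ⟨ α , x ⟩ ⊕ negate (⟨ α , u ⟩ ⊗ ⟨ γ , x ⟩) ⊕ c ⊗ ⟨ α , u ⟩
            ≡⟨ cong (λ d → ⟨ α , x ⟩ ⊕ negate d ⊕ c ⊗ ⟨ α , u ⟩) (⟨⟩-•ˡ ⟨ α , u ⟩ γ x) ⟨
          ⟨ α , x ⟩ ⊕ negate ⟨ ⟨ α , u ⟩ • γ , x ⟩ ⊕ c ⊗ ⟨ α , u ⟩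
            ≡⟨ cong (λ d → ⟨ α , x ⟩ ⊕ d ⊕ c ⊗ ⟨ α , u ⟩) (⟨⟩-negˡ (⟨ α , u ⟩ • γ) x) ⟨
          ⟨ α , x ⟩ ⊕ ⟨ ⊝ (⟨ α , u ⟩ • γ) , x ⟩ ⊕ c ⊗ ⟨ α , u ⟩
            ≡⟨ cong (_⊕ c ⊗ ⟨ α , u ⟩) (⟨⟩-+ˡ α (⊝ (⟨ α , u ⟩ • γ)) x) ⟨
          ⟨ adjoint α , x ⟩ ⊕ c ⊗ ⟨ α , u ⟩ ∎
          where open ≡-Reasoning

        adjoint-0 : adjoint 0ᵥ ≡ 0ᵥ
        adjoint-0 = trans (cong (λ k → 0ᵥ -ᵥ k • γ) (⟨⟩-0ˡ u))
          (trans (cong (0ᵥ -ᵥ_) (•-0ˡ γ)) (V.inverseʳ 0ᵥ))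

        adjoint-γ : adjoint γ ≡ 0ᵥ
        adjoint-γ = trans (cong (λ k → γ -ᵥ k • γ) γu≡1) (trans (cong (γ -ᵥ_) (•-1ˡ γ)) (V.inverseʳ γ))

        adjoint-+ : ∀ α β → adjoint (α +ᵥ β) ≡ adjoint α +ᵥ adjoint β
        adjoint-+ α β = begin
          α +ᵥ β -ᵥ ⟨ α +ᵥ β , u ⟩ • γ
            ≡⟨ cong (λ v → α +ᵥ β -ᵥ v) (trans (cong (_• γ) (⟨⟩-+ˡ α β u)) (•-+ˡ ⟨ α , u ⟩ ⟨ β , u ⟩ γ)) ⟩
          α +ᵥ β -ᵥ (⟨ α , u ⟩ • γ +ᵥ ⟨ β , u ⟩ • γ)
            ≡⟨ cong (α +ᵥ β +ᵥ_) (V.⁻¹-∙-comm (⟨ α , u ⟩ • γ) (⟨ β , u ⟩ • γ)) ⟨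
          α +ᵥ β +ᵥ (⊝ (⟨ α , u ⟩ • γ) -ᵥ ⟨ β , u ⟩ • γ)
            ≡⟨ interchange α β (⊝ (⟨ α , u ⟩ • γ)) (⊝ (⟨ β , u ⟩ • γ)) ⟩
          adjoint α +ᵥ adjoint β ∎
          where
          open ≡-Reasoning
          open Algebra.Properties.CommutativeSemigroup V.commutativeSemigroup using (interchange)

        adjoint-kernel : ∀ {α} → adjoint α ≡ 0ᵥ → ⟨ α , u ⟩ ≡ [ 0 ] → α ≡ 0ᵥ
        adjoint-kernel {α} Pα≡0 αu≡0 = trans (-ᵥ≡0⇒≡ Pα≡0) (trans (cong (_• γ) αu≡0) (•-0ˡ γ))

module Sums where

  open import Defs using (ℤ^; sumOver)
  open Ordered
  open import Algebra.Bundles using (Semiring)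
  open import Data.Fin.Base using (Fin; zero; suc)
  open import Data.Fin.Properties using (suc-injective)
  open import Data.Vec.Properties using (∷-injectiveˡ; ∷-injectiveʳ)
  open import Relation.Binary.Definitions using (DecidableEquality)
  open ≡ using (_≡_; _≢_)

  module VectorSums (S : Semiring 0ℓ 0ℓ) (p : ℕ) where
    open Semiring S hiding (zero)
    open import Algebra.Properties.Semiring.Sum S public using (sum; sum-cong-≋; sum-replicate-zero; ∑-distrib-+; ∑-comm; *-distribˡ-sum; *-distribʳ-sum)

    ∑ : ∀ {n} → (ℤ^ p n → Carrier) → Carrier
    ∑ {n} = sumOver +-rawMonoid p n

    sum-zero : ∀ {m} {g : Fin m → Carrier} → (∀ a → g a ≈ 0#) → sum g ≈ 0#
    sum-zero {m} e = trans (sum-cong-≋ e) (sum-replicate-zero m)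

    sum-single : ∀ {m} {g : Fin m → Carrier} b → (∀ a → a ≢ b → g a ≈ 0#) → sum g ≈ g b
    sum-single zero    e = trans (+-congˡ (sum-zero λ a → e (suc a) λ ())) (+-identityʳ _)
    sum-single (suc b) e = trans (+-cong (e zero λ ()) (sum-single b λ a a≢b → e (suc a) (a≢b ∘ suc-injective)))
      (+-identityˡ _)

    ∑-cong : ∀ {n} {g h : ℤ^ p n → Carrier} → (∀ α → g α ≈ h α) → ∑ g ≈ ∑ h
    ∑-cong {zero}  e = e []
    ∑-cong {suc n} e = sum-cong-≋ λ a → ∑-cong λ α → e (a ∷ α)

    ∑-zero : ∀ {n} {g : ℤ^ p n → Carrier} → (∀ α → g α ≈ 0#) → ∑ g ≈ 0#
    ∑-zero {zero}  e = e []
    ∑-zero {suc n} e = sum-zero λ a → ∑-zero λ α → e (a ∷ α)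

    ∑-single : ∀ {n} {g : ℤ^ p n → Carrier} β → (∀ α → α ≢ β → g α ≈ 0#) → ∑ g ≈ g β
    ∑-single []      e = refl
    ∑-single (b ∷ β) e = trans
      (sum-single b λ a a≢b → ∑-zero λ α → e (a ∷ α) (a≢b ∘ ∷-injectiveˡ))
      (∑-single β λ α α≢β → e (b ∷ α) (α≢β ∘ ∷-injectiveʳ))

    ∑-+ : ∀ {n} (g h : ℤ^ p n → Carrier) → ∑ (λ α → g α + h α) ≈ ∑ g + ∑ h
    ∑-+ {zero}  g h = refl
    ∑-+ {suc n} g h = trans (sum-cong-≋ λ a → ∑-+ (λ α → g (a ∷ α)) (λ α → h (a ∷ α)))
      (∑-distrib-+ (λ a → ∑ λ α → g (a ∷ α)) (λ a → ∑ λ α → h (a ∷ α)))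

    ∑-*ˡ : ∀ {n} c (g : ℤ^ p n → Carrier) → ∑ (λ α → c * g α) ≈ c * ∑ g
    ∑-*ˡ {zero}  c g = refl
    ∑-*ˡ {suc n} c g = trans (sum-cong-≋ λ a → ∑-*ˡ c (λ α → g (a ∷ α)))
      (sym (*-distribˡ-sum c (λ a → ∑ λ α → g (a ∷ α))))

    ∑-*ʳ : ∀ {n} c (g : ℤ^ p n → Carrier) → ∑ (λ α → g α * c) ≈ ∑ g * c
    ∑-*ʳ {zero}  c g = refl
    ∑-*ʳ {suc n} c g = trans (sum-cong-≋ λ a → ∑-*ʳ c (λ α → g (a ∷ α)))
      (sym (*-distribʳ-sum c (λ a → ∑ λ α → g (a ∷ α))))

    ∑-sum-swap : ∀ {m n} (g : ℤ^ p n → Fin m → Carrier) →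
      ∑ (λ α → sum (g α)) ≈ sum (λ a → ∑ λ α → g α a)
    ∑-sum-swap {n = zero}  g = refl
    ∑-sum-swap {n = suc n} g = trans (sum-cong-≋ λ b → ∑-sum-swap λ α → g (b ∷ α))
      (∑-comm λ b a → ∑ λ α → g (b ∷ α) a)

    ∑-swap : ∀ {m n} (g : ℤ^ p m → ℤ^ p n → Carrier) →
      ∑ (λ α → ∑ (g α)) ≈ ∑ (λ β → ∑ λ α → g α β)
    ∑-swap {n = zero}  g = refl
    ∑-swap {n = suc n} g = trans (∑-sum-swap λ α b → ∑ λ β → g α (b ∷ β))
      (sum-cong-≋ λ b → ∑-swap λ α β → g α (b ∷ β))

    when : {A : Set} → Dec A → Carrier → Carrier
    when (yes _) x = x
    when (no _)  x = 0#

    when-yes : ∀ {A} (d : Dec A) {x} → A → when d x ≈ x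
    when-yes (yes _) a = refl
    when-yes (no ¬a) a = contradiction a ¬a

    when-no : ∀ {A} (d : Dec A) {x} → ¬ A → when d x ≈ 0#
    when-no (yes a) ¬a = contradiction a ¬a
    when-no (no _)  ¬a = refl

    when-cong : ∀ {A} (d : Dec A) {x y} → (A → x ≈ y) → when d x ≈ when d y
    when-cong (yes a) e = e a
    when-cong (no _)  e = refl

    when-⇔ : ∀ {A B} (d : Dec A) (d′ : Dec B) {x} → (A → B) → (B → A) → when d x ≈ when d′ x
    when-⇔ (yes a) d′ f g = sym (when-yes d′ (f a))
    when-⇔ (no ¬a) d′ f g = sym (when-no d′ (¬a ∘ g))

    *-when : ∀ {A} (d : Dec A) x y → x * when d y ≈ when d (x * y)
    *-when (yes _) x y = refl
    *-when (no _)  x y = zeroʳ x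

  -- The dimension is fixed so that it need not be inferred.
  module FiniteSums (S : Semiring 0ℓ 0ℓ) (p n : ℕ) where
    open Semiring S hiding (zero)
    private module V = VectorSums S p
    open V public using (sum; sum-cong-≋; sum-zero; sum-single; *-distribˡ-sum; when; when-yes; when-no; when-cong; when-⇔; *-when)

    ∑ : (ℤ^ p n → Carrier) → Carrier
    ∑ = V.∑ {n}

    module _ {g h : ℤ^ p n → Carrier} where
      ∑-cong : (∀ α → g α ≈ h α) → ∑ g ≈ ∑ h
      ∑-cong = V.∑-cong {n} {g} {h}

    ∑-zero : ∀ {g} → (∀ α → g α ≈ 0#) → ∑ g ≈ 0#
    ∑-zero {g} = V.∑-zero {n} {g}

    ∑-single : ∀ {g} β → (∀ α → α ≢ β → g α ≈ 0#) → ∑ g ≈ g β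
    ∑-single {g} = V.∑-single {n} {g}

    ∑-+ : ∀ g h → ∑ (λ α → g α + h α) ≈ ∑ g + ∑ h
    ∑-+ = V.∑-+ {n}

    ∑-*ˡ : ∀ c g → ∑ (λ α → c * g α) ≈ c * ∑ g
    ∑-*ˡ = V.∑-*ˡ {n}

    ∑-*ʳ : ∀ c g → ∑ (λ α → g α * c) ≈ ∑ g * c
    ∑-*ʳ = V.∑-*ʳ {n}

    ∑-sum-swap : ∀ {m} (g : ℤ^ p n → Fin m → Carrier) → ∑ (λ α → sum (g α)) ≈ sum (λ a → ∑ λ α → g α a)
    ∑-sum-swap = V.∑-sum-swap {_} {n}

    ∑-swap : ∀ (g : ℤ^ p n → ℤ^ p n → Carrier) → ∑ (λ α → ∑ (g α)) ≈ ∑ (λ β → ∑ λ α → g α β)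
    ∑-swap = V.∑-swap {n} {n}

    ∑-when : ∀ (_≟_ : DecidableEquality (ℤ^ p n)) (g : ℤ^ p n → Carrier) β →
      ∑ (λ α → when (β ≟ α) (g α)) ≈ g β
    ∑-when _≟_ g β = trans (∑-single β λ α α≢β → when-no (β ≟ α) (α≢β ∘ ≡.sym)) (when-yes (β ≟ β) ≡.refl)

    ∑-fibres : ∀ (_≟_ : DecidableEquality (ℤ^ p n)) (P : ℤ^ p n → ℤ^ p n) (g : ℤ^ p n → ℤ^ p n → Carrier) →
      ∑ (λ β → ∑ λ α → when (P α ≟ β) (g α β)) ≈ ∑ (λ α → g α (P α))
    ∑-fibres _≟_ P g = trans (sym (∑-swap λ α β → when (P α ≟ β) (g α β)))
      (∑-cong λ α → ∑-when _≟_ (g α) (P α))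

    ∑-bijection : ∀ (_≟_ : DecidableEquality (ℤ^ p n)) (f f⁻¹ : ℤ^ p n → ℤ^ p n) →
      (∀ α → f (f⁻¹ α) ≡ α) → (∀ α → f⁻¹ (f α) ≡ α) → (g : ℤ^ p n → Carrier) → ∑ (g ∘ f) ≈ ∑ g
    ∑-bijection _≟_ f f⁻¹ f∘f⁻¹ f⁻¹∘f g = sym (trans
      (∑-cong λ β → sym (trans
        (∑-single (f⁻¹ β) λ α α≢ → when-no (f α ≟ β) λ fα≡β → α≢ (≡.trans (≡.sym (f⁻¹∘f α)) (≡.cong f⁻¹ fα≡β)))
        (when-yes (f (f⁻¹ β) ≟ β) (f∘f⁻¹ β))))
      (∑-fibres _≟_ f λ _ → g))

  module OrderedSums (F : RealField) (p n : ℕ) where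
    open RealField F hiding (zero)
    open RealFieldProperties F
    open FiniteSums semiring p n

    sum-mono : ∀ {m} {g h : Fin m → Carrier} → (∀ a → g a ≤ h a) → sum g ≤ sum h
    sum-mono {zero}  g≤h = ≤-refl
    sum-mono {suc m} g≤h = +-mono-≤ (g≤h zero) (sum-mono (g≤h ∘ suc))

    ∑-mono : ∀ {g h : ℤ^ p n → Carrier} → (∀ α → g α ≤ h α) → ∑ g ≤ ∑ h
    ∑-mono = go n
      where
      go : ∀ m {g h : ℤ^ p m → Carrier} → (∀ α → g α ≤ h α) → VectorSums.∑ semiring p g ≤ VectorSums.∑ semiring p h
      go zero    g≤h = g≤h []
      go (suc m) g≤h = sum-mono λ a → go m λ α → g≤h (a ∷ α)

    sum-nonneg : ∀ {m} {g : Fin m → Carrier} → (∀ a → 0# ≤ g a) → 0# ≤ sum g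
    sum-nonneg {zero}  0≤g = ≤-refl
    sum-nonneg {suc m} 0≤g = +-nonneg (0≤g zero) (sum-nonneg (0≤g ∘ suc))

    ∑-nonneg : ∀ {g : ℤ^ p n → Carrier} → (∀ α → 0# ≤ g α) → 0# ≤ ∑ g
    ∑-nonneg 0≤g = ≤-respˡ (∑-zero {λ _ → 0#} λ _ → refl) (∑-mono 0≤g)

    when-nonneg : ∀ {A} (d : Dec A) {x} → 0# ≤ x → 0# ≤ when d x
    when-nonneg (yes _) 0≤x = 0≤x
    when-nonneg (no _)  0≤x = ≤-refl

    when-mono : ∀ {A} (d : Dec A) {x y} → x ≤ y → when d x ≤ when d y
    when-mono (yes _) x≤y = x≤y
    when-mono (no _)  x≤y = ≤-refl

    when-≤ : ∀ {A} (d : Dec A) {x} → 0# ≤ x → when d x ≤ x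
    when-≤ (yes _) 0≤x = ≤-refl
    when-≤ (no _)  0≤x = 0≤x

    term≤∑ : ∀ (_≟_ : DecidableEquality (ℤ^ p n)) {g : ℤ^ p n → Carrier} →
      (∀ α → 0# ≤ g α) → ∀ β → g β ≤ ∑ g
    term≤∑ _≟_ {g} 0≤g β = ≤-respˡ (∑-when _≟_ g β) (∑-mono λ α → when-≤ (β ≟ α) (0≤g α))

    two-terms≤∑ : ∀ (_≟_ : DecidableEquality (ℤ^ p n)) {g : ℤ^ p n → Carrier} →
      (∀ α → 0# ≤ g α) → ∀ {β γ} → β ≢ γ → g β + g γ ≤ ∑ g
    two-terms≤∑ _≟_ {g} 0≤g {β} {γ} β≢γ = ≤-respˡ
      (trans (∑-+ (λ α → when (β ≟ α) (g α)) (λ α → when (γ ≟ α) (g α))) (+-cong (∑-when _≟_ g β) (∑-when _≟_ g γ)))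
      (∑-mono λ α → bound α (β ≟ α) (γ ≟ α))
      where
      bound : ∀ α (d : Dec (β ≡ α)) (d′ : Dec (γ ≡ α)) → when d (g α) + when d′ (g α) ≤ g α
      bound α (yes e) (yes e′) = contradiction (≡.trans e (≡.sym e′)) β≢γ
      bound α (yes _) (no _)   = ≤-reflexive (+-identityʳ (g α))
      bound α (no _)  d′       = ≤-respˡ (sym (+-identityˡ _)) (when-≤ d′ (0≤g α))

    ≤0-term : ∀ {m} {g : Fin m → Carrier} → (∀ a → 0# ≤ g a) → sum g ≤ 0# → ∀ a → g a ≤ 0#
    ≤0-term {suc m} {g} 0≤g h zero = ≤-trans (≤-by-difference _ (sum-nonneg (0≤g ∘ suc)) refl) h
    ≤0-term {suc m} {g} 0≤g h (suc a) = ≤0-term (0≤g ∘ suc)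
      (≤-trans (≤-by-difference _ (0≤g zero) (+-comm _ _)) h) a

module Fourier where

  open import Defs using (ℤ^; ⟨_,_⟩)
  open Ordered
  open Series using (fromℕℚ; reciprocal-*)
  open ComplexExp
  open Modular
  open Sums
  open import Data.Fin.Base using (Fin; zero; suc; toℕ)
  import Data.Fin.Properties
  open import Data.Fin.Permutation using (permutation)
  open import Data.Integer.Base using (+_)
  open import Data.Nat.DivMod using (_%_; m≡m%n+[m/n]*n)
  open import Data.Rational.Base using (_/_)
  open ≡ using (_≡_; _≢_)

  *-reciprocal : ∀ d .{{_ : NonZero d}} → fromℕℚ d ℚ.* (+ 1 / d) ≡ 1ℚ
  *-reciprocal (suc d) = reciprocal-* d 1 (suc d) (≡.sym (ℕₚ.*-identityʳ (suc d)))

  record RootOfUnity {F : RealField} (C : ComplexField F) (p : ℕ) : Set where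
    open ComplexFieldProperties C
    field
      ω         : Carrier
      ω^p≈1     : ω ^ p ≈ 1#
      ω*conj≈1  : ω * conj ω ≈ 1#
      ω≉1       : ¬ ω ≈ 1#

  module FourierAnalysis {F : RealField} (C : ComplexField F) (p n : ℕ) .{{_ : NonZero p}}
    (p-prime : Prime p) (root : RootOfUnity C p) where
    open ComplexFieldProperties C hiding (zero; sum) public
    open R using (_≤_)
    open RootOfUnity root public
    open Arithmetic p hiding (commutativeRing) public
    open Vectors public
    open Solver
    open FiniteSums semiring p n public
    module ΣR = FiniteSums R.semiring p n
    module ΣO = OrderedSums F p n
    open import Algebra.Properties.Semiring.Exp semiring using (^-homo-*; ^-assocʳ)
    open import Relation.Binary.Reasoning.Setoid setoid

    V : Set
    V = ℤ^ p n

    1^ : ∀ k → 1# ^ k ≈ 1#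
    1^ zero    = refl
    1^ (suc k) = trans (*-identityˡ _) (1^ k)

    opaque
      e : Fin p → Carrier
      e a = ω ^ toℕ a

    opaque
      unfolding e

      e-def : ∀ a → e a ≈ ω ^ toℕ a
      e-def a = refl

      e-[] : ∀ m → e [ m ] ≈ ω ^ m
      e-[] m = begin
        ω ^ toℕ [ m ] ≡⟨ ≡.cong (ω ^_) (toℕ-[] m) ⟩
        ω ^ (m % p) ≈⟨ *-identityʳ _ ⟨
        ω ^ (m % p) * 1# ≈⟨ *-congˡ (1^ (m ℕ./ p)) ⟨
        ω ^ (m % p) * 1# ^ (m ℕ./ p) ≈⟨ *-congˡ (^-congˡ (m ℕ./ p) ω^p≈1) ⟨
        ω ^ (m % p) * (ω ^ p) ^ (m ℕ./ p) ≈⟨ *-congˡ (^-assocʳ ω p (m ℕ./ p)) ⟩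
        ω ^ (m % p) * ω ^ (p ℕ.* (m ℕ./ p)) ≈⟨ ^-homo-* ω (m % p) (p ℕ.* (m ℕ./ p)) ⟨
        ω ^ (m % p ℕ.+ p ℕ.* (m ℕ./ p))
          ≡⟨ ≡.cong (ω ^_) (≡.trans (≡.cong (m % p ℕ.+_) (ℕₚ.*-comm p (m ℕ./ p))) (≡.sym (m≡m%n+[m/n]*n m p))) ⟩
        ω ^ m ∎

      e-⊕ : ∀ a b → e (a ⊕ b) ≈ e a * e b
      e-⊕ a b = trans (e-[] (toℕ a ℕ.+ toℕ b)) (^-homo-* ω (toℕ a) (toℕ b))

      e-0 : e [ 0 ] ≈ 1#
      e-0 = e-[] 0

      e-⊗ : ∀ a b → e (a ⊗ b) ≈ e a ^ toℕ b
      e-⊗ a b = trans (e-[] (toℕ a ℕ.* toℕ b)) (sym (^-assocʳ ω (toℕ a) (toℕ b)))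

      e*conj : ∀ a → e a * conj (e a) ≈ 1#
      e*conj a = trans (*-congˡ (conj-^ ω (toℕ a))) (go (toℕ a))
        where
        go : ∀ k → ω ^ k * conj ω ^ k ≈ 1#
        go zero    = *-identityˡ 1#
        go (suc k) = trans
          (solve 4 (λ w x v y → w :* x :* (v :* y) := w :* v :* (x :* y)) refl ω (ω ^ k) (conj ω) (conj ω ^ k))
          (trans (*-cong ω*conj≈1 (go k)) (*-identityˡ 1#))

    e-negate : ∀ a → e (negate a) ≈ conj (e a)
    e-negate a = begin
      e (negate a) ≈⟨ *-identityʳ _ ⟨
      e (negate a) * 1# ≈⟨ *-congˡ (e*conj a) ⟨
      e (negate a) * (e a * conj (e a)) ≈⟨ *-assoc _ _ _ ⟨
      e (negate a) * e a * conj (e a) ≈⟨ *-congʳ (e-⊕ (negate a) a) ⟨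
      e (negate a ⊕ a) * conj (e a) ≡⟨ ≡.cong (λ b → e b * conj (e a)) (Zₚ.-‿inverseˡ a) ⟩
      e [ 0 ] * conj (e a) ≈⟨ trans (*-congʳ e-0) (*-identityˡ _) ⟩
      conj (e a) ∎

    ∣e∣ : ∀ a → ∣ e a ∣ R.≈ R.1#
    ∣e∣ a = R.square-injective (∣∣-nonneg (e a)) R.0≤1 (R.trans
      (real-injective (trans (∣∣-square (e a)) (trans (e*conj a) (sym real-1))))
      (R.sym (R.*-identityˡ R.1#)))

    e-injective : ∀ {a} → e a ≈ 1# → a ≡ [ 0 ]
    e-injective {a} ea≈1 with a Data.Fin.Properties.≟ [ 0 ]
    ... | yes a≡0 = a≡0
    ... | no a≢0 =
      let b , ab≡1 = inverse p-prime a≢0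
      in ⊥-elim (ω≉1 (begin
        ω ≈⟨ *-identityʳ ω ⟨
        ω ^ 1 ≈⟨ e-[] 1 ⟨
        e [ 1 ] ≡⟨ ≡.cong e ab≡1 ⟨
        e (a ⊗ b) ≈⟨ e-⊗ a b ⟩
        e a ^ toℕ b ≈⟨ ^-congˡ (toℕ b) ea≈1 ⟩
        1# ^ toℕ b ≈⟨ 1^ (toℕ b) ⟩
        1# ∎))

    fixed-by-character : ∀ {a S} → a ≢ [ 0 ] → e a * S ≈ S → S ≈ 0#
    fixed-by-character {a} {S} a≢0 eaS≈S = ∣∣-zero (R.*-cancel-≤0
      (λ h → a≢0 (e-injective (trans (solve 2 (λ z o → z := z :+ :- o :+ o) refl (e a) 1#)
        (trans (+-congʳ (∣∣-zero h)) (+-identityˡ 1#)))))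
      (R.≤-reflexive (R.trans (R.sym (∣∣-* (e a + - 1#) S)) (R.trans (∣∣-cong (begin
        (e a + - 1#) * S ≈⟨ solve 3 (λ z o s → (z :+ :- o) :* s := z :* s :+ :- (o :* s)) refl (e a) 1# S ⟩
        e a * S + - (1# * S) ≈⟨ +-cong eaS≈S (-‿cong (*-identityˡ S)) ⟩
        S + - S ≈⟨ -‿inverseʳ S ⟩
        0# ∎)) ∣0∣))))

    sum-e : ∀ {k} → k ≢ [ 0 ] → sum (λ c → e (c ⊗ k)) ≈ 0#
    sum-e {k} k≢0 = fixed-by-character k≢0 (begin
      e k * sum (λ c → e (c ⊗ k)) ≈⟨ *-distribˡ-sum (e k) (λ c → e (c ⊗ k)) ⟩
      sum (λ c → e k * e (c ⊗ k)) ≈⟨ sum-cong-≋ shift ⟨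
      sum (λ c → e ((c ⊕ [ 1 ]) ⊗ k)) ≈⟨ sum-permute (λ c → e (c ⊗ k)) π ⟨
      sum (λ c → e (c ⊗ k)) ∎)
      where
      open import Algebra.Properties.Semiring.Sum semiring using (sum-permute)
      shift : ∀ c → e ((c ⊕ [ 1 ]) ⊗ k) ≈ e k * e (c ⊗ k)
      shift c = trans (reflexive (≡.cong e (≡.trans (Zₚ.distribʳ k c [ 1 ])
        (≡.trans (≡.cong (c ⊗ k ⊕_) (Zₚ.*-identityˡ k)) (Zₚ.+-comm (c ⊗ k) k))))) (e-⊕ k (c ⊗ k))
      π = permutation (_⊕ [ 1 ]) (_⊕ negate [ 1 ])
        (λ y → ≡.trans (Zₚ.+-assoc y (negate [ 1 ]) [ 1 ]) (≡.trans (≡.cong (y ⊕_) (Zₚ.-‿inverseˡ [ 1 ])) (Zₚ.+-identityʳ y)))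
        (λ y → ≡.trans (Zₚ.+-assoc y [ 1 ] (negate [ 1 ])) (≡.trans (≡.cong (y ⊕_) (Zₚ.-‿inverseʳ [ 1 ])) (Zₚ.+-identityʳ y)))

    ∑-shift : ∀ (g : V → Carrier) u → ∑ (λ x → g (x +ᵥ u)) ≈ ∑ g
    ∑-shift g u = ∑-bijection _≟ᵥ_ (_+ᵥ u) (_-ᵥ u) (λ x → +ᵥ-cancel x u) (λ x → -ᵥ-cancel x u) g

    ∑-e : ∀ {α : V} → α ≢ 0ᵥ → ∑ (λ x → e ⟨ α , x ⟩) ≈ 0#
    ∑-e {α} α≢0 =
      let u , αu≡1 = dual-vector p-prime α≢0
      in fixed-by-character {[ 1 ]} 1≢0 (begin
        e [ 1 ] * ∑ (λ x → e ⟨ α , x ⟩) ≈⟨ ∑-*ˡ (e [ 1 ]) _ ⟨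
        ∑ (λ x → e [ 1 ] * e ⟨ α , x ⟩) ≈⟨ ∑-cong (λ x → trans (*-comm _ _)
          (trans (sym (e-⊕ ⟨ α , x ⟩ [ 1 ])) (reflexive (≡.cong e (≡.sym (≡.trans (⟨⟩-+ʳ α x u) (≡.cong (⟨ α , x ⟩ ⊕_) αu≡1))))))) ⟩
        ∑ (λ x → e ⟨ α , x +ᵥ u ⟩) ≈⟨ ∑-shift (λ x → e ⟨ α , x ⟩) u ⟩
        ∑ (λ x → e ⟨ α , x ⟩) ∎)
      where
      1≢0 : [ 1 ] ≢ [ 0 ]
      1≢0 1≡0 = ω≉1 (trans (sym (*-identityʳ ω)) (trans (sym (e-[] 1)) (trans (reflexive (≡.cong e 1≡0)) e-0)))

    1/pⁿ : ℚ
    1/pⁿ = (+ 1 / (p ℕ.^ n)) {{ℕₚ.m^n≢0 p n}}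

    𝔼 : (V → Carrier) → Carrier
    𝔼 g = ι 1/pⁿ * ∑ g

    sum-const : ∀ m c → sum {m} (λ _ → c) ≈ nat m * c
    sum-const zero    c = sym (trans (*-congʳ ι-0) (zeroˡ c))
    sum-const (suc m) c = trans (+-congˡ (sum-const m c)) (sym (trans (*-congʳ (nat-suc m))
      (trans (distribʳ c (nat m) 1#) (trans (+-comm _ _) (+-congʳ (*-identityˡ c))))))

    𝔼-1 : 𝔼 (λ _ → 1#) ≈ 1#
    𝔼-1 = begin
      ι 1/pⁿ * ∑ (λ _ → 1#) ≈⟨ *-congˡ (count n) ⟩
      ι 1/pⁿ * nat (p ℕ.^ n) ≈⟨ trans (*-comm _ _) (sym (ι-* (fromℕℚ (p ℕ.^ n)) 1/pⁿ)) ⟩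
      ι (fromℕℚ (p ℕ.^ n) ℚ.* 1/pⁿ) ≡⟨ ≡.cong ι (*-reciprocal (p ℕ.^ n) {{ℕₚ.m^n≢0 p n}}) ⟩
      ι 1ℚ ≈⟨ ι-1 ⟩
      1# ∎
      where
      nat-* : ∀ a b → nat (a ℕ.* b) ≈ nat a * nat b
      nat-* a b = trans (sym (real-ι _)) (trans (real-cong (R.nat-* a b)) (trans (real-* _ _) (*-cong (real-ι _) (real-ι _))))
      count : ∀ m → VectorSums.∑ semiring p {m} (λ _ → 1#) ≈ nat (p ℕ.^ m)
      count zero    = sym ι-1
      count (suc m) = trans (sum-const p (VectorSums.∑ semiring p {m} (λ _ → 1#)))
        (trans (*-congˡ (count m)) (sym (nat-* p (p ℕ.^ m))))

    𝔼-cong : ∀ {g h} → (∀ x → g x ≈ h x) → 𝔼 g ≈ 𝔼 h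
    𝔼-cong g≈h = *-congˡ (∑-cong g≈h)

    𝔼-*ˡ : ∀ c g → 𝔼 (λ x → c * g x) ≈ c * 𝔼 g
    𝔼-*ˡ c g = trans (*-congˡ (∑-*ˡ c g)) (solve 3 (λ q c s → q :* (c :* s) := c :* (q :* s)) refl (ι 1/pⁿ) c (∑ g))

    𝔼-∑ : ∀ (g : V → V → Carrier) → 𝔼 (λ x → ∑ λ α → g α x) ≈ ∑ (λ α → 𝔼 (g α))
    𝔼-∑ g = trans (*-congˡ (∑-swap λ x α → g α x)) (sym (∑-*ˡ (ι 1/pⁿ) (λ α → ∑ (g α))))

    𝔼-e : ∀ α β → 𝔼 (λ x → e ⟨ α -ᵥ β , x ⟩) ≈ when (α ≟ᵥ β) 1#
    𝔼-e α β with α ≟ᵥ β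
    ... | yes ≡.refl = trans (𝔼-cong λ x → trans (reflexive (≡.cong e
        (≡.trans (≡.cong ⟨_, x ⟩ (V.inverseʳ α)) (⟨⟩-0ˡ x)))) e-0) 𝔼-1
    ... | no α≢β = trans (*-congˡ (∑-e (α≢β ∘ -ᵥ≡0⇒≡))) (zeroʳ _)

    e-⟨-⟩ : ∀ (α β x : V) → e ⟨ α -ᵥ β , x ⟩ ≈ e ⟨ α , x ⟩ * conj (e ⟨ β , x ⟩)
    e-⟨-⟩ α β x = trans (reflexive (≡.cong e (≡.trans (⟨⟩-+ˡ α (⊝ β) x) (≡.cong (⟨ α , x ⟩ ⊕_) (⟨⟩-negˡ β x)))))
      (trans (e-⊕ _ _) (*-congˡ (e-negate _)))

    fourier : (V → Carrier) → V → Carrier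
    fourier g α = 𝔼 λ x → g x * conj (e ⟨ α , x ⟩)

    fourier-cong : ∀ {g h} → (∀ x → g x ≈ h x) → ∀ α → fourier g α ≈ fourier h α
    fourier-cong g≈h α = 𝔼-cong λ x → *-congʳ (g≈h x)

    ∑-*-assoc : ∀ (a b : V → Carrier) c → ∑ (λ α → a α * b α) * c ≈ ∑ (λ α → a α * (b α * c))
    ∑-*-assoc a b c = trans (sym (∑-*ʳ c (λ α → a α * b α))) (∑-cong λ α → *-assoc (a α) (b α) c)

    fourier-expansion : ∀ {g} (c : V → Carrier) (P : V → V) → (∀ x → g x ≈ ∑ λ α → c α * e ⟨ P α , x ⟩) →
      ∀ β → fourier g β ≈ ∑ λ α → when (P α ≟ᵥ β) (c α)
    fourier-expansion {g} c P expansion β = begin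
      𝔼 (λ x → g x * conj (e ⟨ β , x ⟩)) ≈⟨ 𝔼-cong (λ x → trans (*-congʳ (expansion x))
        (trans (∑-*-assoc c (λ α → e ⟨ P α , x ⟩) (conj (e ⟨ β , x ⟩)))
          (∑-cong λ α → *-congˡ (sym (e-⟨-⟩ (P α) β x))))) ⟩
      𝔼 (λ x → ∑ λ α → c α * e ⟨ P α -ᵥ β , x ⟩) ≈⟨ 𝔼-∑ (λ α x → c α * e ⟨ P α -ᵥ β , x ⟩) ⟩
      ∑ (λ α → 𝔼 λ x → c α * e ⟨ P α -ᵥ β , x ⟩) ≈⟨ ∑-cong (λ α → trans (𝔼-*ˡ (c α) (λ x → e ⟨ P α -ᵥ β , x ⟩))
        (trans (*-congˡ (𝔼-e (P α) β)) (trans (*-when (P α ≟ᵥ β) (c α) 1#)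
          (when-cong (P α ≟ᵥ β) λ _ → *-identityʳ (c α))))) ⟩
      ∑ (λ α → when (P α ≟ᵥ β) (c α)) ∎

    ∑-delta : ∀ x y → ∑ (λ α → e ⟨ α , x -ᵥ y ⟩) ≈ when (y ≟ᵥ x) (∑ λ _ → 1#)
    ∑-delta x y with y ≟ᵥ x
    ... | yes ≡.refl = ∑-cong λ α → trans (reflexive (≡.cong e
        (≡.trans (⟨⟩-comm α (x -ᵥ x)) (≡.trans (≡.cong ⟨_, α ⟩ (V.inverseʳ x)) (⟨⟩-0ˡ α))))) e-0
    ... | no y≢x = trans (∑-cong λ α → reflexive (≡.cong e (⟨⟩-comm α (x -ᵥ y))))
        (∑-e λ x-y≡0 → y≢x (≡.sym (-ᵥ≡0⇒≡ x-y≡0)))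

    inversion : ∀ g x → g x ≈ ∑ λ α → fourier g α * e ⟨ α , x ⟩
    inversion g x = sym (begin
      ∑ (λ α → fourier g α * e ⟨ α , x ⟩)
        ≈⟨ ∑-cong (λ α → trans (*-assoc _ _ _) (*-congˡ (trans
             (sym (∑-*ʳ (e ⟨ α , x ⟩) (λ y → g y * conj (e ⟨ α , y ⟩)))) (∑-cong λ y → character α y)))) ⟩
      ∑ (λ α → 𝔼 λ y → g y * e ⟨ α , x -ᵥ y ⟩) ≈⟨ 𝔼-∑ (λ α y → g y * e ⟨ α , x -ᵥ y ⟩) ⟨
      𝔼 (λ y → ∑ λ α → g y * e ⟨ α , x -ᵥ y ⟩)
        ≈⟨ 𝔼-cong (λ y → trans (∑-*ˡ (g y) _) (trans (*-congˡ (∑-delta x y)) (*-when (y ≟ᵥ x) (g y) _))) ⟩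
      𝔼 (λ y → when (y ≟ᵥ x) (g y * ∑ λ _ → 1#))
        ≈⟨ *-congˡ (trans (∑-single x λ y y≢x → when-no (y ≟ᵥ x) y≢x) (when-yes (x ≟ᵥ x) ≡.refl)) ⟩
      ι 1/pⁿ * (g x * ∑ λ _ → 1#) ≈⟨ solve 3 (λ q c s → q :* (c :* s) := c :* (q :* s)) refl (ι 1/pⁿ) (g x) _ ⟩
      g x * 𝔼 (λ _ → 1#) ≈⟨ trans (*-congˡ 𝔼-1) (*-identityʳ (g x)) ⟩
      g x ∎)
      where
      character : ∀ α y → g y * conj (e ⟨ α , y ⟩) * e ⟨ α , x ⟩ ≈ g y * e ⟨ α , x -ᵥ y ⟩
      character α y = trans (*-assoc _ _ _) (*-congˡ (trans (*-comm _ _) (trans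
        (*-cong (reflexive (≡.cong e (⟨⟩-comm α x))) (conj-cong (reflexive (≡.cong e (⟨⟩-comm α y)))))
        (trans (sym (e-⟨-⟩ x y α)) (reflexive (≡.cong e (⟨⟩-comm (x -ᵥ y) α)))))))

    fourier-* : ∀ g h α → fourier (λ x → g x * h x) α ≈ ∑ λ β → fourier g β * fourier h (α -ᵥ β)
    fourier-* g h α = begin
      𝔼 (λ x → g x * h x * conj (e ⟨ α , x ⟩))
        ≈⟨ 𝔼-cong (λ x → trans (*-assoc _ _ _) (trans (*-congʳ (inversion g x)) (trans
             (∑-*-assoc (fourier g) (λ β → e ⟨ β , x ⟩) (h x * conj (e ⟨ α , x ⟩)))
             (∑-cong λ β → *-congˡ (rotate x β))))) ⟩
      𝔼 (λ x → ∑ λ β → fourier g β * (h x * conj (e ⟨ α -ᵥ β , x ⟩)))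
        ≈⟨ 𝔼-∑ (λ β x → fourier g β * (h x * conj (e ⟨ α -ᵥ β , x ⟩))) ⟩
      ∑ (λ β → 𝔼 λ x → fourier g β * (h x * conj (e ⟨ α -ᵥ β , x ⟩)))
        ≈⟨ ∑-cong (λ β → 𝔼-*ˡ (fourier g β) (λ x → h x * conj (e ⟨ α -ᵥ β , x ⟩))) ⟩
      ∑ (λ β → fourier g β * fourier h (α -ᵥ β)) ∎
      where
      rotate : ∀ x β → e ⟨ β , x ⟩ * (h x * conj (e ⟨ α , x ⟩)) ≈ h x * conj (e ⟨ α -ᵥ β , x ⟩)
      rotate x β = trans (solve 3 (λ a b c → a :* (b :* c) := b :* (a :* c)) refl _ _ _) (*-congˡ
        (trans (sym (e-⟨-⟩ β α x)) (trans (reflexive (≡.cong (λ v → e ⟨ v , x ⟩) (≡.sym (swap α β))))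
          (trans (reflexive (≡.cong e (⟨⟩-negˡ (α -ᵥ β) x))) (e-negate _)))))
        where
        swap : ∀ (α β : V) → ⊝ (α -ᵥ β) ≡ β -ᵥ α
        swap α β = ≡.trans (≡.sym (V.⁻¹-∙-comm α (⊝ β))) (≡.trans (≡.cong (⊝ α +ᵥ_) (V.⁻¹-involutive β)) (V.comm (⊝ α) β))

    conj-∑ : ∀ g → conj (∑ g) ≈ ∑ (conj ∘ g)
    conj-∑ = go n
      where
      sum-conj : ∀ m (g : Fin m → Carrier) → conj (sum g) ≈ sum (conj ∘ g)
      sum-conj zero    g = conj-0
      sum-conj (suc m) g = trans (conj-+ _ _) (+-congˡ (sum-conj m (g ∘ suc)))
      go : ∀ m (g : ℤ^ p m → Carrier) → conj (VectorSums.∑ semiring p g) ≈ VectorSums.∑ semiring p (conj ∘ g)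
      go zero    g = refl
      go (suc m) g = trans (sum-conj p _) (sum-cong-≋ λ a → go m λ α → g (a ∷ α))

    real-∑ : ∀ g → real (ΣR.∑ g) ≈ ∑ (real ∘ g)
    real-∑ = go n
      where
      sum-real : ∀ m (g : Fin m → R.Carrier) → real (ΣR.sum g) ≈ sum (real ∘ g)
      sum-real zero    g = real-0
      sum-real (suc m) g = trans (real-+ _ _) (+-congˡ (sum-real m (g ∘ suc)))
      go : ∀ m (g : ℤ^ p m → R.Carrier) → real (VectorSums.∑ R.semiring p g) ≈ VectorSums.∑ semiring p (real ∘ g)
      go zero    g = refl
      go (suc m) g = trans (sum-real p _) (sum-cong-≋ λ a → go m λ α → g (a ∷ α))

    sum-real : ∀ {m} (g : Fin m → R.Carrier) → real (ΣR.sum g) ≈ sum (real ∘ g)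
    sum-real {zero}  g = real-0
    sum-real {suc m} g = trans (real-+ _ _) (+-congˡ (sum-real (g ∘ suc)))

    ∑-triangle : ∀ g → ∣ ∑ g ∣ ≤ ΣR.∑ (∣_∣ ∘ g)
    ∑-triangle = go n
      where
      sum-triangle : ∀ m (g : Fin m → Carrier) → ∣ sum g ∣ ≤ ΣR.sum (∣_∣ ∘ g)
      sum-triangle zero    g = R.≤-reflexive ∣0∣
      sum-triangle (suc m) g = R.≤-trans (∣∣-triangle _ _) (R.+-mono-≤ R.≤-refl (sum-triangle m (g ∘ suc)))
      go : ∀ m (g : ℤ^ p m → Carrier) → ∣ VectorSums.∑ semiring p g ∣ ≤ VectorSums.∑ R.semiring p (∣_∣ ∘ g)
      go zero    g = R.≤-refl
      go (suc m) g = R.≤-trans (sum-triangle p _) (ΣO.sum-mono λ a → go m λ α → g (a ∷ α))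

    ∣when∣ : ∀ {A} (d : Dec A) z → ∣ when d z ∣ R.≈ ΣR.when d ∣ z ∣
    ∣when∣ (yes _) z = R.refl
    ∣when∣ (no _)  z = ∣0∣

    fourier-⊝ : ∀ {g} → (∀ x → conj (g x) ≈ g x) → ∀ α → fourier g (⊝ α) ≈ conj (fourier g α)
    fourier-⊝ {g} real-valued α = sym (begin
      conj (ι 1/pⁿ * ∑ (λ x → g x * conj (e ⟨ α , x ⟩))) ≈⟨ conj-* _ _ ⟩
      conj (ι 1/pⁿ) * conj (∑ (λ x → g x * conj (e ⟨ α , x ⟩))) ≈⟨ *-cong (conj-ι _) (conj-∑ _) ⟩
      𝔼 (λ x → conj (g x * conj (e ⟨ α , x ⟩))) ≈⟨ 𝔼-cong (λ x → trans (conj-* _ _)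
        (*-cong (real-valued x) (conj-cong (trans (sym (e-negate _)) (reflexive (≡.cong e (≡.sym (⟨⟩-negˡ α x)))))))) ⟩
      fourier g (⊝ α) ∎)

    norm : (V → Carrier) → R.Carrier
    norm g = ΣR.∑ λ α → ∣ fourier g α ∣

    energy : (V → Carrier) → R.Carrier
    energy g = ΣR.∑ λ α → ∣ fourier g α ∣ R.* ∣ fourier g α ∣

    -- For an idempotent g this is Parseval's identity.
    energy-idempotent : ∀ {g} → (∀ x → conj (g x) ≈ g x) → (∀ x → g x * g x ≈ g x) → real (energy g) ≈ fourier g 0ᵥ
    energy-idempotent {g} real-valued idempotent = begin
      real (energy g) ≈⟨ real-∑ _ ⟩
      ∑ (λ β → real (∣ fourier g β ∣ R.* ∣ fourier g β ∣))
        ≈⟨ ∑-cong (λ β → trans (∣∣-square (fourier g β)) (*-congˡ (trans (sym (fourier-⊝ real-valued β))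
             (reflexive (≡.cong (fourier g) (≡.sym (V.identityˡ (⊝ β)))))))) ⟩
      ∑ (λ β → fourier g β * fourier g (0ᵥ -ᵥ β)) ≈⟨ fourier-* g g 0ᵥ ⟨
      fourier (λ x → g x * g x) 0ᵥ ≈⟨ fourier-cong idempotent 0ᵥ ⟩
      fourier g 0ᵥ ∎

    value≤norm : ∀ g x → ∣ g x ∣ ≤ norm g
    value≤norm g x = R.≤-respˡ (∣∣-cong (sym (inversion g x))) (R.≤-trans (∑-triangle _)
      (ΣO.∑-mono λ α → R.≤-reflexive (R.trans (∣∣-* _ _) (R.trans (R.*-congˡ (∣e∣ ⟨ α , x ⟩)) (R.*-identityʳ _)))))

    -- The substitution x ↦ τ x acts on characters by χ_α ∘ τ = e(φ α) χ_{P α}.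
    record Substitution : Set where
      field
        τ P : V → V
        φ   : V → Fin p
        ⟨⟩-τ : ∀ α x → ⟨ α , τ x ⟩ ≡ ⟨ P α , x ⟩ ⊕ φ α

    module _ (s : Substitution) (g : V → Carrier) where
      open Substitution s

      fourier-∘ : ∀ β → fourier (g ∘ τ) β ≈ ∑ λ α → when (P α ≟ᵥ β) (fourier g α * e (φ α))
      fourier-∘ = fourier-expansion (λ α → fourier g α * e (φ α)) P λ x → trans (inversion g (τ x))
        (∑-cong λ α → trans (*-congˡ (trans (reflexive (≡.cong e (⟨⟩-τ α x))) (trans (e-⊕ ⟨ P α , x ⟩ (φ α)) (*-comm _ _))))
          (sym (*-assoc _ _ _)))

      fibre-norm : V → R.Carrier
      fibre-norm β = ΣR.∑ λ α → ΣR.when (P α ≟ᵥ β) ∣ fourier g α ∣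

      fourier-∘-≤ : ∀ β → ∣ fourier (g ∘ τ) β ∣ ≤ fibre-norm β
      fourier-∘-≤ β = R.≤-respˡ (∣∣-cong (sym (fourier-∘ β))) (R.≤-trans (∑-triangle _)
        (ΣO.∑-mono λ α → R.≤-reflexive (R.trans (∣when∣ (P α ≟ᵥ β) _) (ΣR.when-cong (P α ≟ᵥ β) λ _ →
          R.trans (∣∣-* _ _) (R.trans (R.*-congˡ (∣e∣ (φ α))) (R.*-identityʳ _))))))

      ∑-fibre-norm : ΣR.∑ fibre-norm R.≈ norm g
      ∑-fibre-norm = ΣR.∑-fibres _≟ᵥ_ P λ α _ → ∣ fourier g α ∣

      norm-∘-≤ : norm (g ∘ τ) ≤ norm g
      norm-∘-≤ = R.≤-respʳ ∑-fibre-norm (ΣO.∑-mono fourier-∘-≤)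

module KeyLemma where

  open import Defs using (ℤ^; ⟨_,_⟩)
  open Ordered
  open Exp using (module NonnegativeSeries)
  open ComplexExp
  open Logarithm using (module NaturalsInField)
  open Modular
  open Sums
  open Fourier
  open import Data.Fin.Base using (Fin; zero; suc)
  import Data.Integer.Base
  open ≡ using (_≡_; _≢_)

  module Inequalities (F : RealField) where
    open RealField F hiding (_-_)
    open NonnegativeSeries F
    open Solver

    square-difference : ∀ {a g Q} → 0# ≤ g → g ≤ a → a ≤ Q → a * a + - (g * g) ≤ (Q + Q) * (a + - g)
    square-difference {a} {g} {Q} 0≤g g≤a a≤Q = ≤-by-difference
      ((a + - g) * ((Q + - a) + (Q + - a) + (a + - g)))
      (*-nonneg (0≤-difference g≤a) (+-nonneg (+-nonneg (0≤-difference a≤Q) (0≤-difference a≤Q)) (0≤-difference g≤a)))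
      (solve 3 (λ a g Q → (Q :+ Q) :* (a :+ :- g) :=
        a :* a :+ :- (g :* g) :+ (a :+ :- g) :* ((Q :+ :- a) :+ (Q :+ :- a) :+ (a :+ :- g))) refl a g Q)

    double-cancel : ∀ {x y} → x + x ≤ y + y → x ≤ y
    double-cancel {x} {y} h = ≤-by-difference (ι ½ * (y + y + - (x + x)))
      (*-nonneg (ι-nonneg (ℚ.*≤* (Data.Integer.Base.+≤+ ℕ.z≤n))) (0≤-difference h))
      (solve 2 (λ x y → y := x :+ con ½ :* (y :+ y :+ :- (x :+ x))) refl x y)

    product≤squares : ∀ x y → x * y + x * y ≤ x * x + y * y
    product≤squares x y = ≤-by-difference ((x + - y) * (x + - y)) (square-nonneg _)
      (solve 2 (λ x y → x :* x :+ y :* y := x :* y :+ x :* y :+ (x :+ :- y) :* (x :+ :- y)) refl x y)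

    coefficient-bound : ∀ {N L Q μ μ′ ν} → Q + - μ′ ≤ (Q + Q) * L → μ′ ≤ μ → μ + ν ≤ Q →
      0# ≤ ν → 0# ≤ Q → nat 8 * (N * L) ≤ nat 1 → nat 1 ≤ N → nat 3 * (N * ν) ≤ μ
    coefficient-bound {N} {L} {Q} {μ} {μ′} {ν} h₁ h₂ h₃ 0≤ν 0≤Q h₄ h₅ = ≤-by-difference
      (nat 3 * N * d₃ + nat 4 * N * d₁ + Q * d₄ + nat 4 * N * d₂ + (d₃ + ν) * d₅)
      (+-nonneg (+-nonneg (+-nonneg (+-nonneg
        (*-nonneg (*-nonneg (nat-nonneg 3) 0≤N) (0≤-difference h₃))
        (*-nonneg (*-nonneg (nat-nonneg 4) 0≤N) (0≤-difference h₁)))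
        (*-nonneg 0≤Q (0≤-difference h₄)))
        (*-nonneg (*-nonneg (nat-nonneg 4) 0≤N) (0≤-difference h₂)))
        (*-nonneg (+-nonneg (0≤-difference h₃) 0≤ν) (0≤-difference h₅)))
      (solve 6 (λ N L Q μ μ′ ν → μ := con′ 3 :* (N :* ν) :+
        (con′ 3 :* N :* (Q :+ :- (μ :+ ν)) :+ con′ 4 :* N :* ((Q :+ Q) :* L :+ :- (Q :+ :- μ′))
          :+ Q :* (con′ 1 :+ :- (con′ 8 :* (N :* L))) :+ con′ 4 :* N :* (μ :+ :- μ′)
          :+ (Q :+ :- (μ :+ ν) :+ ν) :* (N :+ :- con′ 1))) refl N L Q μ μ′ ν)
      where
      con′ : ∀ {m} → ℕ → Polynomial m
      con′ k = con (Data.Integer.Base.+ k ℚ./ 1)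
      0≤N = ≤-trans (nat-nonneg 1) h₅
      d₁ = (Q + Q) * L + - (Q + - μ′)
      d₂ = μ + - μ′
      d₃ = Q + - (μ + ν)
      d₄ = nat 1 + - (nat 8 * (N * L))
      d₅ = N + - nat 1

    density-zero : ∀ {N μ} → nat 3 * N * μ ≤ μ * N + nat 3 * N * (μ * μ) → μ + μ ≤ nat 1 → nat 1 ≤ N → 0# ≤ μ → μ ≤ 0#
    density-zero {N} {μ} h₁ h₂ h₅ 0≤μ = ≤-by-difference
      (d₁ + d₁ + nat 3 * N * μ * d₂ + μ * d₅)
      (+-nonneg (+-nonneg (+-nonneg (0≤-difference h₁) (0≤-difference h₁))
        (*-nonneg (*-nonneg (*-nonneg (nat-nonneg 3) (≤-trans (nat-nonneg 1) h₅)) 0≤μ) (0≤-difference h₂)))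
        (*-nonneg 0≤μ (0≤-difference h₅)))
      (trans (sym ι-0) (solve 2 (λ N μ → con 0ℚ := μ :+
        ((μ :* N :+ con′ 3 :* N :* (μ :* μ) :+ :- (con′ 3 :* N :* μ)) :+ (μ :* N :+ con′ 3 :* N :* (μ :* μ) :+ :- (con′ 3 :* N :* μ))
          :+ con′ 3 :* N :* μ :* (con′ 1 :+ :- (μ :+ μ)) :+ μ :* (N :+ :- con′ 1))) refl N μ))
      where
      con′ : ∀ {m} → ℕ → Polynomial m
      con′ k = con (Data.Integer.Base.+ k ℚ./ 1)
      d₁ = μ * N + nat 3 * N * (μ * μ) + - (nat 3 * N * μ)
      d₂ = nat 1 + - (μ + μ)
      d₅ = N + - nat 1

  module Shrinking {F : RealField} (C : ComplexField F) (p n : ℕ) .{{_ : NonZero p}}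
    (p-prime : Prime p) (root : RootOfUnity C p) where
    open FourierAnalysis C p n p-prime root public
    open R using (_≤_)
    open Inequalities F
    private module N = NaturalsInField F

    module _ (γ u : V) (γu≡1 : ⟨ γ , u ⟩ ≡ [ 1 ]) where
      open Projection γ u γu≡1

      projection : Fin p → Substitution
      projection c = record
        { τ = project c ; P = adjoint ; φ = λ α → c ⊗ ⟨ α , u ⟩ ; ⟨⟩-τ = ⟨⟩-project c }

    record Idempotent (b : V → Carrier) : Set where
      field
        real-valued : ∀ x → conj (b x) ≈ b x
        idempotent  : ∀ x → b x * b x ≈ b x

    module _ {b : V → Carrier} (b-idempotent : Idempotent b) where
      open Idempotent b-idempotent

      private
        N = norm b
        μ = energy b
        ν : V → R.Carrier
        ν α = ∣ fourier b α ∣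

      real-energy : ∀ τ → real (energy (b ∘ τ)) ≈ fourier (b ∘ τ) 0ᵥ
      real-energy τ = energy-idempotent (real-valued ∘ τ) (idempotent ∘ τ)

      μ-nonneg : R.0# ≤ μ
      μ-nonneg = ΣO.∑-nonneg λ α → R.square-nonneg (ν α)

      ν-0 : ν 0ᵥ R.≈ μ
      ν-0 = R.trans (∣∣-cong (sym (energy-idempotent real-valued idempotent))) (∣∣-real μ-nonneg)

      ν-convolution : ∀ α → ν α ≤ ΣR.∑ λ β → ν β R.* ν (α -ᵥ β)
      ν-convolution α = R.≤-respˡ (∣∣-cong (trans (sym (fourier-* b b α)) (fourier-cong idempotent α)))
        (R.≤-respʳ (ΣR.∑-cong λ β → ∣∣-* _ _) (∑-triangle _))

      energy-zero : μ ≤ R.0# → ∀ x → b x ≈ 0#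
      energy-zero μ≤0 x = ∣∣-zero (R.≤-trans (value≤norm b x) (R.≤-reflexive (ΣR.∑-zero λ α →
        R.square-zero (R.≤-trans (ΣO.term≤∑ _≟ᵥ_ {λ α → ν α R.* ν α} (λ α → R.square-nonneg (ν α)) α) μ≤0))))

      module _ (γ u : V) (γu≡1 : ⟨ γ , u ⟩ ≡ [ 1 ]) where
        open Projection γ u γu≡1

        private
          a : V → R.Carrier
          a = fibre-norm (projection γ u γu≡1 [ 0 ]) b
          Q = ΣR.∑ λ β → a β R.* a β

        fibre-convolution : ∀ β → a β ≤ ΣR.∑ λ β′ → a β′ R.* a (β -ᵥ β′)
        fibre-convolution β = begin
          ΣR.∑ (λ α → ΣR.when (adjoint α ≟ᵥ β) (ν α))
            ≲⟨ ΣO.∑-mono (λ α → R.≤-trans (ΣO.when-mono (adjoint α ≟ᵥ β) (ν-convolution α))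
                 (R.≤-reflexive (when-∑ (adjoint α ≟ᵥ β) λ α′ → ν α′ R.* ν (α -ᵥ α′)))) ⟩
          ΣR.∑ (λ α → ΣR.∑ λ α′ → ΣR.when (adjoint α ≟ᵥ β) (ν α′ R.* ν (α -ᵥ α′)))
            ≈⟨ ΣR.∑-swap (λ α α′ → ΣR.when (adjoint α ≟ᵥ β) (ν α′ R.* ν (α -ᵥ α′))) ⟩
          ΣR.∑ (λ α′ → ΣR.∑ λ α → ΣR.when (adjoint α ≟ᵥ β) (ν α′ R.* ν (α -ᵥ α′)))
            ≈⟨ ΣR.∑-cong (λ α′ → shift α′) ⟩
          ΣR.∑ (λ α′ → ν α′ R.* a (β -ᵥ adjoint α′))
            ≈⟨ ΣR.∑-fibres _≟ᵥ_ adjoint (λ α′ β′ → ν α′ R.* a (β -ᵥ β′)) ⟨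
          ΣR.∑ (λ β′ → ΣR.∑ λ α′ → ΣR.when (adjoint α′ ≟ᵥ β′) (ν α′ R.* a (β -ᵥ β′)))
            ≈⟨ ΣR.∑-cong (λ β′ → R.trans (ΣR.∑-cong λ α′ → R.trans
                 (ΣR.when-cong (adjoint α′ ≟ᵥ β′) λ _ → R.*-comm _ _) (R.sym (ΣR.*-when (adjoint α′ ≟ᵥ β′) _ _)))
                 (R.trans (ΣR.∑-*ˡ (a (β -ᵥ β′)) _) (R.*-comm _ _))) ⟩
          ΣR.∑ (λ β′ → a β′ R.* a (β -ᵥ β′)) ∎
          where
          open R.≤-Reasoning
          when-∑ : ∀ {A} (d : Dec A) h → ΣR.when d (ΣR.∑ h) R.≈ ΣR.∑ (λ α → ΣR.when d (h α))
          when-∑ (yes _) h = R.refl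
          when-∑ (no _)  h = R.sym (ΣR.∑-zero λ _ → R.refl)
          shift : ∀ α′ → ΣR.∑ (λ α → ΣR.when (adjoint α ≟ᵥ β) (ν α′ R.* ν (α -ᵥ α′))) R.≈ ν α′ R.* a (β -ᵥ adjoint α′)
          shift α′ = R.trans
            (R.sym (ΣR.∑-bijection _≟ᵥ_ (_+ᵥ α′) (_-ᵥ α′) (λ x → +ᵥ-cancel x α′) (λ x → -ᵥ-cancel x α′)
              (λ α → ΣR.when (adjoint α ≟ᵥ β) (ν α′ R.* ν (α -ᵥ α′)))))
            (R.trans (ΣR.∑-cong λ α → R.trans
                (ΣR.when-cong (adjoint (α +ᵥ α′) ≟ᵥ β) λ _ → R.*-congˡ (R.reflexive (≡.cong ν (-ᵥ-cancel α α′))))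
                (R.trans (ΣR.when-⇔ (adjoint (α +ᵥ α′) ≟ᵥ β) (adjoint α ≟ᵥ β -ᵥ adjoint α′) (to α) (from α))
                  (R.sym (ΣR.*-when (adjoint α ≟ᵥ β -ᵥ adjoint α′) (ν α′) (ν α)))))
              (ΣR.∑-*ˡ (ν α′) _))
            where
            to : ∀ α → adjoint (α +ᵥ α′) ≡ β → adjoint α ≡ β -ᵥ adjoint α′
            to α e = ≡.trans (≡.sym (-ᵥ-cancel (adjoint α) (adjoint α′)))
              (≡.cong (_-ᵥ adjoint α′) (≡.trans (≡.sym (adjoint-+ α α′)) e))
            from : ∀ α → adjoint α ≡ β -ᵥ adjoint α′ → adjoint (α +ᵥ α′) ≡ β
            from α e = ≡.trans (adjoint-+ α α′) (≡.trans (≡.cong (_+ᵥ adjoint α′) e) (+ᵥ-cancel β (adjoint α′)))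

        fibre≤Q : ∀ β → a β ≤ Q
        fibre≤Q β = double-cancel (begin
          a β R.+ a β ≲⟨ R.+-mono-≤ (fibre-convolution β) (fibre-convolution β) ⟩
          ΣR.∑ (λ β′ → a β′ R.* a (β -ᵥ β′)) R.+ ΣR.∑ (λ β′ → a β′ R.* a (β -ᵥ β′))
            ≈⟨ ΣR.∑-+ (λ β′ → a β′ R.* a (β -ᵥ β′)) (λ β′ → a β′ R.* a (β -ᵥ β′)) ⟨
          ΣR.∑ (λ β′ → a β′ R.* a (β -ᵥ β′) R.+ a β′ R.* a (β -ᵥ β′))
            ≲⟨ ΣO.∑-mono (λ β′ → product≤squares (a β′) (a (β -ᵥ β′))) ⟩
          ΣR.∑ (λ β′ → a β′ R.* a β′ R.+ a (β -ᵥ β′) R.* a (β -ᵥ β′))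
            ≈⟨ ΣR.∑-+ (λ β′ → a β′ R.* a β′) (λ β′ → a (β -ᵥ β′) R.* a (β -ᵥ β′)) ⟩
          Q R.+ ΣR.∑ (λ β′ → a (β -ᵥ β′) R.* a (β -ᵥ β′))
            ≈⟨ R.+-congˡ (ΣR.∑-bijection _≟ᵥ_ (β -ᵥ_) (β -ᵥ_) reflect reflect (λ β → a β R.* a β)) ⟩
          Q R.+ Q ∎)
          where
          open R.≤-Reasoning
          reflect : ∀ x → β -ᵥ (β -ᵥ x) ≡ x
          reflect x = ≡.trans (≡.cong (β +ᵥ_) (≡.trans (≡.sym (V.⁻¹-∙-comm β (⊝ x))) (≡.cong (⊝ β +ᵥ_) (V.⁻¹-involutive x))))
            (≡.trans (≡.sym (V.assoc β (⊝ β) x)) (≡.trans (≡.cong (_+ᵥ x) (V.inverseʳ β)) (V.identityˡ x)))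

        norm-loss : ∀ c → Q R.+ R.- energy (b ∘ project c) ≤ (Q R.+ Q) R.* (N R.+ R.- norm (b ∘ project c))
        norm-loss c = begin
          Q R.+ R.- energy (b ∘ project c) ≈⟨ ∑-difference (λ β → a β R.* a β) (λ β → g β R.* g β) ⟨
          ΣR.∑ (λ β → a β R.* a β R.+ R.- (g β R.* g β))
            ≲⟨ ΣO.∑-mono (λ β → square-difference (∣∣-nonneg _) (fourier-∘-≤ (projection γ u γu≡1 c) b β) (fibre≤Q β)) ⟩
          ΣR.∑ (λ β → (Q R.+ Q) R.* (a β R.+ R.- g β)) ≈⟨ ΣR.∑-*ˡ (Q R.+ Q) (λ β → a β R.+ R.- g β) ⟩
          (Q R.+ Q) R.* ΣR.∑ (λ β → a β R.+ R.- g β)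
            ≈⟨ R.*-congˡ (R.trans (∑-difference a g) (R.+-congʳ (∑-fibre-norm (projection γ u γu≡1 c) b))) ⟩
          (Q R.+ Q) R.* (N R.+ R.- norm (b ∘ project c)) ∎
          where
          open R.≤-Reasoning
          g : V → R.Carrier
          g β = ∣ fourier (b ∘ project c) β ∣
          ∑-difference : ∀ h k → ΣR.∑ (λ β → h β R.+ R.- k β) R.≈ ΣR.∑ h R.+ R.- ΣR.∑ k
          ∑-difference h k = R.trans (ΣR.∑-+ h (λ β → R.- k β)) (R.+-congˡ (R.trans
            (ΣR.∑-cong λ β → solveR 1 (λ x → ⊟ x ⊜ conR (ℚ.- 1ℚ) ⊠ x) R.refl (k β))
            (R.trans (ΣR.∑-*ˡ _ k) (solveR 1 (λ x → conR (ℚ.- 1ℚ) ⊠ x ⊜ ⊟ x) R.refl _))))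

        μ+ν≤Q : γ ≢ 0ᵥ → μ R.+ ν γ ≤ Q
        μ+ν≤Q γ≢0 = R.≤-trans (R.≤-respˡ
          (R.+-cong (R.trans (ΣR.when-yes (adjoint 0ᵥ ≟ᵥ 0ᵥ) adjoint-0) ν-0) (ΣR.when-yes (adjoint γ ≟ᵥ 0ᵥ) adjoint-γ))
          (ΣO.two-terms≤∑ _≟ᵥ_ (λ α → ΣO.when-nonneg (adjoint α ≟ᵥ 0ᵥ) (∣∣-nonneg _)) (γ≢0 ∘ ≡.sym)))
          (fibre≤Q 0ᵥ)

        sum-energies : ΣR.sum (λ c → energy (b ∘ project c)) R.≈ R.nat p R.* μ
        sum-energies = real-injective (begin
          real (ΣR.sum (λ c → energy (b ∘ project c))) ≈⟨ sum-real (λ c → energy (b ∘ project c)) ⟩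
          sum (λ c → real (energy (b ∘ project c)))
            ≈⟨ sum-cong-≋ (λ c → trans (real-energy (project c)) (fourier-∘ (projection γ u γu≡1 c) b 0ᵥ)) ⟩
          sum (λ c → ∑ λ α → when (adjoint α ≟ᵥ 0ᵥ) (fourier b α * e (c ⊗ ⟨ α , u ⟩)))
            ≈⟨ ∑-sum-swap (λ α c → when (adjoint α ≟ᵥ 0ᵥ) (fourier b α * e (c ⊗ ⟨ α , u ⟩))) ⟨
          ∑ (λ α → sum λ c → when (adjoint α ≟ᵥ 0ᵥ) (fourier b α * e (c ⊗ ⟨ α , u ⟩)))
            ≈⟨ ∑-single 0ᵥ vanish ⟩
          sum (λ c → when (adjoint 0ᵥ ≟ᵥ 0ᵥ) (fourier b 0ᵥ * e (c ⊗ ⟨ 0ᵥ , u ⟩)))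
            ≈⟨ sum-cong-≋ (λ c → trans (when-yes (adjoint 0ᵥ ≟ᵥ 0ᵥ) adjoint-0) (trans (*-congˡ (trans
                 (reflexive (≡.cong e (≡.trans (≡.cong (c ⊗_) (⟨⟩-0ˡ u)) (Zₚ.zeroʳ c)))) e-0)) (*-identityʳ _))) ⟩
          sum {p} (λ _ → fourier b 0ᵥ) ≈⟨ sum-const p (fourier b 0ᵥ) ⟩
          nat p * fourier b 0ᵥ ≈⟨ *-cong (real-ι _) (energy-idempotent real-valued idempotent) ⟨
          real (R.nat p) * real μ ≈⟨ real-* _ _ ⟨
          real (R.nat p R.* μ) ∎)
          where
          open import Relation.Binary.Reasoning.Setoid setoid
          vanish : ∀ α → α ≢ 0ᵥ → sum (λ c → when (adjoint α ≟ᵥ 0ᵥ) (fourier b α * e (c ⊗ ⟨ α , u ⟩))) ≈ 0#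
          vanish α α≢0 with adjoint α ≟ᵥ 0ᵥ
          ... | no _ = sum-zero {p} {λ _ → 0#} λ _ → refl
          ... | yes Pα≡0 = trans (sym (*-distribˡ-sum (fourier b α) (λ c → e (c ⊗ ⟨ α , u ⟩))))
                  (trans (*-congˡ (sum-e λ αu≡0 → α≢0 (adjoint-kernel Pα≡0 αu≡0))) (zeroʳ _))

        low-energy-value : ¬ ¬ (∃[ c ] energy (b ∘ project c) ≤ μ)
        low-energy-value none = none ([ 0 ] , R.≤-resp
          (solveR 2 (λ x y → x ⊞ ⊟ y ⊞ y ⊜ x) R.refl _ _) (R.+-identityˡ μ)
          (R.+-mono-≤ (ΣO.≤0-term (λ c → R.0≤-difference (μ≤ c)) (R.≤-reflexive total) [ 0 ]) (R.≤-refl {μ})))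
          where
          μ≤ : ∀ c → μ ≤ energy (b ∘ project c)
          μ≤ c = R.≤-stable λ ¬h → R.≤-total (energy (b ∘ project c)) μ [ (λ h → none (c , h)) , ¬h ]′
          total : ΣR.sum (λ c → energy (b ∘ project c) R.+ R.- μ) R.≈ R.0#
          total = R.trans (∑-distrib-+ (λ c → energy (b ∘ project c)) (λ _ → R.- μ))
            (R.trans (R.+-cong sum-energies (sum-constR p (R.- μ)))
              (R.trans (R.sym (R.distribˡ (R.nat p) μ (R.- μ))) (R.trans (R.*-congˡ (R.-‿inverseʳ μ)) (R.zeroʳ _))))
            where
            open import Algebra.Properties.Semiring.Sum R.semiring using (∑-distrib-+)
            sum-constR : ∀ m c → ΣR.sum {m} (λ _ → c) R.≈ R.nat m R.* c
            sum-constR zero    c = R.sym (R.trans (R.*-congʳ R.nat-0) (R.zeroˡ c))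
            sum-constR (suc m) c = R.trans (R.+-congˡ (sum-constR m c)) (R.sym (R.trans (R.*-congʳ (R.nat-suc m))
              (R.trans (R.distribʳ c (R.nat m) R.1#) (R.trans (R.+-comm _ _) (R.+-congʳ (R.*-identityˡ c))))))

      record Shrinks : Set where
        field
          γ u     : V
          γu≡1    : ⟨ γ , u ⟩ ≡ [ 1 ]
          c       : Fin p
        open Projection γ u γu≡1
        field
          energy≤ : energy (b ∘ project c) ≤ μ
          norm≤   : R.nat 1 ≤ R.nat 8 R.* (N R.* (N R.+ R.- norm (b ∘ project c)))

      shrinking : ∀ {x} → b x ≈ 1# → μ R.+ μ ≤ R.nat 1 → ¬ ¬ Shrinks
      shrinking {x} bx≈1 2μ≤1 none = N.¬1≤0 (R.≤-resp ∣1∣ ∣0∣ (R.≤-reflexive (∣∣-cong (trans (sym bx≈1)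
        (energy-zero (density-zero sum-bound 2μ≤1 1≤N μ-nonneg) x)))))
        where
        1≤N : R.nat 1 ≤ N
        1≤N = R.≤-respˡ (R.trans (R.trans (∣∣-cong bx≈1) ∣1∣) (R.sym R.nat-1)) (value≤norm b x)
        3Nν≤μ : ∀ γ → γ ≢ 0ᵥ → R.nat 3 R.* (N R.* ν γ) ≤ μ
        3Nν≤μ γ γ≢0 =
          let u , γu≡1 = dual-vector p-prime γ≢0
          in R.≤-stable λ ¬h → low-energy-value γ u γu≡1 λ (c , energy≤) → ¬h (coefficient-bound
               (norm-loss γ u γu≡1 c) energy≤ (μ+ν≤Q γ u γu≡1 γ≢0) (∣∣-nonneg _)
               (ΣO.∑-nonneg λ β → R.square-nonneg _)
               (R.≤-stable λ ¬k → R.≤-total (R.nat 1) _ [ (λ norm≤ → none record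
                 { γ = γ ; u = u ; γu≡1 = γu≡1 ; c = c ; energy≤ = energy≤ ; norm≤ = norm≤ }) , ¬k ]′) 1≤N)
        3N = R.nat 3 R.* N
        0≤3N = R.*-nonneg (R.nat-nonneg 3) (R.≤-trans (R.nat-nonneg 1) 1≤N)
        term : ∀ α (d : Dec (0ᵥ ≡ α)) → 3N R.* (ν α R.* ν α) ≤ μ R.* ν α R.+ ΣR.when d (3N R.* (μ R.* μ))
        term α (yes ≡.refl) = R.≤-by-difference (μ R.* ν 0ᵥ) (R.*-nonneg μ-nonneg (∣∣-nonneg _))
          (R.trans (R.+-congˡ (R.*-congˡ (R.*-cong (R.sym ν-0) (R.sym ν-0)))) (R.+-comm _ _))
        term α (no α≢0) = R.≤-resp (solveR 3 (λ t N v → t ⊠ (N ⊠ v) ⊠ v ⊜ t ⊠ N ⊠ (v ⊠ v)) R.refl (R.nat 3) N (ν α))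
          (R.sym (R.+-identityʳ _))
          (R.*-mono-≤ μ-nonneg (∣∣-nonneg _) (3Nν≤μ α (α≢0 ∘ ≡.sym)) R.≤-refl)
        sum-bound : 3N R.* μ ≤ μ R.* N R.+ 3N R.* (μ R.* μ)
        sum-bound = R.≤-resp (ΣR.∑-*ˡ 3N λ α → ν α R.* ν α)
          (R.trans (ΣR.∑-+ (λ α → μ R.* ν α) (λ α → ΣR.when (0ᵥ ≟ᵥ α) (3N R.* (μ R.* μ))))
            (R.+-cong (ΣR.∑-*ˡ μ ν) (ΣR.∑-when _≟ᵥ_ (λ _ → 3N R.* (μ R.* μ)) 0ᵥ)))
          (ΣO.∑-mono λ α → term α (0ᵥ ≟ᵥ α))

module Trees where

  open import Defs
  open Modular
  open import Data.Fin.Base using (Fin; zero; suc)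
  open import Data.Fin.Properties using (all?; any?; _≟_)
  import Data.Vec.Functional as Vector
  open ≡ using (_≡_)
  open import Relation.Nullary.Decidable using (_×-dec_; _→-dec_; _⊎-dec_; map′; decidable-stable)
  open import Relation.Unary using (Decidable)

  module _ {p : ℕ} where

    all-vectors? : ∀ {n} {P : ℤ^ p n → Set} → Decidable P → Dec (∀ x → P x)
    all-vectors? {zero}  P? = map′ (λ { h [] → h }) (λ h → h []) (P? [])
    all-vectors? {suc n} P? = map′ (λ { h (a ∷ x) → h a x }) (λ h a x → h (a ∷ x))
      (all? λ a → all-vectors? λ x → P? (a ∷ x))

    any-vector? : ∀ {n} {P : ℤ^ p n → Set} → Decidable P → Dec (∃[ x ] P x)
    any-vector? {zero}  P? = map′ ([] ,_) (λ { ([] , h) → h }) (P? [])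
    any-vector? {suc n} P? = map′ (λ (a , x , h) → a ∷ x , h) (λ { (a ∷ x , h) → a , x , h })
      (any? λ a → any-vector? λ x → P? (a ∷ x))

  any-sign? : ∀ {P : Sign → Set} → Decidable P → Dec (∃[ σ ] P σ)
  any-sign? P? = map′ (λ { (inj₁ h) → Sign.+ , h ; (inj₂ h) → Sign.- , h })
    (λ { (Sign.+ , h) → inj₁ h ; (Sign.- , h) → inj₂ h }) (P? Sign.+ ⊎-dec P? Sign.-)

  ⊔-lub : ∀ {m d} (g : Fin m → ℕ) → (∀ a → g a ℕ.≤ d) → Vector.foldr ℕ._⊔_ 0 g ℕ.≤ d
  ⊔-lub {zero}  g h = z≤n
  ⊔-lub {suc m} g h = ℕₚ.⊔-lub (h zero) (⊔-lub (g ∘ suc) (h ∘ suc))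

  ≤-⊔ : ∀ {m} (g : Fin m → ℕ) a → g a ℕ.≤ Vector.foldr ℕ._⊔_ 0 g
  ≤-⊔ {suc m} g zero    = ℕₚ.m≤m⊔n _ _
  ≤-⊔ {suc m} g (suc a) = ℕₚ.≤-trans (≤-⊔ (g ∘ suc) a) (ℕₚ.m≤n⊔m _ _)

  least : ∀ {P : ℕ → Set} → Decidable P → ∀ {m} → P m → ∃[ d ] P d × (∀ {k} → P k → d ℕ.≤ k)
  least {P} P? {m} Pm = search m zero (λ ()) (≡.subst P (≡.sym (ℕₚ.+-identityʳ m)) Pm)
    where
    search : ∀ m d → (∀ {k} → k ℕ.< d → ¬ P k) → P (m ℕ.+ d) → ∃[ d ] P d × (∀ {k} → P k → d ℕ.≤ k)
    search zero    d none Pd = d , Pd , λ Pk → ℕₚ.≮⇒≥ λ k<d → none k<d Pk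
    search (suc m) d none Pm+d with P? d
    ... | yes Pd = d , Pd , λ Pk → ℕₚ.≮⇒≥ λ k<d → none k<d Pk
    ... | no ¬Pd = search m (suc d) none′ (≡.subst P (≡.sym (ℕₚ.+-suc m d)) Pm+d)
      where
      none′ : ∀ {k} → k ℕ.< suc d → ¬ P k
      none′ {k} (s≤s k≤d) Pk with ℕₚ.m≤n⇒m<n∨m≡n k≤d
      ... | inj₁ k<d = none k<d Pk
      ... | inj₂ ≡.refl = ¬Pd Pk

  module _ {p n : ℕ} .{{_ : NonZero p}} where

    HasTreeOn : (ℤ^ p n → Set) → (ℤ^ p n → Sign) → ℕ → Set
    HasTreeOn S f d = ∃[ T ] depth T ℕ.≤ d × (∀ x → S x → eval T x ≡ f x)

    hasTreeOn? : ∀ {S} → Decidable S → ∀ f d → Dec (HasTreeOn S f d)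
    hasTreeOn? S? f zero = map′ (λ (σ , h) → leaf σ , z≤n , h) (λ { (leaf σ , _ , h) → σ , h ; (node _ _ , () , _) })
      (any-sign? λ σ → all-vectors? λ x → S? x →-dec (σ Signₚ.≟ f x))
    hasTreeOn? {S} S? f (suc d) = map′ from to
      (any-sign? (λ σ → all-vectors? λ x → S? x →-dec (σ Signₚ.≟ f x)) ⊎-dec
       any-vector? λ γ → all? λ a → hasTreeOn? (λ x → S? x ×-dec (⟨ γ , x ⟩ ≟ a)) f d)
      where
      Query = (∃[ σ ] ∀ x → S x → σ ≡ f x) ⊎ (∃[ γ ] ∀ a → HasTreeOn (λ x → S x × ⟨ γ , x ⟩ ≡ a) f d)
      from : Query → HasTreeOn S f (suc d)
      from (inj₁ (σ , h)) = leaf σ , z≤n , h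
      from (inj₂ (γ , h)) = node γ (λ a → proj₁ (h a)) , s≤s (⊔-lub _ λ a → proj₁ (proj₂ (h a))) ,
        λ x Sx → proj₂ (proj₂ (h ⟨ γ , x ⟩)) x (Sx , ≡.refl)
      to : HasTreeOn S f (suc d) → Query
      to (leaf σ , _ , h) = inj₁ (σ , h)
      to (node γ T , s≤s T≤d , h) = inj₂ (γ , λ a → T a , ℕₚ.≤-trans (≤-⊔ (λ a → depth (T a)) a) T≤d ,
        λ { x (Sx , ≡.refl) → h x Sx })

    HasTree : (ℤ^ p n → Sign) → ℕ → Set
    HasTree f d = ∃[ T ] depth T ℕ.≤ d × T Computes f

    hasTree? : ∀ f d → Dec (HasTree f d)
    hasTree? f d = map′ (λ (T , T≤d , h) → T , T≤d , λ x → h x x≡x) (λ (T , T≤d , h) → T , T≤d , λ x _ → h x)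
      (hasTreeOn? {λ x → x ≡ x} (λ x → yes ≡.refl) f d)
      where
      x≡x : ∀ {x : ℤ^ p n} → x ≡ x
      x≡x = ≡.refl

    hasTree-stable : ∀ {f d} → ¬ ¬ HasTree f d → HasTree f d
    hasTree-stable {f} {d} = decidable-stable (hasTree? f d)

    hasTree-mono : ∀ {f d d′} → d ℕ.≤ d′ → HasTree f d → HasTree f d′
    hasTree-mono d≤d′ (T , T≤d , h) = T , ℕₚ.≤-trans T≤d d≤d′ , h

    hasTree-constant : ∀ {f σ} → (∀ x → f x ≡ σ) → HasTree f 0
    hasTree-constant {σ = σ} h = leaf σ , z≤n , λ x → ≡.sym (h x)

    open Arithmetic p
    open Vectors

    hasTree-query : ∀ {γ u : ℤ^ p n} (γu≡1 : ⟨ γ , u ⟩ ≡ [ 1 ]) {f d} →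
      (∀ c → HasTree (f ∘ Projection.project γ u γu≡1 c) d) → HasTree f (suc d)
    hasTree-query {γ} {u} γu≡1 {f} h = node γ (λ c → proj₁ (h c)) , s≤s (⊔-lub _ λ c → proj₁ (proj₂ (h c))) ,
      λ x → ≡.trans (proj₂ (proj₂ (h ⟨ γ , x ⟩)) x) (≡.cong f (Projection.project-fixes γ u γu≡1 ≡.refl))

    record Direction : Set where
      constructor direction
      field
        γ u  : ℤ^ p n
        γu≡1 : ⟨ γ , u ⟩ ≡ [ 1 ]

    module Path where
      open Direction

      -- The directions are queried in order; cs lists the answers.
      τ : (Γ : List Direction) → Vec (Fin p) (length Γ) → ℤ^ p n → ℤ^ p n
      τ []      []       x = x
      τ (s ∷ Γ) (c ∷ cs) x = Projection.project (γ s) (u s) (γu≡1 s) c (τ Γ cs x)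

      P : List Direction → ℤ^ p n → ℤ^ p n
      P []      α = α
      P (s ∷ Γ) α = P Γ (Projection.adjoint (γ s) (u s) (γu≡1 s) α)

      φ : (Γ : List Direction) → Vec (Fin p) (length Γ) → ℤ^ p n → Fin p
      φ []      []       α = [ 0 ]
      φ (s ∷ Γ) (c ∷ cs) α = φ Γ cs (Projection.adjoint (γ s) (u s) (γu≡1 s) α) ⊕ c ⊗ ⟨ α , u s ⟩

      ⟨⟩-τ : ∀ Γ cs α x → ⟨ α , τ Γ cs x ⟩ ≡ ⟨ P Γ α , x ⟩ ⊕ φ Γ cs α
      ⟨⟩-τ []      []       α x = ≡.sym (Zₚ.+-identityʳ ⟨ α , x ⟩)
      ⟨⟩-τ (s ∷ Γ) (c ∷ cs) α x = ≡.trans (⟨⟩-project c α (τ Γ cs x))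
        (≡.trans (≡.cong (_⊕ c ⊗ ⟨ α , u s ⟩) (⟨⟩-τ Γ cs (adjoint α) x))
          (Zₚ.+-assoc ⟨ P Γ (adjoint α) , x ⟩ (φ Γ cs (adjoint α)) (c ⊗ ⟨ α , u s ⟩)))
        where open Projection (γ s) (u s) (γu≡1 s)

      hasTree-path : ∀ Γ {f d} → (∀ cs → HasTree (f ∘ τ Γ cs) d) → HasTree f (length Γ ℕ.+ d)
      hasTree-path []      h = h []
      hasTree-path (s ∷ Γ) {f} h = hasTree-query {γ s} {u s} (γu≡1 s) {f} λ c →
        hasTree-path Γ {f ∘ Projection.project (γ s) (u s) (γu≡1 s) c} λ cs → h (c ∷ cs)

module Counting where

  open import Data.List.Base using (filter; map)
  open import Data.List.Membership.Propositional using (_∈_)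
  open import Data.List.Relation.Unary.All as All using (All; []; _∷_)
  open import Data.List.Relation.Unary.AllPairs using ([]; _∷_)
  open import Data.List.Relation.Unary.Any using (here; there)
  open import Data.List.Relation.Unary.Unique.Propositional using (Unique)
  open import Data.Nat.ListAction using (sum)
  open import Relation.Binary.Definitions using (DecidableEquality)
  open ≡ using (_≡_; _≢_)
  open import Relation.Nullary.Decidable using (¬?)

  module Fibres {A : Set} (_≟_ : DecidableEquality A) (P : A → A) where

    fibre : A → List A → List A
    fibre β = filter λ α → P α ≟ β

    outside : A → List A → List A
    outside β = filter λ α → ¬? (P α ≟ β)

    length-split : ∀ β S → length (fibre β S) ℕ.+ length (outside β S) ≡ length S
    length-split β []      = ≡.refl
    length-split β (α ∷ S) with P α ≟ β
    ... | yes _ = ≡.cong suc (length-split β S)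
    ... | no _  = ≡.trans (ℕₚ.+-suc _ _) (≡.cong suc (length-split β S))

    fibre-outside : ∀ {β β′} → β′ ≢ β → ∀ S → fibre β′ (outside β S) ≡ fibre β′ S
    fibre-outside β′≢β [] = ≡.refl
    fibre-outside {β} {β′} β′≢β (α ∷ S) with P α ≟ β
    ... | no _ with P α ≟ β′
    ...   | yes _ = ≡.cong (α ∷_) (fibre-outside β′≢β S)
    ...   | no _  = fibre-outside β′≢β S
    fibre-outside {β} {β′} β′≢β (α ∷ S) | yes Pα≡β with P α ≟ β′
    ...   | yes Pα≡β′ = ⊥-elim (β′≢β (≡.trans (≡.sym Pα≡β′) Pα≡β))
    ...   | no _      = fibre-outside β′≢β S

    weighted-count : ∀ (w : A → ℕ) {S′} → Unique S′ → ∀ S → (∀ {β} → β ∈ S′ → w β ℕ.≤ length (fibre β S)) →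
      sum (map w S′) ℕ.≤ length S
    weighted-count w []                    S h = z≤n
    weighted-count w {β ∷ S′} (β∉S′ ∷ uniq) S h = ≡.subst (w β ℕ.+ sum (map w S′) ℕ.≤_) (length-split β S)
      (ℕₚ.+-mono-≤ (h (here ≡.refl)) (weighted-count w uniq (outside β S) λ {β′} β′∈S′ →
        ≡.subst (λ L → w β′ ℕ.≤ length L) (≡.sym (fibre-outside (All.lookup β∉S′ β′∈S′ ∘ ≡.sym) S)) (h (there β′∈S′))))

    module _ (o : A) where

      weight : A → ℕ
      weight β with β ≟ o
      ... | yes _ = 1
      ... | no _  = 2

      weights-other : ∀ {S′} → All (o ≢_) S′ → length S′ ℕ.+ length S′ ≡ sum (map weight S′)
      weights-other []                     = ≡.refl
      weights-other {β ∷ S′} (o≢β ∷ o≢S′) with β ≟ o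
      ... | yes β≡o = ⊥-elim (o≢β (≡.sym β≡o))
      ... | no _    = ≡.cong suc (≡.trans (ℕₚ.+-suc _ _) (≡.cong suc (weights-other o≢S′)))

      weights : ∀ {S′} → Unique S′ → length S′ ℕ.+ length S′ ℕ.≤ suc (sum (map weight S′))
      weights []                       = z≤n
      weights {β ∷ S′} (β≢S′ ∷ uniq) with β ≟ o
      ... | yes ≡.refl = s≤s (ℕₚ.≤-reflexive (≡.trans (ℕₚ.+-suc _ _) (≡.cong suc (weights-other β≢S′))))
      ... | no _       = s≤s (ℕₚ.≤-trans (ℕₚ.≤-reflexive (ℕₚ.+-suc _ _)) (s≤s (weights uniq)))

      image-count : ∀ {S′ S} → Unique S′ → (∀ {β} → β ∈ S′ → 1 ℕ.≤ length (fibre β S)) →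
        (∀ {β} → β ∈ S′ → β ≢ o → 2 ℕ.≤ length (fibre β S)) → length S′ ℕ.+ length S′ ℕ.≤ suc (length S)
      image-count {S′} {S} uniq one two = ℕₚ.≤-trans (weights uniq) (s≤s (weighted-count weight uniq S bound))
        where
        bound : ∀ {β} → β ∈ S′ → weight β ℕ.≤ length (fibre β S)
        bound {β} β∈S′ with β ≟ o
        ... | yes _  = one β∈S′
        ... | no β≢o = two β∈S′ β≢o

module Sparsity where

  open import Defs using (ℤ^; ⟨_,_⟩; DecisionTree; depth; _Computes_)
  open Ordered
  open Series using (fromℕℚ)
  open ComplexExp
  open Logarithm using (module NaturalsInField)
  open Modular
  open Sums
  open Fourier
  open KeyLemma
  open Trees
  open Counting
  open import Data.Fin.Base using (zero; suc)
  open import Data.List.Relation.Unary.AllPairs using ([]; _∷_)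
  open ≡ using (_≡_; _≢_)
  open import Relation.Nullary.Decidable using (¬?; decidable-stable)

  module DecisionTrees {F : RealField} (C : ComplexField F) (p n : ℕ) .{{_ : NonZero p}}
    (p-prime : Prime p) (2<p : 2 ℕ.< p) (root : RootOfUnity C p) where
    open Shrinking C p n p-prime root
    open R using (_≤_)
    open Solver
    open NaturalsInField F using (nat-reflects-≤)

    sgn : Sign → Carrier
    sgn Sign.+ = 1#
    sgn Sign.- = - 1#

    ∣sgn∣ : ∀ σ → ∣ sgn σ ∣ R.≈ R.1#
    ∣sgn∣ Sign.+ = ∣1∣
    ∣sgn∣ Sign.- = R.trans (∣neg∣ 1#) ∣1∣

    1≉0 : ¬ 1# ≈ 0#
    1≉0 h = ω≉1 (trans (sym (*-identityʳ ω)) (trans (*-congˡ h) (trans (zeroʳ ω) (sym h))))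

    1≉-1 : ¬ 1# ≈ - 1#
    1≉-1 h = 1≉0 (trans (sym ι-1) (trans (solve 0 (con 1ℚ := con ½ :* (con 1ℚ :+ :- :- con 1ℚ)) refl)
      (trans (*-congˡ (+-cong ι-1 (-‿cong (trans (-‿cong ι-1) (sym h))))) (trans (*-congˡ (-‿inverseʳ 1#)) (zeroʳ _)))))

    transform : (V → Sign) → V → Carrier
    transform f = fourier (sgn ∘ f)

    1≤norm : ∀ f → R.nat 1 ≤ norm (sgn ∘ f)
    1≤norm f = R.≤-respˡ (R.trans (∣sgn∣ (f 0ᵥ)) (R.sym R.nat-1)) (value≤norm (sgn ∘ f) 0ᵥ)

    fourier-const : ∀ c α → fourier (λ _ → c) α ≈ when (0ᵥ ≟ᵥ α) c
    fourier-const c α = trans (𝔼-*ˡ c _) (trans (*-congˡ (trans (𝔼-cong λ x → trans (sym (*-identityˡ _))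
        (trans (*-congʳ (trans (sym e-0) (reflexive (≡.cong e (≡.sym (⟨⟩-0ˡ x)))))) (sym (e-⟨-⟩ 0ᵥ α x))))
      (𝔼-e 0ᵥ α))) (trans (*-when (0ᵥ ≟ᵥ α) c 1#) (when-cong (0ᵥ ≟ᵥ α) λ _ → *-identityʳ c)))

    fourier-linear : ∀ c d g h α → fourier (λ x → c * (g x + d * h x)) α ≈ c * (fourier g α + d * fourier h α)
    fourier-linear c d g h α = begin
      𝔼 (λ x → c * (g x + d * h x) * k x)
        ≈⟨ 𝔼-cong (λ x → solve 5 (λ c d g h k → c :* (g :+ d :* h) :* k := c :* (g :* k :+ d :* (h :* k))) refl c d (g x) (h x) (k x)) ⟩
      𝔼 (λ x → c * (g x * k x + d * (h x * k x))) ≈⟨ 𝔼-*ˡ c _ ⟩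
      c * 𝔼 (λ x → g x * k x + d * (h x * k x))
        ≈⟨ *-congˡ (trans (*-congˡ (∑-+ (λ x → g x * k x) (λ x → d * (h x * k x)))) (distribˡ _ _ _)) ⟩
      c * (fourier g α + 𝔼 (λ x → d * (h x * k x))) ≈⟨ *-congˡ (+-congˡ (𝔼-*ˡ d (λ x → h x * k x))) ⟩
      c * (fourier g α + d * fourier h α) ∎
      where
      open import Relation.Binary.Reasoning.Setoid setoid
      k : V → Carrier
      k x = conj (e ⟨ α , x ⟩)

    differs : Sign → Sign → Carrier
    differs Sign.+ Sign.+ = 0#
    differs Sign.+ Sign.- = 1#
    differs Sign.- Sign.+ = 1#
    differs Sign.- Sign.- = 0#

    differs-idempotent : ∀ σ (f : V → Sign) → Idempotent (differs σ ∘ f)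
    differs-idempotent σ f = record
      { real-valued = λ x → proj₁ (go σ (f x)) ; idempotent = λ x → proj₂ (go σ (f x)) }
      where
      go : ∀ σ τ → conj (differs σ τ) ≈ differs σ τ × differs σ τ * differs σ τ ≈ differs σ τ
      go Sign.+ Sign.+ = conj-0 , zeroˡ 0#
      go Sign.+ Sign.- = conj-1 , *-identityˡ 1#
      go Sign.- Sign.+ = conj-1 , *-identityˡ 1#
      go Sign.- Sign.- = conj-0 , zeroˡ 0#

    differs-≢ : ∀ {σ τ} → τ ≢ σ → differs σ τ ≈ 1#
    differs-≢ {Sign.+} {Sign.+} h = contradiction ≡.refl h
    differs-≢ {Sign.+} {Sign.-} h = refl
    differs-≢ {Sign.-} {Sign.+} h = refl
    differs-≢ {Sign.-} {Sign.-} h = contradiction ≡.refl h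

    differs-sgn : ∀ σ τ → differs σ τ ≈ ι ½ * (1# + - sgn σ * sgn τ)
    differs-sgn σ τ = trans (go σ τ) (*-congˡ (+-congˡ (sgn-* σ τ)))
      where
      half-zero : 0# ≈ ι ½ * (1# + - 1#)
      half-zero = sym (trans (*-congˡ (-‿inverseʳ 1#)) (zeroʳ _))
      half-two : 1# ≈ ι ½ * (1# + 1#)
      half-two = sym (trans (distribˡ _ _ _) (trans (+-cong (*-identityʳ _) (*-identityʳ _)) (trans (sym (ι-+ ½ ½)) ι-1)))
      product : Sign → Sign → Carrier
      product Sign.+ Sign.+ = - 1#
      product Sign.+ Sign.- = 1#
      product Sign.- Sign.+ = 1#
      product Sign.- Sign.- = - 1#
      go : ∀ σ τ → differs σ τ ≈ ι ½ * (1# + product σ τ)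
      go Sign.+ Sign.+ = half-zero
      go Sign.+ Sign.- = half-two
      go Sign.- Sign.+ = half-two
      go Sign.- Sign.- = half-zero
      sgn-* : ∀ σ τ → product σ τ ≈ - sgn σ * sgn τ
      sgn-* Sign.+ Sign.+ = sym (*-identityʳ _)
      sgn-* Sign.+ Sign.- = sym (trans (solve 1 (λ o → :- o :* :- o := o :* o) refl 1#) (*-identityʳ 1#))
      sgn-* Sign.- Sign.+ = sym (trans (*-identityʳ _) (solve 1 (λ o → :- :- o := o) refl 1#))
      sgn-* Sign.- Sign.- = sym (trans (solve 1 (λ o → :- :- o :* :- o := :- (o :* o)) refl 1#) (-‿cong (*-identityʳ 1#)))

    norm-differs : ∀ σ f → norm (differs σ ∘ f) ≤ norm (sgn ∘ f)
    norm-differs σ f = begin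
      norm (differs σ ∘ f) ≲⟨ ΣO.∑-mono bound ⟩
      ΣR.∑ (λ α → R.ι ½ R.* (ΣR.when (0ᵥ ≟ᵥ α) R.1# R.+ ∣ transform f α ∣))
        ≈⟨ R.trans (ΣR.∑-*ˡ (R.ι ½) _) (R.*-congˡ (R.trans (ΣR.∑-+ (λ α → ΣR.when (0ᵥ ≟ᵥ α) R.1#) (λ α → ∣ transform f α ∣))
             (R.+-congʳ (ΣR.∑-when _≟ᵥ_ (λ _ → R.1#) 0ᵥ)))) ⟩
      R.ι ½ R.* (R.1# R.+ A) ≲⟨ R.*-mono-≤ 0≤½ (R.+-nonneg R.0≤1 0≤A) R.≤-refl
          (R.+-mono-≤ (R.≤-respˡ R.nat-1 (1≤norm f)) R.≤-refl) ⟩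
      R.ι ½ R.* (A R.+ A) ≈⟨ solveR 1 (λ a → conR ½ ⊠ (a ⊞ a) ⊜ a) R.refl A ⟩
      A ∎
      where
      open R.≤-Reasoning
      A = norm (sgn ∘ f)
      0≤A = R.≤-trans (R.nat-nonneg 1) (1≤norm f)
      0≤½ = R.ι-nonneg (ℚₚ.nonNegative⁻¹ ½)
      bound : ∀ α → ∣ fourier (differs σ ∘ f) α ∣ ≤ R.ι ½ R.* (ΣR.when (0ᵥ ≟ᵥ α) R.1# R.+ ∣ transform f α ∣)
      bound α = R.≤-respˡ (∣∣-cong (sym (trans (fourier-cong (λ x → differs-sgn σ (f x)) α)
          (fourier-linear (ι ½) (- sgn σ) (λ _ → 1#) (sgn ∘ f) α))))
        (R.≤-respˡ (R.sym (∣∣-* _ _)) (R.*-mono-≤ 0≤½ (∣∣-nonneg _)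
          (R.≤-reflexive (∣ι∣ (ℚₚ.nonNegative⁻¹ ½)))
          (R.≤-trans (∣∣-triangle _ _) (R.+-mono-≤
            (R.≤-reflexive (R.trans (∣∣-cong (fourier-const 1# α)) (R.trans (∣when∣ (0ᵥ ≟ᵥ α) 1#)
              (ΣR.when-cong (0ᵥ ≟ᵥ α) λ _ → ∣1∣))))
            (R.≤-reflexive (R.trans (∣∣-* _ _) (R.trans (R.*-congʳ (R.trans (∣neg∣ _) (∣sgn∣ σ))) (R.*-identityˡ _))))))))

    minority : ∀ f → ¬ ¬ (∃[ σ ] energy (differs σ ∘ f) R.+ energy (differs σ ∘ f) ≤ R.nat 1)
    minority f none = R.≤-total (μ Sign.+) (μ Sign.-) [ (λ h → none (Sign.+ , R.≤-respʳ total (R.+-mono-≤ R.≤-refl h)))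
      , (λ h → none (Sign.- , R.≤-respʳ total (R.+-mono-≤ h R.≤-refl))) ]′
      where
      μ : Sign → R.Carrier
      μ σ = energy (differs σ ∘ f)
      covers : ∀ τ → differs Sign.+ τ + 1# * differs Sign.- τ ≈ 1#
      covers Sign.+ = trans (+-identityˡ _) (*-identityˡ 1#)
      covers Sign.- = trans (+-congˡ (zeroʳ 1#)) (+-identityʳ 1#)
      real-μ : ∀ σ → real (μ σ) ≈ fourier (differs σ ∘ f) 0ᵥ
      real-μ σ = energy-idempotent (Idempotent.real-valued (differs-idempotent σ f)) (Idempotent.idempotent (differs-idempotent σ f))
      total : μ Sign.+ R.+ μ Sign.- R.≈ R.nat 1
      total = real-injective (begin
        real (μ Sign.+ R.+ μ Sign.-) ≈⟨ trans (real-+ _ _) (+-cong (real-μ Sign.+) (real-μ Sign.-)) ⟩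
        fourier (differs Sign.+ ∘ f) 0ᵥ + fourier (differs Sign.- ∘ f) 0ᵥ
          ≈⟨ trans (*-identityˡ _) (+-congˡ (*-identityˡ _)) ⟨
        1# * (fourier (differs Sign.+ ∘ f) 0ᵥ + 1# * fourier (differs Sign.- ∘ f) 0ᵥ)
          ≈⟨ fourier-linear 1# 1# (differs Sign.+ ∘ f) (differs Sign.- ∘ f) 0ᵥ ⟨
        fourier (λ x → 1# * (differs Sign.+ (f x) + 1# * differs Sign.- (f x))) 0ᵥ
          ≈⟨ fourier-cong (λ x → trans (*-identityˡ _) (covers (f x))) 0ᵥ ⟩
        fourier (λ _ → 1#) 0ᵥ ≈⟨ trans (fourier-const 1# 0ᵥ) (when-yes (0ᵥ {n} ≟ᵥ 0ᵥ) ≡.refl) ⟩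
        1# ≈⟨ trans (real-cong R.nat-1) real-1 ⟨
        real (R.nat 1) ∎)
        where open import Relation.Binary.Reasoning.Setoid setoid

    Reaches : ℕ → (V → Sign) → Sign → Set
    Reaches k f σ = Σ (List (Direction {p} {n})) λ Γ → length Γ ℕ.≤ k × ∃[ cs ] (∀ x → f (Path.τ Γ cs x) ≡ σ)

    reaches-constant : ∀ {A} σ k f → norm (differs σ ∘ f) ≤ A →
      energy (differs σ ∘ f) R.+ energy (differs σ ∘ f) ≤ R.nat 1 →
      R.nat 8 R.* (A R.* norm (differs σ ∘ f)) ≤ R.nat k → ¬ ¬ Reaches k f σ
    reaches-constant {A} σ k f b≤A 2μ≤1 8Ab≤k none with any-vector? (λ x → ¬? (f x Signₚ.≟ σ))
    ... | no constant = none ([] , z≤n , [] , λ x → decidable-stable (f x Signₚ.≟ σ) λ h → constant (x , h))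
    ... | yes (x , fx≢σ) = shrinking b-idempotent bx≈1 2μ≤1 (step k 8Ab≤k none)
      where
      b = differs σ ∘ f
      b-idempotent = differs-idempotent σ f
      bx≈1 : b x ≈ 1#
      bx≈1 = differs-≢ fx≢σ
      0≤b : R.0# ≤ norm b
      0≤b = ΣO.∑-nonneg λ _ → ∣∣-nonneg _
      step : ∀ k → R.nat 8 R.* (A R.* norm b) ≤ R.nat k → ¬ Reaches k f σ → ¬ Shrinks b-idempotent
      step k 8Ab≤k none s = continue k none (R.≤-trans decrease (R.+-mono-≤ 8Ab≤k R.≤-refl))
        where
        open Shrinks s
        open Projection γ u γu≡1
        b′ = norm (b ∘ project c)
        b′≤b : b′ ≤ norm b
        b′≤b = norm-∘-≤ (projection γ u γu≡1 c) b
        decrease : R.nat 8 R.* (A R.* b′) ≤ R.nat 8 R.* (A R.* norm b) R.+ R.- R.nat 1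
        decrease = R.≤-by-difference _ (R.+-nonneg (R.0≤-difference norm≤)
            (R.*-nonneg (R.nat-nonneg 8) (R.*-nonneg (R.0≤-difference b≤A) (R.0≤-difference b′≤b))))
          (solveR 4 (λ A b b′ o → conR (fromℕℚ 8) ⊠ (A ⊠ b) ⊞ ⊟ o ⊜ conR (fromℕℚ 8) ⊠ (A ⊠ b′) ⊞
            (conR (fromℕℚ 8) ⊠ (b ⊠ (b ⊞ ⊟ b′)) ⊞ ⊟ o ⊞ conR (fromℕℚ 8) ⊠ ((A ⊞ ⊟ b) ⊠ (b ⊞ ⊟ b′)))) R.refl A (norm b) b′ (R.nat 1))
        continue : ∀ k → ¬ Reaches k f σ → R.nat 8 R.* (A R.* b′) ≤ R.nat k R.+ R.- R.nat 1 → ⊥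
        continue zero _ h = ℕₚ.1+n≰n (nat-reflects-≤ {1} {0} (R.≤-resp (R.+-identityˡ (R.nat 1))
          (solveR 2 (λ x y → x ⊞ ⊟ y ⊞ y ⊜ x) R.refl (R.nat 0) (R.nat 1))
          (R.+-mono-≤ (R.≤-trans (R.*-nonneg (R.nat-nonneg 8) (R.*-nonneg (R.≤-trans 0≤b b≤A)
            (ΣO.∑-nonneg λ _ → ∣∣-nonneg _))) h) (R.≤-refl {R.nat 1}))))
        continue (suc k) none h = reaches-constant σ k (f ∘ project c) (R.≤-trans b′≤b b≤A)
          (R.≤-trans (R.+-mono-≤ energy≤ energy≤) 2μ≤1)
          (R.≤-respʳ (R.trans (R.+-cong (R.nat-suc k) (R.-‿cong R.nat-1))
            (solveR 2 (λ k o → k ⊞ o ⊞ ⊟ o ⊜ k) R.refl (R.nat k) R.1#)) h)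
          λ (Γ , Γ≤k , cs , constant) → none (direction γ u γu≡1 ∷ Γ , s≤s Γ≤k , c ∷ cs , constant)

module Main where

  open import Defs using (ℤ^; ⟨_,_⟩; DecisionTree; depth; _Computes_)
  open Ordered
  open Series using (fromℕℚ; 1/!)
  open ComplexExp
  open Logarithm using (module LogarithmBounds; module NaturalsInField)
  open Modular
  open Sums
  open Fourier
  open KeyLemma
  open Trees
  open Counting
  open Sparsity
  open import Data.Fin.Base using (Fin; zero; suc; toℕ)
  open import Data.List.Membership.Propositional using (_∈_; _∉_)
  open import Data.List.Membership.Propositional.Properties using (∈-filter⁺; ∈-filter⁻)
  import Data.List.Membership.DecPropositional as DecMembership
  open import Data.List.Relation.Unary.All.Properties using (¬Any⇒All¬)
  open import Data.List.Relation.Unary.AllPairs using ([]; _∷_)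
  open import Data.List.Relation.Unary.Any using (here; there)
  open import Data.List.Relation.Unary.Unique.Propositional using (Unique)
  open import Data.Nat.DivMod using (m<n⇒m%n≡m)
  open import Function.Bundles using (Equivalence; _⇔_)
  open ≡ using (_≡_; _≢_)
  open import Relation.Nullary.Decidable using (decidable-stable; ¬¬-excluded-middle)

  module SpectralBound {F : RealField} (C : ComplexField F) (p n : ℕ) .{{_ : NonZero p}}
    (p-prime : Prime p) (2<p : 2 ℕ.< p) (root : RootOfUnity C p) where
    open Shrinking C p n p-prime root
    open DecisionTrees C p n p-prime 2<p root
    open R using (_≤_)
    open DecMembership (_≟ᵥ_ {n}) using (_∈?_)

    ≈0-stable : ∀ {z} → ¬ ¬ z ≈ 0# → z ≈ 0#
    ≈0-stable h = ∣∣-zero (R.≤-stable λ k → h λ z≈0 → k (R.≤-reflexive (R.trans (∣∣-cong z≈0) ∣0∣)))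

    *e-cancel : ∀ {z a} → z * e a ≈ 0# → z ≈ 0#
    *e-cancel {z} {a} h = trans (sym (*-identityʳ z)) (trans (*-congˡ (sym (e*conj a)))
      (trans (sym (*-assoc z (e a) (conj (e a)))) (trans (*-congʳ h) (zeroˡ _))))

    record Support (f : V → Sign) (S : List V) : Set where
      field
        unique  : Unique S
        nonzero : ∀ {α} → α ∈ S → ¬ transform f α ≈ 0#
        vanishing : ∀ {α} → α ∉ S → transform f α ≈ 0#

    at-most-one : ∀ {f} α₀ → (∀ α → α ≢ α₀ → transform f α ≈ 0#) → ∀ x → f x ≡ f 0ᵥ
    at-most-one {f} α₀ vanish x = decidable-stable (f x Signₚ.≟ f 0ᵥ) λ fx≢f0 →
      let ex≈-1 = opposite (f x) (f 0ᵥ) fx≢f0 sgn-x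
          2a≡0 = e-injective {a ⊕ a} (trans (e-⊕ a a) (trans (*-cong ex≈-1 ex≈-1)
            (trans (Solver.solve 1 (λ o → Solver.:- o Solver.:* Solver.:- o Solver.:= o Solver.:* o) refl 1#) (*-identityˡ 1#))))
      in 1≉-1 (trans (sym e-0) (trans (reflexive (≡.cong e (≡.sym (double-zero 2a≡0)))) ex≈-1))
      where
      a = ⟨ α₀ , x ⟩
      value : ∀ y → sgn (f y) ≈ transform f α₀ * e ⟨ α₀ , y ⟩
      value y = trans (inversion (sgn ∘ f) y)
        (∑-single α₀ λ α α≢ → trans (*-congʳ (vanish α α≢)) (zeroˡ _))
      sgn-x : sgn (f x) ≈ sgn (f 0ᵥ) * e a
      sgn-x = trans (value x) (*-congʳ (sym (trans (value 0ᵥ) (trans (*-congˡ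
        (trans (reflexive (≡.cong e (≡.trans (⟨⟩-comm α₀ 0ᵥ) (⟨⟩-0ˡ α₀)))) e-0)) (*-identityʳ _)))))
      opposite : ∀ σ τ → σ ≢ τ → ∀ {z} → sgn σ ≈ sgn τ * z → z ≈ - 1#
      opposite Sign.+ Sign.+ σ≢τ h = contradiction ≡.refl σ≢τ
      opposite Sign.+ Sign.- σ≢τ {z} h = trans (sym (trans (*-congʳ
        (Solver.solve 1 (λ o → Solver.:- o Solver.:* Solver.:- o Solver.:= o Solver.:* o) refl 1#)) (trans (*-congʳ (*-identityˡ 1#)) (*-identityˡ z))))
        (trans (*-assoc (- 1#) (- 1#) z) (trans (*-congˡ (sym h)) (*-identityʳ _)))
      opposite Sign.- Sign.+ σ≢τ {z} h = trans (sym (*-identityˡ z)) (sym h)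
      opposite Sign.- Sign.- σ≢τ h = contradiction ≡.refl σ≢τ
      double-zero : ∀ {a} → a ⊕ a ≡ [ 0 ] → a ≡ [ 0 ]
      double-zero {a} 2a≡0 =
        let b , 2b≡1 = inverse p-prime {[ 2 ]} λ 2≡0 → contradiction (≡.trans (≡.sym (m<n⇒m%n≡m 2<p))
              (≡.trans (≡.sym (toℕ-[] 2)) (≡.trans (≡.cong toℕ 2≡0) (≡.trans (toℕ-[] 0) (m<n⇒m%n≡m (ℕₚ.<-trans (s≤s z≤n) 2<p)))))) λ ()
        in begin
          a ≡⟨ Zₚ.*-identityʳ a ⟨
          a ⊗ [ 1 ] ≡⟨ ≡.cong (a ⊗_) 2b≡1 ⟨
          a ⊗ ([ 2 ] ⊗ b) ≡⟨ Zₚ.*-assoc a [ 2 ] b ⟨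
          a ⊗ [ 2 ] ⊗ b ≡⟨ ≡.cong (_⊗ b) (≡.trans (≡.cong (a ⊗_) ([]-+ 1 1))
            (≡.trans (Zₚ.distribˡ a [ 1 ] [ 1 ]) (≡.trans (≡.cong₂ _⊕_ (Zₚ.*-identityʳ a) (Zₚ.*-identityʳ a)) 2a≡0))) ⟩
          [ 0 ] ⊗ b ≡⟨ Zₚ.zeroˡ b ⟩
          [ 0 ] ∎
        where open ≡.≡-Reasoning

    small-support-constant : ∀ {f S} → Support f S → length S ℕ.≤ 1 → ∀ x → f x ≡ f 0ᵥ
    small-support-constant {S = []} supp _ = at-most-one 0ᵥ λ α _ → Support.vanishing supp {α} λ ()
    small-support-constant {S = α₀ ∷ []} supp _ =
      at-most-one α₀ λ α α≢α₀ → Support.vanishing supp λ { (here α≡α₀) → α≢α₀ α≡α₀ }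
    small-support-constant {S = _ ∷ _ ∷ _} supp (s≤s ())

    module Restriction (f : V → Sign) {S : List V} (supp : Support f S) (Γ : List (Direction {p} {n})) where
      open Support supp
      private module Γ = Path {p} {n}
      open Fibres (_≟ᵥ_ {n}) (Γ.P Γ)

      restricted : Vec (Fin p) (length Γ) → V → Sign
      restricted cs = f ∘ Γ.τ Γ cs

      coefficient : ∀ cs β → transform (restricted cs) β ≈
        ∑ λ α → when (Γ.P Γ α ≟ᵥ β) (transform f α * e (Γ.φ Γ cs α))
      coefficient cs = fourier-∘ (record { τ = Γ.τ Γ cs ; P = Γ.P Γ ; φ = Γ.φ Γ cs ; ⟨⟩-τ = Γ.⟨⟩-τ Γ cs }) (sgn ∘ f)

      norm-restricted : ∀ cs → norm (sgn ∘ restricted cs) ≤ norm (sgn ∘ f)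
      norm-restricted cs = norm-∘-≤ (record { τ = Γ.τ Γ cs ; P = Γ.P Γ ; φ = Γ.φ Γ cs ; ⟨⟩-τ = Γ.⟨⟩-τ Γ cs }) (sgn ∘ f)

      term-zero : ∀ cs β α → (α ∈ S → Γ.P Γ α ≢ β) → when (Γ.P Γ α ≟ᵥ β) (transform f α * e (Γ.φ Γ cs α)) ≈ 0#
      term-zero cs β α h with Γ.P Γ α ≟ᵥ β
      ... | no _ = refl
      ... | yes Pα≡β = trans (*-congʳ (vanishing λ α∈S → h α∈S Pα≡β)) (zeroˡ _)

      in-fibre : ∀ {β α} → α ∈ S → Γ.P Γ α ≡ β → α ∈ fibre β S
      in-fibre {β} = ∈-filter⁺ (λ α → Γ.P Γ α ≟ᵥ β)

      fibre-nonempty : ∀ cs {β} → ¬ transform (restricted cs) β ≈ 0# → 1 ℕ.≤ length (fibre β S)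
      fibre-nonempty cs {β} nz with fibre β S in eq
      ... | _ ∷ _ = s≤s z≤n
      ... | [] = contradiction (trans (coefficient cs β) (∑-zero λ α → term-zero cs β α λ α∈S Pα≡β →
            absurd (≡.subst (α ∈_) eq (in-fibre α∈S Pα≡β)))) nz
        where
        absurd : ∀ {α : V} → ¬ α ∈ []
        absurd ()

      -- A single coefficient over β could not cancel under the answers cs₀.
      fibre-≥2 : ∀ cs₀ {σ} → (∀ x → restricted cs₀ x ≡ σ) → ∀ cs {β} → β ≢ 0ᵥ →
        ¬ transform (restricted cs) β ≈ 0# → 2 ℕ.≤ length (fibre β S)
      fibre-≥2 cs₀ {σ} constant cs {β} β≢0 nz with fibre β S in eq | fibre-nonempty cs {β} nz
      ... | _ ∷ _ ∷ _ | _ = s≤s (s≤s z≤n)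
      ... | α₀ ∷ [] | _ = contradiction (*e-cancel (trans (sym (trans (coefficient cs₀ β)
              (trans (∑-single α₀ λ α α≢α₀ → term-zero cs₀ β α λ α∈S Pα≡β →
                  α≢α₀ (only (≡.subst (α ∈_) eq (in-fibre α∈S Pα≡β))))
                (when-yes (Γ.P Γ α₀ ≟ᵥ β) (proj₂ α₀∈)))))
            (trans (fourier-cong (λ x → reflexive (≡.cong sgn (constant x))) β)
              (trans (fourier-const (sgn σ) β) (when-no (0ᵥ ≟ᵥ β) (β≢0 ∘ ≡.sym))))))
          (nonzero (proj₁ α₀∈))
        where
        only : ∀ {α : V} → α ∈ α₀ ∷ [] → α ≡ α₀
        only (here e) = e
        α₀∈ : α₀ ∈ S × Γ.P Γ α₀ ≡ β
        α₀∈ = ∈-filter⁻ (λ α → Γ.P Γ α ≟ᵥ β) {xs = S} (≡.subst (α₀ ∈_) (≡.sym eq) (here ≡.refl))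

      image-support : ∀ cs (L : List V) → ¬ ¬ (∃[ S′ ] Unique S′ × (∀ {β} → β ∈ S′ → ¬ transform (restricted cs) β ≈ 0#) ×
        (∀ {α} → α ∈ L → Γ.P Γ α ∉ S′ → transform (restricted cs) (Γ.P Γ α) ≈ 0#))
      image-support cs [] none = none ([] , [] , (λ ()) , λ ())
      image-support cs (α ∷ L) none = image-support cs L λ (S′ , unique′ , nonzero′ , zero′) →
        ¬¬-excluded-middle λ where
          (yes z) → none (S′ , unique′ , nonzero′ , λ { (here ≡.refl) _ → z ; (there α∈L) → zero′ α∈L })
          (no nz) → decide S′ unique′ nonzero′ zero′ nz (Γ.P Γ α ∈? S′)
        where
        decide : ∀ S′ → Unique S′ → (∀ {β} → β ∈ S′ → ¬ transform (restricted cs) β ≈ 0#) →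
          (∀ {α} → α ∈ L → Γ.P Γ α ∉ S′ → transform (restricted cs) (Γ.P Γ α) ≈ 0#) →
          ¬ transform (restricted cs) (Γ.P Γ α) ≈ 0# → Dec (Γ.P Γ α ∈ S′) → ⊥
        decide S′ unique′ nonzero′ zero′ nz (yes Pα∈S′) = none (S′ , unique′ , nonzero′ ,
          λ { (here ≡.refl) Pα∉S′ → contradiction Pα∈S′ Pα∉S′ ; (there α∈L) → zero′ α∈L })
        decide S′ unique′ nonzero′ zero′ nz (no Pα∉S′) = none (Γ.P Γ α ∷ S′ , ¬Any⇒All¬ S′ Pα∉S′ ∷ unique′ ,
          (λ { (here ≡.refl) → nz ; (there β∈S′) → nonzero′ β∈S′ }) ,
          λ { (here ≡.refl) ∉ → contradiction (here ≡.refl) ∉ ; (there α∈L) ∉ → zero′ α∈L (∉ ∘ there) })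

      restricted-support : ∀ cs₀ {σ} → (∀ x → restricted cs₀ x ≡ σ) → ∀ cs →
        ¬ ¬ (∃[ S′ ] Support (restricted cs) S′ × length S′ ℕ.+ length S′ ℕ.≤ suc (length S))
      restricted-support cs₀ {σ} constant cs none = image-support cs S λ (S′ , unique′ , nonzero′ , zero′) →
        none (S′ , record
          { unique = unique′ ; nonzero = nonzero′
          ; vanishing = λ {β} β∉S′ → ≈0-stable λ nz → nz (trans (coefficient cs β) (∑-zero λ α →
              term-zero cs β α λ { α∈S ≡.refl → nz (zero′ α∈S β∉S′) })) }
          , image-count 0ᵥ {S′} {S} unique′ (λ {β} β∈S′ → fibre-nonempty cs {β} (nonzero′ β∈S′))
              (λ {β} β∈S′ β≢0 → fibre-≥2 cs₀ {σ} constant cs {β} β≢0 (nonzero′ β∈S′)))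

    halve : ∀ m j → m ℕ.+ m ℕ.≤ suc (2 ℕ.^ suc j) → m ℕ.≤ 2 ℕ.^ j
    halve m j h = ℕₚ.≮⇒≥ λ 2^j<m → ℕₚ.1+n≰n {suc (2 ℕ.^ suc j)} (ℕₚ.≤-trans
      (≡.subst (ℕ._≤ m ℕ.+ m) (≡.trans (≡.cong suc (ℕₚ.+-suc (2 ℕ.^ j) (2 ℕ.^ j)))
        (≡.cong (λ t → suc (suc (2 ℕ.^ j ℕ.+ t))) (≡.sym (ℕₚ.+-identityʳ (2 ℕ.^ j)))))
        (ℕₚ.+-mono-≤ 2^j<m 2^j<m)) h)

    phases : ∀ {A k} → R.nat 8 R.* (A R.* A) ≤ R.nat k → ∀ j f {S} → Support f S → length S ℕ.≤ 2 ℕ.^ j →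
      norm (sgn ∘ f) ≤ A → HasTree f (j ℕ.* k)
    phases 8A²≤k zero f supp S≤1 _ = hasTree-constant {f = f} (small-support-constant supp S≤1)
    phases {A} {k} 8A²≤k (suc j) f {S} supp S≤2^1+j f≤A = hasTree-stable λ no-tree →
      minority f λ (σ , 2μ≤1) → reaches-constant σ k f (b≤A σ) 2μ≤1
        (R.≤-trans (R.*-mono-≤ (R.nat-nonneg 8) (R.*-nonneg 0≤A (ΣO.∑-nonneg λ _ → ∣∣-nonneg _)) R.≤-refl
          (R.*-mono-≤ 0≤A (ΣO.∑-nonneg λ _ → ∣∣-nonneg _) R.≤-refl (b≤A σ))) 8A²≤k)
        λ (Γ , Γ≤k , cs₀ , constant) → no-tree (hasTree-mono (ℕₚ.+-monoˡ-≤ (j ℕ.* k) Γ≤k)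
          (Path.hasTree-path Γ {f} λ cs → hasTree-stable λ no-subtree →
            let open Restriction f supp Γ in
            restricted-support cs₀ {σ} constant cs λ (S′ , supp′ , 2S′≤) →
              no-subtree (phases {A} {k} 8A²≤k j (restricted cs) {S′} supp′ (halve (length S′) j (ℕₚ.≤-trans 2S′≤ (s≤s S≤2^1+j)))
                (R.≤-trans (norm-restricted cs) f≤A))))
      where
      b≤A : ∀ σ → norm (differs σ ∘ f) ≤ A
      b≤A σ = R.≤-trans (norm-differs σ f) f≤A
      0≤A : R.0# ≤ A
      0≤A = R.≤-trans (ΣO.∑-nonneg λ _ → ∣∣-nonneg _) f≤A

    logarithm-bounds : ∀ s → 1 ℕ.≤ s → ∃[ j ] s ℕ.≤ 2 ℕ.^ j × 2 ℕ.^ j ℕ.≤ s ℕ.* s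
    logarithm-bounds (suc zero) _ = 0 , s≤s z≤n , s≤s z≤n
    logarithm-bounds (suc s@(suc _)) _ =
      let j , s≤2^j , 2^j≤s² = logarithm-bounds s (s≤s z≤n) in extend j s≤2^j 2^j≤s² (suc s ℕₚ.≤? 2 ℕ.^ j)
      where
      extend : ∀ j → s ℕ.≤ 2 ℕ.^ j → 2 ℕ.^ j ℕ.≤ s ℕ.* s → Dec (suc s ℕ.≤ 2 ℕ.^ j) →
        ∃[ j ] suc s ℕ.≤ 2 ℕ.^ j × 2 ℕ.^ j ℕ.≤ suc s ℕ.* suc s
      extend j s≤ 2^j≤ (yes h) = j , h , ℕₚ.≤-trans 2^j≤ (ℕₚ.*-mono-≤ (ℕₚ.n≤1+n s) (ℕₚ.n≤1+n s))
      extend j s≤ 2^j≤ (no ¬h) = suc j ,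
        ℕₚ.≤-trans (ℕₚ.+-mono-≤ (ℕₚ.≤-trans (s≤s z≤n) s≤) s≤) (ℕₚ.+-monoʳ-≤ (2 ℕ.^ j) (ℕₚ.≤-reflexive (≡.sym (ℕₚ.+-identityʳ _)))) ,
        ℕₚ.*-mono-≤ {2} {suc s} (s≤s (s≤s z≤n)) (ℕₚ.≤-trans (ℕₚ.≤-pred (ℕₚ.≰⇒> ¬h)) (ℕₚ.n≤1+n s))

    rounding : ∀ {x} → R.0# ≤ x → ¬ ¬ (∃[ k ] x ≤ R.nat k × R.nat k ≤ x R.+ R.nat 1)
    rounding {x} 0≤x = let m , x≤m = R.upper-bound x in go m x≤m
      where
      go : ∀ m → x ≤ R.nat m → ¬ ¬ (∃[ k ] x ≤ R.nat k × R.nat k ≤ x R.+ R.nat 1)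
      go zero    x≤0 none = none (0 , x≤0 , R.≤-respˡ (R.sym R.nat-0) (R.+-nonneg 0≤x (R.nat-nonneg 1)))
      go (suc m) x≤m+1 none = R.≤-total x (R.nat m) [ (λ x≤m → go m x≤m none) ,
        (λ m≤x → none (suc m , x≤m+1 , R.≤-respˡ (R.sym (R.trans (R.nat-suc m) (R.+-congˡ (R.sym R.nat-1)))) (R.+-mono-≤ m≤x R.≤-refl))) ]′

    spectral-bound : ∀ f {A S ℓ} → norm (sgn ∘ f) R.≈ A → Support f S → ι (fromℕℚ (length S)) IsExp real ℓ →
      ∃[ T ] (T Computes f) × R.nat (depth T) ≤ R.nat 72 R.* (A R.* A) R.* ℓ
    spectral-bound f {A} {S} {ℓ} f≈A supp log =
      let j , S≤2^j , 2^j≤S² = logarithm-bounds (length S) 1≤S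
          m , 8A²≤m = R.upper-bound (R.nat 8 R.* (A R.* A))
          d , (T , T≤d , computes) , minimal = least (hasTree? f) (phases {A} {m} 8A²≤m j f {S} supp S≤2^j f≤A)
      in T , computes , R.≤-stable λ ¬bound → rounding 0≤8A² λ (k , 8A²≤k , k≤8A²+1) → ¬bound (begin
        R.nat (depth T) ≲⟨ R.nat-mono (ℕₚ.≤-trans T≤d (minimal (phases {A} {k} 8A²≤k j f {S} supp S≤2^j f≤A))) ⟩
        R.nat (j ℕ.* k) ≈⟨ R.nat-* j k ⟩
        R.nat j R.* R.nat k
          ≲⟨ R.*-mono-≤ (R.*-nonneg (R.nat-nonneg 8) (L.log-nonneg {ℓ} {length S} log 1≤S)) (R.nat-nonneg k)
               (L.log-lower-bound {ℓ} {length S} log j 1≤S 2^j≤S²) (R.≤-trans k≤8A²+1 (R.+-mono-≤ R.≤-refl 1≤A²)) ⟩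
        R.nat 8 R.* ℓ R.* (R.nat 8 R.* (A R.* A) R.+ A R.* A)
          ≈⟨ solveR 2 (λ A l → conR (fromℕℚ 8) ⊠ l ⊠ (conR (fromℕℚ 8) ⊠ (A ⊠ A) ⊞ A ⊠ A) ⊜ conR (fromℕℚ 72) ⊠ (A ⊠ A) ⊠ l) R.refl A ℓ ⟩
        R.nat 72 R.* (A R.* A) R.* ℓ ∎)
      where
      open R.≤-Reasoning
      module L = LogarithmBounds C
      f≤A : norm (sgn ∘ f) ≤ A
      f≤A = R.≤-reflexive f≈A
      1≤A : R.nat 1 ≤ A
      1≤A = R.≤-trans (1≤norm f) f≤A
      0≤A = R.≤-trans (R.nat-nonneg 1) 1≤A
      1≤A² : R.nat 1 ≤ A R.* A
      1≤A² = R.≤-respˡ (R.trans (R.*-congʳ R.nat-1) (R.*-identityˡ _)) (R.*-mono-≤ 0≤A (R.nat-nonneg 1) 1≤A 1≤A)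
      0≤8A² = R.*-nonneg (R.nat-nonneg 8) (R.*-nonneg 0≤A 0≤A)
      1≤S : 1 ℕ.≤ length S
      1≤S = nonempty S supp
        where
        nonempty : ∀ S → Support f S → 1 ℕ.≤ length S
        nonempty (_ ∷ _) _ = s≤s z≤n
        nonempty [] supp = contradiction (NaturalsInField.nat-reflects-≤ F {1} {0} (R.≤-respʳ (R.trans
            (ΣR.∑-zero λ α → R.trans (∣∣-cong (Support.vanishing supp {α} λ ())) ∣0∣) (R.sym R.nat-0)) (1≤norm f))) λ ()

    -- The Fourier transform is given in stages so that it can be instantiated without
    -- comparing large terms up to definitional equality.
    spectral-theorem : ∀ (f : V → Sign) {c sums : V → Carrier} {term : V → V → Carrier} {q : Carrier}
      {exps expTerms : ℕ → Carrier} {A S ℓ} →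
      (∀ α → c α ≈ q * sums α) → q ≈ ι 1/pⁿ → (∀ α → sums α ≈ ∑ (term α)) →
      (∀ α x → term α x ≈ sgn (f x) * conj (ω ^ toℕ ⟨ α , x ⟩)) →
      ΣR.∑ (λ α → ∣ c α ∣) R.≈ A → Unique S → (∀ α → α ∈ S ⇔ (¬ c α ≈ 0#)) →
      exps ⟶ ι (fromℕℚ (length S)) → (∀ m → exps m ≈ sum {m} λ i → expTerms (toℕ i)) →
      (∀ k → expTerms k ≈ ι (1/! k) * real ℓ ^ k) →
      ∃[ T ] (T Computes f) × R.nat (depth T) ≤ R.nat 72 R.* (A R.* A) R.* ℓ
    spectral-theorem f {c} {A = A} {S} {ℓ} c≈ q≈ sums≈ term≈ norm≈A unique S⇔ lim exps≈ expTerms≈ = spectral-bound f {A} {S} {ℓ}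
      (R.trans (ΣR.∑-cong λ α → ∣∣-cong (sym (c≈transform α))) norm≈A)
      record
        { unique = unique
        ; nonzero = λ {α} α∈S h → Equivalence.to (S⇔ α) α∈S (trans (c≈transform α) h)
        ; vanishing = λ {α} α∉S → ≈0-stable λ nz → α∉S (Equivalence.from (S⇔ α) λ h → nz (trans (sym (c≈transform α)) h)) }
      (⟶-cong (λ m → trans (exps≈ m) (sum-cong-≋ {m} λ i → expTerms≈ (toℕ i))) refl lim)
      where
      c≈transform : ∀ α → c α ≈ transform f α
      c≈transform α = trans (c≈ α) (*-cong q≈ (trans (sums≈ α) (∑-cong λ x → trans (term≈ α x)
        (*-congˡ (conj-cong (sym (e-def ⟨ α , x ⟩)))))))

open import Defs
open import Data.Nat.Base using (_≤_; _<_)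
open Reals using (≃ℝ-sym; ≃ℝ-trans; +ℝ-cong; always)
open Complex
open ComplexExp
open Roots
open Sums
open Fourier
open Main
open import Data.Fin.Base using (Fin; zero; suc)
open import Data.Integer.Base using (+_)
import Data.Rational.Base as ℚ
open import Relation.Nullary.Decidable using (from-yes)
open import Algebra.Bundles.Raw using (RawRing)
import Algebra.Definitions.RawMonoid as MonoidDefs
import Data.Sign.Base as Sign
open Sparsity

private
  module ℂₚ = ComplexFieldProperties ℂ-field

∑ℂ-cong : ∀ p n {f g : ℤ^ p n → ℂ} → (∀ x → f x ≃ℂ g x) → ∑ℂ f ≃ℂ VectorSums.∑ ℂₚ.semiring p g
∑ℂ-cong p zero            e = e []
∑ℂ-cong p (suc n) {f} {g} e = sumℂ-cong p
  {λ a → ∑ℂ λ x → f (a ∷ x)} {λ a → VectorSums.∑ ℂₚ.semiring p λ x → g (a ∷ x)}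
  λ a → ∑ℂ-cong p n {λ x → f (a ∷ x)} {λ x → g (a ∷ x)} λ x → e (a ∷ x)

sumℝ-cong : ∀ m {f g : Fin m → ℝ} → (∀ i → f i ≃ℝ g i) →
  MonoidDefs.sum (RawRing.+-rawMonoid ℝ-rawRing) f ≃ℝ ℂₚ.R.sum g
sumℝ-cong zero            e = ℂₚ.R.refl {0ℝ}
sumℝ-cong (suc m) {f} {g} e = +ℝ-cong {f zero} {g zero}
  {MonoidDefs.sum (RawRing.+-rawMonoid ℝ-rawRing) (λ i → f (suc i))} {ℂₚ.R.sum (λ i → g (suc i))}
  (e zero) (sumℝ-cong m (λ i → e (suc i)))

∑ℝ-cong : ∀ p n {f g : ℤ^ p n → ℝ} → (∀ x → f x ≃ℝ g x) → ∑ℝ f ≃ℝ VectorSums.∑ ℂₚ.R.semiring p g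
∑ℝ-cong p zero            e = e []
∑ℝ-cong p (suc n) {f} {g} e = sumℝ-cong p
  {λ a → ∑ℝ λ x → f (a ∷ x)} {λ a → VectorSums.∑ ℂₚ.R.semiring p λ x → g (a ∷ x)}
  λ a → ∑ℝ-cong p n {λ x → f (a ∷ x)} {λ x → g (a ∷ x)} λ x → e (a ∷ x)

-- The instances are explicit because unsolved ones defeat the syntactic comparison of types.
module Instance (p n : ℕ) .{{nz : NonZero p}} (p-prime : Prime p) (2<p : 2 < p)
  {π : ℝ} (isPi : IsPi π) {ω : ℂ} (ω-exp : ω IsExpOf 2πi/ p {{nz}} π) where

  root : RootOfUnity ℂ-field p
  root = record
    { ω = ω
    ; ω^p≈1 = ω^p p {{nz}} {π} isPi {ω} {2πi/ p {{nz}} π} ≡.refl ω-exp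
    ; ω*conj≈1 = ω*conj p {{nz}} {π} isPi {ω} {2πi/ p {{nz}} π} ≡.refl ω-exp
    ; ω≉1 = ω≄1 p {{nz}} {π} isPi {ω} {2πi/ p {{nz}} π} ≡.refl ω-exp 2<p }

  open FourierAnalysis ℂ-field p n p-prime root using (1/pⁿ; module ΣR)
  open DecisionTrees ℂ-field p n p-prime 2<p root using (sgn)
  open SpectralBound ℂ-field p n p-prime 2<p root using (spectral-theorem)

  open ΣR using () renaming (∑ to ∑ᴿ)

  ⟦⟧≃sgn : ∀ σ → ⟦ σ ⟧ ≃ℂ sgn σ
  ⟦⟧≃sgn Sign.+ = ℂₚ.refl {1ℂ}
  ⟦⟧≃sgn Sign.- = ℂₚ.refl { -ℂ 1ℂ}

  module _ (f : ℤ^ p n → Sign) where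

    term : ℤ^ p n → ℤ^ p n → ℂ
    term α x = ⟦ f x ⟧ *ℂ conj (χ {p} {{nz}} ω α x)

    term≃ : ∀ α x → term α x ≃ℂ sgn (f x) *ℂ conj (χ {p} {{nz}} ω α x)
    term≃ α x = *ℂ-cong {⟦ f x ⟧} {sgn (f x)} {conj (χ {p} {{nz}} ω α x)} {conj (χ {p} {{nz}} ω α x)}
      (⟦⟧≃sgn (f x)) (ℂₚ.refl {conj (χ {p} {{nz}} ω α x)})

    sums≃ : ∀ α → ∑ℂ (term α) ≃ℂ VectorSums.∑ ℂₚ.semiring p (term α)
    sums≃ α = ∑ℂ-cong p n {term α} {term α} λ x → ℂₚ.refl {term α x}

    unfolded : ℤ^ p n → ℂ
    unfolded α = fromℝ (fromℚ 1/pⁿ) *ℂ ∑ℂ (λ x → ⟦ f x ⟧ *ℂ conj (χ {p} {{nz}} ω α x))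

    fourier≃unfolded : ∀ α → fourier {p} {{nz}} ω (λ x → ⟦ f x ⟧) α ≃ℂ unfolded α
    fourier≃unfolded α = pointwise-≃ℂ {fourier {p} {{nz}} ω (λ x → ⟦ f x ⟧) α} {unfolded α} (λ _ → ≡.refl) (λ _ → ≡.refl)

    tree : ∀ {f̂ : ℤ^ p n → ℂ} → (∀ α → f̂ α ≃ℂ unfolded α) → ∀ {A s ℓ} → ‖ f̂ ‖₁ ≃ℝ A →
      HasCardinality (λ α → ¬ (f̂ α ≃ℂ 0ℂ)) s → ℓ IsLogOf s →
      ∃[ T ] (_Computes_ {p} {n} {{nz}} T f) × (fromℕ (depth T) ≤ℝ fromℕ 72 *ℝ (A *ℝ A) *ℝ ℓ)
    tree {f̂} f̂≃ {A} {s} {ℓ} norm≃A (as , unique , as⇔ , ≡.refl) log =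
      spectral-theorem f {f̂} {λ α → ∑ℂ (term α)} {term} {fromℝ (fromℚ 1/pⁿ)}
        {expPartial (fromℝ ℓ)} {expPartial-term (fromℝ ℓ)} {A} {as} {ℓ}
        f̂≃ (ℂₚ.refl {fromℝ (fromℚ 1/pⁿ)}) sums≃ term≃
        (≃ℝ-trans {∑ᴿ (λ α → ∣ f̂ α ∣ℂ)} {‖ f̂ ‖₁} {A} (≃ℝ-sym {‖ f̂ ‖₁} {∑ᴿ (λ α → ∣ f̂ α ∣ℂ)} norm≃) norm≃A)
        unique as⇔ log (expPartial≃ (fromℝ ℓ)) (expPartial-term≃ (fromℝ ℓ))
      where
      norm≃ : ‖ f̂ ‖₁ ≃ℝ ∑ᴿ (λ α → ∣ f̂ α ∣ℂ)
      norm≃ = ∑ℝ-cong p n {λ α → ∣ f̂ α ∣ℂ} {λ α → ∣ f̂ α ∣ℂ} λ α → ℂₚ.R.refl {∣ f̂ α ∣ℂ}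

theorem4p10 : ∃[ K ] (0ℝ <ℝ K) ×
    (∀ (p n : ℕ) .{{_ : NonZero p}} → Prime p → 2 < p → 1 ≤ n →
    ∀ (π : ℝ) → IsPi π →
    ∀ (ω : ℂ) → ω IsExpOf (2πi/ p π) →
    ∀ (f : ℤ^ p n → Sign) (A : ℝ) (s : ℕ) →
    ‖ fourier ω (λ x → ⟦ f x ⟧) ‖₁ ≃ℝ A →
    HasCardinality (λ α → ¬ (fourier ω (λ x → ⟦ f x ⟧) α ≃ℂ 0ℂ)) s →
    ∀ (log-s : ℝ) → log-s IsLogOf s →
    ∃[ T ] (T Computes f) × (fromℕ (depth T) ≤ℝ K *ℝ (A *ℝ A) *ℝ log-s))
theorem4p10 = fromℕ 72 ,
  (ℚ.1ℚ , ℚₚ.positive⁻¹ ℚ.1ℚ , always λ _ → from-yes (ℚ.0ℚ ℚ.+ ℚ.1ℚ ℚₚ.≤? + 72 ℚ./ 1)) ,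
  λ p n {{nz}} p-prime 2<p _ π isPi ω ω-exp f A s norm≃A card ℓ log →
    let open Instance p n {{nz}} p-prime 2<p {π} isPi {ω} ω-exp
    in tree f {fourier {p} {{nz}} ω (λ x → ⟦ f x ⟧)} (fourier≃unfolded f) {A} {s} {ℓ} norm≃A card log
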